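{- Every $\mathbb{F}_q$-linear set of rank $4$ of $\mathrm{PG}(1,q^4)$ with maximum field of linearity $\mathbb{F}_q$ is simple.
   Context: $q$ is a prime power, $W=\mathbb{F}_{q^4}^2$ and $\mathrm{PG}(1,q^4)=\mathrm{PG}(W,\mathbb{F}_{q^4})$. For an $\mathbb{F}_q$-subspace $U$ of $W$, $L_U=\{\langle \mathbf{u}\rangle_{\mathbb{F}_{q^4}} \colon \mathbf{u}\in U\setminus\{\mathbf{0}\}\}$ is an $\mathbb{F}_q$-linear set of rank $\dim_{\mathbb{F}_q}U$. A linear set $L$ is $\mathbb{F}_{q^t}$-linear if $L=L_{U'}$ for an $\mathbb{F}_{q^t}$-subspace $U'$ of $W$, and its maximum field of linearity is $\mathbb{F}_{q^t}$ for the largest such $t$. An $\mathbb{F}_q$-linear set $L_U$ with maximum field of linearity $\mathbb{F}_q$ is simple if for every $\mathbb{F}_q$-subspace $V$ of $W$ with $\dim_{\mathbb{F}_q}V=\dim_{\mathbb{F}_q}U$ and $L_V=L_U$ there exists $g\in\mathrm{\Gamma L}(W,\mathbb{F}_{q^4})$ with $U^g=V$. -}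

module Defs where

open import Level using (0ℓ)
open import Data.Nat as ℕ using (ℕ; zero; suc; _<_)
open import Data.Nat.Divisibility using (_∣_)
open import Data.Nat.Primality using (Prime)
open import Data.Fin using (Fin)
import Data.Fin as F
open import Data.Product using (proj₁; Σ; ∃; ∃-syntax; _×_; _,_)
open import Function.Bundles using (_↔_)
open import Function.Definitions using (Injective; Surjective)
open import Relation.Binary.PropositionalEquality using (_≡_; _≢_)
open import Relation.Nullary using (¬_)
open import Algebra.Structures using (IsCommutativeRing)

IsPrimePower : ℕ → Set
IsPrimePower q = Σ ℕ λ p → Σ ℕ λ k → Prime p × q ≡ p ℕ.^ suc k

record Field : Set₁ where
  infixl 7 _*_
  infixl 6 _+_
  field
    Carrier : Set
    _+_ _*_ : Carrier → Carrier → Carrier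
    -_ : Carrier → Carrier
    0# 1# : Carrier
    isCommutativeRing : IsCommutativeRing _≡_ _+_ _*_ -_ 0# 1#
    0≢1 : 0# ≢ 1#
    inverse : ∀ x → x ≢ 0# → ∃[ y ] (x * y ≡ 1#)

  _^_ : Carrier → ℕ → Carrier
  x ^ zero = 1#
  x ^ suc n = x * (x ^ n)

HasSize : Field → ℕ → Set
HasSize K n = Field.Carrier K ↔ Fin n

module Geometry (K : Field) (q : ℕ) where
  open Field K

  -- the subfield F_{q^t} of K = F_{q^4}: fixed points of x ↦ x^(q^t)
  InSubfield : ℕ → Carrier → Set
  InSubfield t x = x ^ (q ℕ.^ t) ≡ x

  -- W = K², the underlying vector space of PG(1,q^4)
  W : Set
  W = Carrier × Carrier

  𝟎 : W
  𝟎 = 0# , 0#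

  _⊕_ : W → W → W
  (a , b) ⊕ (c , d) = (a + c) , (b + d)

  _·_ : Carrier → W → W
  λ' · (a , b) = (λ' * a) , (λ' * b)

  SubsetW : Set₁
  SubsetW = W → Set

  record IsSubspace (t : ℕ) (U : SubsetW) : Set where
    field
      zero-mem : U 𝟎
      add-mem  : ∀ {u v} → U u → U v → U (u ⊕ v)
      smul-mem : ∀ {λ' u} → InSubfield t λ' → U u → U (λ' · u)

  lincomb : ∀ {n} → (Fin n → Carrier) → (Fin n → W) → W
  lincomb {zero}  c b = 𝟎
  lincomb {suc n} c b = (c F.zero · b F.zero) ⊕ lincomb (λ i → c (F.suc i)) (λ i → b (F.suc i))

  Coeffs : ℕ → ℕ → Set
  Coeffs t n = Σ (Fin n → Carrier) λ c → ∀ i → InSubfield t (c i)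

  record IsBasis (t : ℕ) (U : SubsetW) {n : ℕ} (b : Fin n → W) : Set where
    field
      spans : ∀ u → U u → Σ (Coeffs t n) λ c → u ≡ lincomb (proj₁ c) b
      in-U  : ∀ i → U (b i)
      indep : (c : Coeffs t n) → lincomb (proj₁ c) b ≡ 𝟎 → ∀ i → proj₁ c i ≡ 0#

  HasDim : ℕ → SubsetW → ℕ → Set
  HasDim t U n = Σ (Fin n → W) (IsBasis t U)

  -- ⟨w⟩_{F_{q^4}} ∈ L_U  (for w ≠ 0)
  InLinSet : SubsetW → W → Set
  InLinSet U w = Σ W λ u → U u × u ≢ 𝟎 × ∃[ λ' ] (u ≡ λ' · w)

  SameLinSet : SubsetW → SubsetW → Set
  SameLinSet U V = ∀ w → w ≢ 𝟎 → (InLinSet U w → InLinSet V w) × (InLinSet V w → InLinSet U w)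

  IsLinearOver : ℕ → SubsetW → Set₁
  IsLinearOver t U = Σ SubsetW λ U' → IsSubspace t U' × SameLinSet U' U

  -- maximum field of linearity of L_U is F_q: L_U is not F_{q^t}-linear
  -- for any proper extension F_{q^t} of F_q inside F_{q^4} (t ∣ 4, t > 1)
  MaxFieldIsFq : SubsetW → Set₁
  MaxFieldIsFq U = ∀ t → t ∣ 4 → 1 < t → ¬ IsLinearOver t U

  record IsFieldAut (σ : Carrier → Carrier) : Set where
    field
      pres-+ : ∀ x y → σ (x + y) ≡ σ x + σ y
      pres-* : ∀ x y → σ (x * y) ≡ σ x * σ y
      pres-1 : σ 1# ≡ 1#
      inj    : Injective _≡_ _≡_ σ
      surj   : Surjective _≡_ _≡_ σ

  record IsΓL (g : W → W) : Set where
    field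
      σ      : Carrier → Carrier
      σ-aut  : IsFieldAut σ
      additive : ∀ u v → g (u ⊕ v) ≡ g u ⊕ g v
      semilin  : ∀ λ' u → g (λ' · u) ≡ σ λ' · g u
      inj    : Injective _≡_ _≡_ g
      surj   : Surjective _≡_ _≡_ g

  ImageIs : (W → W) → SubsetW → SubsetW → Set
  ImageIs g U V = ∀ w → (V w → Σ W λ u → U u × g u ≡ w) × (Σ W (λ u → U u × g u ≡ w) → V w)

  IsSimple : SubsetW → Set₁
  IsSimple U = ∀ (V : SubsetW) (n : ℕ) → IsSubspace 1 V → HasDim 1 U n → HasDim 1 V n →
               SameLinSet U V → Σ (W → W) λ g → IsΓL g × ImageIs g U V

{-# OPTIONS --safe #-}
-- Write φ for x ↦ x^q, F and E for the fixed fields of φ and φ².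
--
-- A point off L_U exists by counting; sending it to ⟨(0,1)⟩ turns U into the graph of a
-- φ-polynomial f = a₀ + a₁φ + a₂φ² + a₃φ³, and every V with L_V = L_U into the graph of some g.
-- The linear set is the set of values f(x)/x, and the value z is attained |ker(f - z)| - 1
-- times, which is -1 in K.  So the sums of f(x)/x and of its products with its conjugates
-- depend only on the linear set.  Orthogonality of characters evaluates them: f and g have
-- the same a₀, and after subtracting it the same a₁φ(a₃), a₂φ²(a₂) and A + B, where
-- A = a₁φ(a₁)φ²(a₂), B = a₂φ(a₃)φ²(a₃).  Since AB is a function of the first two, {A, B} is
-- an invariant.  If A is the same for f and g, then Hilbert 90 yields λ with g(x) = f(λx)/λ;
-- otherwise this holds for the adjoint of f, for which A and B are exchanged.
--
-- It remains to map U to the graph of the adjoint, which is the orthogonal complement of U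
-- for the trace of the determinant form.  An isomorphism is the same as a nondegenerate
-- K-bilinear form on K² whose trace vanishes on U.  Symmetric solutions form an F-space of
-- dimension at least 2, and if all are degenerate then f maps, up to equivalence, into a
-- multiple of E, where a nondegenerate solution can be written down.  When a₂ = 0 everything
-- is explicit.
module Submission where

open import Defs
open import Level using (0ℓ)
open import Algebra.Bundles using (CommutativeMonoid; CommutativeRing)
import Algebra.Properties.CommutativeMonoid.Sum as MonoidSum
import Algebra.Properties.CommutativeSemiring.Binomial as Binomial
import Algebra.Properties.CommutativeSemiring.Exp as Exp
import Algebra.Properties.Ring as RingProperties
import Algebra.Properties.Semiring.Mult as Mult
import Algebra.Properties.Semiring.Sum as SemiringSum
open import Data.Bool using (Bool; true; false; not; if_then_else_)
open import Data.Fin as F using (Fin; zero; suc; punchIn; punchOut; inject₁)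
open import Data.Fin.Patterns
open import Data.Fin.Permutation using (permutation)
import Data.Fin.Properties as F
open import Data.List using (List; []; _∷_)
open import Data.List.Membership.Propositional using (_∈_)
import Data.List.Membership.DecPropositional as DecMembership
open import Data.List.Relation.Unary.All as All using ([]; _∷_)
import Data.List.Properties as List
open import Data.Nat as ℕ using (ℕ; zero; suc; z≤n; s≤s)
open import Data.Nat.Combinatorics using (_C_; nC1≡n; nCn≡1; k>n⇒nCk≡0; nCk+nC[k+1]≡[n+1]C[k+1])
open import Data.Nat.Divisibility using (_∣_; divides; m∣m*n; >⇒∤)
open import Data.Nat.Primality using (Prime; euclidsLemma; prime⇒nonZero; prime⇒nonTrivial)
import Data.Nat.Properties as ℕ
import Data.Nat.Solver as ℕSolver
open import Data.Product using (_×_; _,_; proj₁; proj₂; ∃; ∃-syntax; ∃₂; Σ)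
import Data.Product.Properties as Product
open import Data.Sum using (_⊎_; inj₁; inj₂)
open import Data.Vec as Vec using (Vec; []; _∷_)
open import Data.Vec.Functional using (tail; init; last)
open import Data.Vec.N-ary using (N-ary; _$ⁿ_; curryⁿ; Eq; curryⁿ-cong)
open import Function using (_∘_; id)
open import Function.Bundles using (Inverse)
open import Relation.Binary.PropositionalEquality using (_≡_; _≢_; _≗_; refl; sym; trans; cong; cong₂; subst; module ≡-Reasoning)
open import Relation.Nullary using (Dec; yes; no; ¬_; contradiction; ¬?)
open import Relation.Nullary.Decidable using (map′; _×-dec_; _⊎-dec_; from-yes; does; decidable-stable)

-- No finer invariant can separate A from B: f - z and its adjoint have the same rank, so f and its
-- adjoint have the same linear set. The theorem itself therefore demands an equivalence between
-- their graphs, and in general it is not diagonal. The forms are parametrised by β in K and ε in a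
-- 2-dimensional F-space, subject to one equation in K, whence dimension at least 4 + 2 - 4. Two
-- F-independent degenerate forms are enough. Each is β(y + μx)(y′ + μx′); for different μ the sum
-- has determinant β₁β₂(μ₁ - μ₂)², and for equal μ the Dickson matrix of f + μ makes the two β
-- proportional over F, unless its columns 0 and 2 are parallel, which is the case of values in a
-- multiple of E. Nothing is ever divided by 2, so characteristic 2 is not exceptional. When a₂ = 0
-- both A and B vanish and the invariants retain too little; one particular value of f(x)/x is then
-- compared directly.

module FieldRing (K : Field) where

  commutativeRing : CommutativeRing 0ℓ 0ℓ
  commutativeRing = record { isCommutativeRing = Field.isCommutativeRing K }

  open CommutativeRing commutativeRing public
    using (_-_; ring; semiring; commutativeSemiring; +-commutativeMonoid; *-commutativeMonoid;
           +-assoc; +-comm; +-identityˡ; +-identityʳ; *-assoc; *-comm; *-identityˡ; *-identityʳ;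
           -‿inverseˡ; -‿inverseʳ; distribˡ; distribʳ; zeroˡ; zeroʳ)
  open RingProperties ring public
    using (-0#≈0#; -‿distribˡ-*; -‿distribʳ-*; -‿involutive; -‿+-comm)

-- Ring endomorphisms with φ⁴ = id, and a solver for their identities.

record Frobenius (K : Field) : Set where
  open Field K
  field
    φ   : Carrier → Carrier
    φ-+ : ∀ x y → φ (x + y) ≡ φ x + φ y
    φ-* : ∀ x y → φ (x * y) ≡ φ x * φ y
    φ-1 : φ 1# ≡ 1#
    φ⁴  : ∀ x → φ (φ (φ (φ x))) ≡ x

-- With φ the identity the solver below is an ordinary commutative ring solver, available before any
-- Frobenius map has been constructed.
identity : (K : Field) → Frobenius K
identity K = record { φ = id ; φ-+ = λ _ _ → refl ; φ-* = λ _ _ → refl ; φ-1 = refl ; φ⁴ = λ _ → refl }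

-- Decides identities in the ring operations and φ.
module FrobeniusSolver (K : Field) (frobenius : Frobenius K) where

  open Field K
  open FieldRing K
  open Frobenius frobenius
  open ≡-Reasoning

  φ-0 : φ 0# ≡ 0#
  φ-0 = begin
    φ 0#                         ≡⟨ +-identityʳ _ ⟨
    φ 0# + 0#                    ≡⟨ cong (φ 0# +_) (-‿inverseʳ (φ 0#)) ⟨
    φ 0# + (φ 0# + - φ 0#)       ≡⟨ +-assoc _ _ _ ⟨
    φ 0# + φ 0# + - φ 0#         ≡⟨ cong (_+ - φ 0#) (φ-+ 0# 0#) ⟨
    φ (0# + 0#) + - φ 0#         ≡⟨ cong (λ z → φ z + - φ 0#) (+-identityʳ 0#) ⟩
    φ 0# + - φ 0#                ≡⟨ -‿inverseʳ _ ⟩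
    0#                           ∎

  φ-neg : ∀ x → φ (- x) ≡ - φ x
  φ-neg x = begin
    φ (- x)                      ≡⟨ +-identityʳ _ ⟨
    φ (- x) + 0#                 ≡⟨ cong (φ (- x) +_) (-‿inverseʳ (φ x)) ⟨
    φ (- x) + (φ x + - φ x)      ≡⟨ +-assoc _ _ _ ⟨
    φ (- x) + φ x + - φ x        ≡⟨ cong (_+ - φ x) (φ-+ (- x) x) ⟨
    φ (- x + x) + - φ x          ≡⟨ cong (λ z → φ z + - φ x) (-‿inverseˡ x) ⟩
    φ 0# + - φ x                 ≡⟨ cong (_+ - φ x) φ-0 ⟩
    0# + - φ x                   ≡⟨ +-identityˡ _ ⟩
    - φ x                        ∎

  infixl 6 _:+_ _:-_
  infixl 7 _:*_
  infix 8 :-_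

  data Expr (n : ℕ) : Set where
    var       : Fin n → Expr n
    O I       : Expr n
    _:+_ _:*_ : Expr n → Expr n → Expr n
    :-_ Φ     : Expr n → Expr n

  _:-_ : ∀ {n} → Expr n → Expr n → Expr n
  e₁ :- e₂ = e₁ :+ :- e₂

  Φ² Φ³ : ∀ {n} → Expr n → Expr n
  Φ² e = Φ (Φ e)
  Φ³ e = Φ (Φ (Φ e))

  ⟦_⟧ : ∀ {n} → Expr n → Vec Carrier n → Carrier
  ⟦ var i ⟧    ρ = Vec.lookup ρ i
  ⟦ O ⟧        ρ = 0#
  ⟦ I ⟧        ρ = 1#
  ⟦ e₁ :+ e₂ ⟧ ρ = ⟦ e₁ ⟧ ρ + ⟦ e₂ ⟧ ρ
  ⟦ e₁ :* e₂ ⟧ ρ = ⟦ e₁ ⟧ ρ * ⟦ e₂ ⟧ ρ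
  ⟦ :- e ⟧     ρ = - ⟦ e ⟧ ρ
  ⟦ Φ e ⟧      ρ = φ (⟦ e ⟧ ρ)

  -- The atom 4i + k stands for φᵏ of the i-th variable.  A polynomial is a
  -- list of signed monomials without cancelling pairs.
  Mono Poly : Set
  Mono = List ℕ
  Poly = List (Bool × Mono)

  atom : ∀ {n} → Fin n → ℕ
  atom zero    = 0
  atom (suc i) = 4 ℕ.+ atom i

  rotate : ℕ → ℕ
  rotate 0 = 1
  rotate 1 = 2
  rotate 2 = 3
  rotate 3 = 0
  rotate (suc (suc (suc (suc c)))) = 4 ℕ.+ rotate c

  insertAtom : ℕ → Mono → Mono
  insertAtom c []      = c ∷ []
  insertAtom c (d ∷ m) = if c ℕ.≤ᵇ d then c ∷ d ∷ m else d ∷ insertAtom c m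

  mulMono : Mono → Mono → Mono
  mulMono []      m′ = m′
  mulMono (c ∷ m) m′ = insertAtom c (mulMono m m′)

  rotateMono : Mono → Mono
  rotateMono []      = []
  rotateMono (c ∷ m) = insertAtom (rotate c) (rotateMono m)

  -- The order of terms is irrelevant, because `solve` only asks whether the normal form of a
  -- difference is `[]`. Multiplicities are repeated terms, so no coefficient arithmetic occurs.
  insertTerm : Bool → Mono → Poly → Poly
  insertTerm b m [] = (b , m) ∷ []
  insertTerm true  m ((true  , m′) ∷ p) = (true , m′) ∷ insertTerm true m p
  insertTerm false m ((false , m′) ∷ p) = (false , m′) ∷ insertTerm false m p
  insertTerm true  m ((false , m′) ∷ p) with List.≡-dec ℕ._≟_ m m′
  ... | yes _ = p
  ... | no  _ = (false , m′) ∷ insertTerm true m p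
  insertTerm false m ((true  , m′) ∷ p) with List.≡-dec ℕ._≟_ m m′
  ... | yes _ = p
  ... | no  _ = (true , m′) ∷ insertTerm false m p

  addPoly : Poly → Poly → Poly
  addPoly []            p′ = p′
  addPoly ((b , m) ∷ p) p′ = addPoly p (insertTerm b m p′)

  negPoly rotatePoly : Poly → Poly
  negPoly []            = []
  negPoly ((b , m) ∷ p) = (not b , m) ∷ negPoly p
  rotatePoly []            = []
  rotatePoly ((b , m) ∷ p) = (b , rotateMono m) ∷ rotatePoly p

  mulTerm : Bool → Mono → Poly → Poly
  mulTerm b m []              = []
  mulTerm b m ((b′ , m′) ∷ p) = ((if b then not b′ else b′) , mulMono m m′) ∷ mulTerm b m p

  mulPoly : Poly → Poly → Poly
  mulPoly []            p′ = []
  mulPoly ((b , m) ∷ p) p′ = addPoly (mulTerm b m p′) (mulPoly p p′)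

  normalise : ∀ {n} → Expr n → Poly
  normalise (var i)    = (false , atom i ∷ []) ∷ []
  normalise O          = []
  normalise I          = (false , []) ∷ []
  normalise (e₁ :+ e₂) = addPoly (normalise e₁) (normalise e₂)
  normalise (e₁ :* e₂) = mulPoly (normalise e₁) (normalise e₂)
  normalise (:- e)     = negPoly (normalise e)
  normalise (Φ e)      = rotatePoly (normalise e)

  module _ {n} (ρ : Vec Carrier n) where

    atomValue : ∀ {n} → Vec Carrier n → ℕ → Carrier
    atomValue []      c = 0#
    atomValue (x ∷ ρ) 0 = x
    atomValue (x ∷ ρ) 1 = φ x
    atomValue (x ∷ ρ) 2 = φ (φ x)
    atomValue (x ∷ ρ) 3 = φ (φ (φ x))
    atomValue (x ∷ ρ) (suc (suc (suc (suc c)))) = atomValue ρ c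

    monoValue : Mono → Carrier
    monoValue []      = 1#
    monoValue (c ∷ m) = atomValue ρ c * monoValue m

    termValue : Bool → Carrier → Carrier
    termValue true  x = - x
    termValue false x = x

    polyValue : Poly → Carrier
    polyValue []            = 0#
    polyValue ((b , m) ∷ p) = termValue b (monoValue m) + polyValue p

    atom-correct : ∀ {n} (ρ : Vec Carrier n) i → atomValue ρ (atom i) ≡ Vec.lookup ρ i
    atom-correct (x ∷ ρ) zero    = refl
    atom-correct (x ∷ ρ) (suc i) = atom-correct ρ i

    rotate-correct : ∀ {n} (ρ : Vec Carrier n) c → atomValue ρ (rotate c) ≡ φ (atomValue ρ c)
    rotate-correct []      c = sym φ-0
    rotate-correct (x ∷ ρ) 0 = refl
    rotate-correct (x ∷ ρ) 1 = refl
    rotate-correct (x ∷ ρ) 2 = refl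
    rotate-correct (x ∷ ρ) 3 = sym (φ⁴ x)
    rotate-correct (x ∷ ρ) (suc (suc (suc (suc c)))) = rotate-correct ρ c

    swap-* : ∀ x y z → x * (y * z) ≡ y * (x * z)
    swap-* x y z = trans (sym (*-assoc x y z)) (trans (cong (_* z) (*-comm x y)) (*-assoc y x z))

    swap-+ : ∀ x y z → x + (y + z) ≡ y + (x + z)
    swap-+ x y z = trans (sym (+-assoc x y z)) (trans (cong (_+ z) (+-comm x y)) (+-assoc y x z))

    insertAtom-correct : ∀ c m → monoValue (insertAtom c m) ≡ atomValue ρ c * monoValue m
    insertAtom-correct c []      = refl
    insertAtom-correct c (d ∷ m) with c ℕ.≤ᵇ d
    ... | true  = refl
    ... | false = trans (cong (atomValue ρ d *_) (insertAtom-correct c m)) (swap-* _ _ _)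

    mulMono-correct : ∀ m m′ → monoValue (mulMono m m′) ≡ monoValue m * monoValue m′
    mulMono-correct []      m′ = sym (*-identityˡ _)
    mulMono-correct (c ∷ m) m′ = trans (insertAtom-correct c (mulMono m m′))
      (trans (cong (atomValue ρ c *_) (mulMono-correct m m′)) (sym (*-assoc _ _ _)))

    rotateMono-correct : ∀ m → monoValue (rotateMono m) ≡ φ (monoValue m)
    rotateMono-correct []      = sym φ-1
    rotateMono-correct (c ∷ m) = trans (insertAtom-correct (rotate c) (rotateMono m))
      (trans (cong₂ _*_ (rotate-correct ρ c) (rotateMono-correct m)) (sym (φ-* _ _)))

    cancel-neg-pos : ∀ x y → y ≡ - x + (x + y)
    cancel-neg-pos x y = begin
      y               ≡⟨ +-identityˡ y ⟨
      0# + y          ≡⟨ cong (_+ y) (-‿inverseˡ x) ⟨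
      - x + x + y     ≡⟨ +-assoc _ _ _ ⟩
      - x + (x + y)   ∎

    cancel-pos-neg : ∀ x y → y ≡ x + (- x + y)
    cancel-pos-neg x y = trans (cancel-neg-pos x y) (swap-+ _ _ _)

    insertTerm-correct : ∀ b m p → polyValue (insertTerm b m p) ≡ termValue b (monoValue m) + polyValue p
    insertTerm-correct b m [] = refl
    insertTerm-correct true m ((true , m′) ∷ p) =
      trans (cong (- monoValue m′ +_) (insertTerm-correct true m p)) (swap-+ _ _ _)
    insertTerm-correct false m ((false , m′) ∷ p) =
      trans (cong (monoValue m′ +_) (insertTerm-correct false m p)) (swap-+ _ _ _)
    insertTerm-correct true m ((false , m′) ∷ p) with List.≡-dec ℕ._≟_ m m′
    ... | yes refl = cancel-neg-pos (monoValue m) (polyValue p)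
    ... | no _ = trans (cong (monoValue m′ +_) (insertTerm-correct true m p)) (swap-+ _ _ _)
    insertTerm-correct false m ((true , m′) ∷ p) with List.≡-dec ℕ._≟_ m m′
    ... | yes refl = cancel-pos-neg (monoValue m) (polyValue p)
    ... | no _ = trans (cong (- monoValue m′ +_) (insertTerm-correct false m p)) (swap-+ _ _ _)

    addPoly-correct : ∀ p p′ → polyValue (addPoly p p′) ≡ polyValue p + polyValue p′
    addPoly-correct []            p′ = sym (+-identityˡ _)
    addPoly-correct ((b , m) ∷ p) p′ = begin
      polyValue (addPoly p (insertTerm b m p′))               ≡⟨ addPoly-correct p _ ⟩
      polyValue p + polyValue (insertTerm b m p′)             ≡⟨ cong (polyValue p +_) (insertTerm-correct b m p′) ⟩
      polyValue p + (termValue b (monoValue m) + polyValue p′) ≡⟨ swap-+ _ _ _ ⟩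
      termValue b (monoValue m) + (polyValue p + polyValue p′) ≡⟨ +-assoc _ _ _ ⟨
      termValue b (monoValue m) + polyValue p + polyValue p′   ∎

    termValue-not : ∀ b x → termValue (not b) x ≡ - termValue b x
    termValue-not true  x = sym (-‿involutive x)
    termValue-not false x = refl

    termValue-φ : ∀ b x → termValue b (φ x) ≡ φ (termValue b x)
    termValue-φ true  x = sym (φ-neg x)
    termValue-φ false x = refl

    termValue-* : ∀ b b′ x y → termValue (if b then not b′ else b′) (x * y) ≡ termValue b x * termValue b′ y
    termValue-* true  true  x y = begin
      x * y            ≡⟨ cong (_* y) (-‿involutive x) ⟨
      - (- x) * y      ≡⟨ -‿distribˡ-* (- x) y ⟨
      - (- x * y)      ≡⟨ -‿distribʳ-* (- x) y ⟩
      - x * - y        ∎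
    termValue-* true  false x y = -‿distribˡ-* x y
    termValue-* false true  x y = -‿distribʳ-* x y
    termValue-* false false x y = refl

    negPoly-correct : ∀ p → polyValue (negPoly p) ≡ - polyValue p
    negPoly-correct []            = sym -0#≈0#
    negPoly-correct ((b , m) ∷ p) =
      trans (cong₂ _+_ (termValue-not b _) (negPoly-correct p)) (-‿+-comm _ _)

    rotatePoly-correct : ∀ p → polyValue (rotatePoly p) ≡ φ (polyValue p)
    rotatePoly-correct []            = sym φ-0
    rotatePoly-correct ((b , m) ∷ p) =
      trans (cong₂ _+_ (trans (cong (termValue b) (rotateMono-correct m)) (termValue-φ b _)) (rotatePoly-correct p))
            (sym (φ-+ _ _))

    mulTerm-correct : ∀ b m p → polyValue (mulTerm b m p) ≡ termValue b (monoValue m) * polyValue p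
    mulTerm-correct b m []              = sym (zeroʳ _)
    mulTerm-correct b m ((b′ , m′) ∷ p) =
      trans (cong₂ _+_ (trans (cong (termValue (if b then not b′ else b′)) (mulMono-correct m m′)) (termValue-* b b′ _ _)) (mulTerm-correct b m p))
            (sym (distribˡ _ _ _))

    mulPoly-correct : ∀ p p′ → polyValue (mulPoly p p′) ≡ polyValue p * polyValue p′
    mulPoly-correct []            p′ = sym (zeroˡ _)
    mulPoly-correct ((b , m) ∷ p) p′ =
      trans (addPoly-correct (mulTerm b m p′) _)
        (trans (cong₂ _+_ (mulTerm-correct b m p′) (mulPoly-correct p p′)) (sym (distribʳ _ _ _)))

    normalise-correct : ∀ e → polyValue (normalise e) ≡ ⟦ e ⟧ ρ
    normalise-correct (var i)    = trans (+-identityʳ _) (trans (*-identityʳ _) (atom-correct ρ i))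
    normalise-correct O          = refl
    normalise-correct I          = +-identityʳ _
    normalise-correct (e₁ :+ e₂) = trans (addPoly-correct (normalise e₁) _)
      (cong₂ _+_ (normalise-correct e₁) (normalise-correct e₂))
    normalise-correct (e₁ :* e₂) = trans (mulPoly-correct (normalise e₁) _)
      (cong₂ _*_ (normalise-correct e₁) (normalise-correct e₂))
    normalise-correct (:- e)     = trans (negPoly-correct (normalise e)) (cong -_ (normalise-correct e))
    normalise-correct (Φ e)      = trans (rotatePoly-correct (normalise e)) (cong φ (normalise-correct e))

  x-y≡0⇒x≡y : ∀ {x y} → x - y ≡ 0# → x ≡ y
  x-y≡0⇒x≡y {x} {y} x-y≡0 = begin
    x              ≡⟨ +-identityʳ x ⟨
    x + 0#         ≡⟨ cong (x +_) (-‿inverseˡ y) ⟨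
    x + (- y + y)  ≡⟨ +-assoc _ _ _ ⟨
    x - y + y      ≡⟨ cong (_+ y) x-y≡0 ⟩
    0# + y         ≡⟨ +-identityˡ y ⟩
    y              ∎

  infix 4 _:=_
  _:=_ : ∀ {n} → Expr n → Expr n → Expr n × Expr n
  _:=_ = _,_

  close : ∀ n → N-ary n (Expr n) (Expr n × Expr n) → Expr n × Expr n
  close n f = f $ⁿ Vec.map var (Vec.allFin n)

  solve : ∀ n (f : N-ary n (Expr n) (Expr n × Expr n)) →
          normalise (proj₁ (close n f) :- proj₂ (close n f)) ≡ [] →
          Eq n _≡_ (curryⁿ ⟦ proj₁ (close n f) ⟧) (curryⁿ ⟦ proj₂ (close n f) ⟧)
  solve n f eq = curryⁿ-cong _≡_ ⟦ proj₁ (close n f) ⟧ ⟦ proj₂ (close n f) ⟧ λ ρ →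
    x-y≡0⇒x≡y (trans (sym (normalise-correct ρ (proj₁ (close n f) :- proj₂ (close n f)))) (cong (polyValue ρ) eq))

-- Binomial coefficients divisible by a prime.

-- Induction along Pascal's rule. The form without division is what Euclid's lemma consumes in
-- `prime∣binomial`.
[1+k]*[1+n]C[1+k]≡[1+n]*nCk : ∀ n k → suc k ℕ.* (suc n C suc k) ≡ suc n ℕ.* (n C k)
[1+k]*[1+n]C[1+k]≡[1+n]*nCk n zero =
  trans (ℕ.*-identityˡ _) (trans (nC1≡n (suc n)) (sym (ℕ.*-identityʳ (suc n))))
[1+k]*[1+n]C[1+k]≡[1+n]*nCk zero (suc k) = begin
  suc (suc k) ℕ.* (1 C suc (suc k))  ≡⟨ cong (suc (suc k) ℕ.*_) (k>n⇒nCk≡0 {1} {suc (suc k)} (s≤s (s≤s z≤n))) ⟩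
  suc (suc k) ℕ.* 0                  ≡⟨ ℕ.*-zeroʳ (suc (suc k)) ⟩
  1 ℕ.* 0                            ≡⟨ cong (1 ℕ.*_) (k>n⇒nCk≡0 {0} {suc k} (s≤s z≤n)) ⟨
  1 ℕ.* (0 C suc k)                  ∎
  where open ≡-Reasoning
[1+k]*[1+n]C[1+k]≡[1+n]*nCk (suc n) (suc k) = begin
  suc (suc k) ℕ.* (suc (suc n) C suc (suc k))
    ≡⟨ cong (suc (suc k) ℕ.*_) (nCk+nC[k+1]≡[n+1]C[k+1] (suc n) (suc k)) ⟨
  suc (suc k) ℕ.* (c ℕ.+ d)
    ≡⟨ solve 3 (λ k c d → (con 2 :+ k) :* (c :+ d) := c :+ (con 1 :+ k) :* c :+ (con 2 :+ k) :* d) refl k c d ⟩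
  c ℕ.+ suc k ℕ.* c ℕ.+ suc (suc k) ℕ.* d
    ≡⟨ cong₂ (λ x y → c ℕ.+ x ℕ.+ y) ([1+k]*[1+n]C[1+k]≡[1+n]*nCk n k) ([1+k]*[1+n]C[1+k]≡[1+n]*nCk n (suc k)) ⟩
  c ℕ.+ suc n ℕ.* (n C k) ℕ.+ suc n ℕ.* (n C suc k)
    ≡⟨ solve 4 (λ c n x y → c :+ (con 1 :+ n) :* x :+ (con 1 :+ n) :* y := c :+ (con 1 :+ n) :* (x :+ y)) refl c n (n C k) (n C suc k) ⟩
  c ℕ.+ suc n ℕ.* (n C k ℕ.+ n C suc k)
    ≡⟨ cong (λ z → c ℕ.+ suc n ℕ.* z) (nCk+nC[k+1]≡[n+1]C[k+1] n k) ⟩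
  c ℕ.+ suc n ℕ.* c ∎
  where
  open ≡-Reasoning
  open ℕSolver.+-*-Solver
  c = suc n C suc k
  d = suc n C suc (suc k)

-- The prime divides the product in the absorption identity, and `suc k` is positive and smaller
-- than it.
prime∣binomial : ∀ {p} → Prime (suc p) → ∀ k → k ℕ.< p → suc p ∣ suc p C suc k
prime∣binomial {p} pr k k<p
  with euclidsLemma (suc k) (suc p C suc k) pr
         (subst (suc p ∣_) (sym ([1+k]*[1+n]C[1+k]≡[1+n]*nCk p k)) (m∣m*n (p C k)))
... | inj₁ p∣1+k = contradiction p∣1+k (>⇒∤ (s≤s k<p))
... | inj₂ p∣C   = p∣C

-- Sums and products over a finite field.

-- An arbitrary commutative monoid, because both sums and, as `∏`, the product behind x^N = x are
-- needed.
module FiniteSum (K : Field) {N : ℕ} (size : HasSize K N) (M : CommutativeMonoid 0ℓ 0ℓ) where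

  open CommutativeMonoid M using (_≈_; _∙_; ε; identityʳ; ∙-cong)
    renaming (Carrier to A; trans to ≈-trans; reflexive to ≈-reflexive)
  open Field K using (Carrier)
  open Inverse size using (to; from; strictlyInverseˡ; strictlyInverseʳ)
  open MonoidSum M

  ∑ᴷ : (Carrier → A) → A
  ∑ᴷ f = sum (f ∘ from)

  ∑ᴷ-cong : ∀ {f g} → (∀ x → f x ≈ g x) → ∑ᴷ f ≈ ∑ᴷ g
  ∑ᴷ-cong f≈g = sum-cong-≋ (f≈g ∘ from)

  ∑ᴷ-∙ : ∀ f g → ∑ᴷ (λ x → f x ∙ g x) ≈ ∑ᴷ f ∙ ∑ᴷ g
  ∑ᴷ-∙ f g = ∑-distrib-+ (f ∘ from) (g ∘ from)

  ∑ᴷ-comm : ∀ (f : Carrier → Carrier → A) → ∑ᴷ (λ x → ∑ᴷ (f x)) ≈ ∑ᴷ (λ y → ∑ᴷ (λ x → f x y))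
  ∑ᴷ-comm f = ∑-comm (λ i j → f (from i) (from j))

  ∑ᴷ-reindex : ∀ f (h h⁻¹ : Carrier → Carrier) → (∀ x → h (h⁻¹ x) ≡ x) → (∀ x → h⁻¹ (h x) ≡ x) →
               ∑ᴷ f ≈ ∑ᴷ (f ∘ h)
  ∑ᴷ-reindex f h h⁻¹ inverseˡ inverseʳ =
    ≈-trans (∑-permute (f ∘ from) π) (sum-cong-≋ λ i → ≈-reflexive (cong f (strictlyInverseʳ (h (from i)))))
    where
    π = permutation (to ∘ h ∘ from) (to ∘ h⁻¹ ∘ from)
      (λ i → trans (cong (to ∘ h) (strictlyInverseʳ _)) (trans (cong to (inverseˡ _)) (strictlyInverseˡ i)))
      (λ i → trans (cong (to ∘ h⁻¹) (strictlyInverseʳ _)) (trans (cong to (inverseʳ _)) (strictlyInverseˡ i)))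

  ∑ᴷ-single : ∀ f a → (∀ x → x ≢ a → f x ≈ ε) → ∑ᴷ f ≈ f a
  ∑ᴷ-single f a f≈ε = single (f ∘ from) (to a) (cong f (strictlyInverseʳ a))
    (λ j j≢toa → f≈ε (from j) (λ eq → j≢toa (trans (sym (strictlyInverseˡ j)) (cong to eq))))
    where
    single : ∀ {n} (t : Fin n → A) i → t i ≡ f a → (∀ j → j ≢ i → t j ≈ ε) → sum t ≈ f a
    single {suc n} t i ti≡fa others = ≈-trans (sum-remove {i = i} t)
      (≈-trans (∙-cong (≈-reflexive ti≡fa)
        (≈-trans (sum-cong-≋ (λ j → others (punchIn i j) (λ eq → F.punchInᵢ≢i i j eq))) (sum-replicate-zero n)))
        (identityʳ _))

module FiniteField (K : Field) {N : ℕ} (size : HasSize K N) where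

  open Field K
  open FieldRing K
  open Inverse size using (to; from; strictlyInverseˡ; strictlyInverseʳ)
  open FrobeniusSolver K (identity K)
    using (solve; _:=_; _:+_; _:*_; _:-_; :-_; O; I; x-y≡0⇒x≡y)
  open FiniteSum K size +-commutativeMonoid public
  module ∏ = FiniteSum K size *-commutativeMonoid
  open SemiringSum semiring using (*-distribˡ-sum)

  infix 4 _≟_
  _≟_ : (x y : Carrier) → Dec (x ≡ y)
  x ≟ y = map′ (λ eq → trans (sym (strictlyInverseʳ x)) (trans (cong from eq) (strictlyInverseʳ y))) (cong to) (to x F.≟ to y)

  ∃? : {P : Carrier → Set} → (∀ x → Dec (P x)) → Dec (∃ P)
  ∃? {P} P? = map′ (λ (i , p) → from i , p) (λ (x , p) → to x , subst P (sym (strictlyInverseʳ x)) p) (F.any? (P? ∘ from))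

  *-cancelˡ : ∀ {x y z} → x ≢ 0# → x * y ≡ x * z → y ≡ z
  *-cancelˡ {x} {y} {z} x≢0 xy≡xz with inverse x x≢0
  ... | (w , xw≡1) = begin
    y             ≡⟨ *-identityˡ y ⟨
    1# * y        ≡⟨ cong (_* y) xw≡1 ⟨
    x * w * y     ≡⟨ solve 3 (λ x w y → x :* w :* y := w :* (x :* y)) refl x w y ⟩
    w * (x * y)   ≡⟨ cong (w *_) xy≡xz ⟩
    w * (x * z)   ≡⟨ solve 3 (λ x w y → w :* (x :* y) := x :* w :* y) refl x w z ⟩
    x * w * z     ≡⟨ cong (_* z) xw≡1 ⟩
    1# * z        ≡⟨ *-identityˡ z ⟩
    z             ∎
    where open ≡-Reasoning

  xy≡0⇒y≡0 : ∀ {x y} → x ≢ 0# → x * y ≡ 0# → y ≡ 0#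
  xy≡0⇒y≡0 x≢0 xy≡0 = *-cancelˡ x≢0 (trans xy≡0 (sym (zeroʳ _)))

  *-nonzero : ∀ {x y} → x ≢ 0# → y ≢ 0# → x * y ≢ 0#
  *-nonzero x≢0 y≢0 xy≡0 = y≢0 (xy≡0⇒y≡0 x≢0 xy≡0)

  xx≡0⇒x≡0 : ∀ {x} → x * x ≡ 0# → x ≡ 0#
  xx≡0⇒x≡0 {x} xx≡0 with x ≟ 0#
  ... | yes x≡0 = x≡0
  ... | no  x≢0 = xy≡0⇒y≡0 x≢0 xx≡0

  -- Total with value 0 at 0, hence multiplicative everywhere; f(x) * inv x then makes sense at x =
  -- 0 and is 0 there.
  inv : Carrier → Carrier
  inv x with x ≟ 0#
  ... | yes _   = 0#
  ... | no  x≢0 = proj₁ (inverse x x≢0)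

  inv-0 : inv 0# ≡ 0#
  inv-0 with 0# ≟ 0#
  ... | yes _   = refl
  ... | no  0≢0 = contradiction refl 0≢0

  x*inv≡1 : ∀ {x} → x ≢ 0# → x * inv x ≡ 1#
  x*inv≡1 {x} x≢0 with x ≟ 0#
  ... | yes x≡0 = contradiction x≡0 x≢0
  ... | no  x≢0 = proj₂ (inverse x x≢0)

  inv-unique : ∀ {x y} → x * y ≡ 1# → inv x ≡ y
  inv-unique {x} {y} xy≡1 = *-cancelˡ x≢0 (trans (x*inv≡1 x≢0) (sym xy≡1))
    where
    x≢0 : x ≢ 0#
    x≢0 refl = 0≢1 (trans (sym (zeroˡ y)) xy≡1)

  inv≢0 : ∀ {x} → x ≢ 0# → inv x ≢ 0#
  inv≢0 {x} x≢0 inv≡0 = 0≢1 (trans (sym (zeroʳ x)) (trans (cong (x *_) (sym inv≡0)) (x*inv≡1 x≢0)))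

  inv-* : ∀ x y → inv (x * y) ≡ inv x * inv y
  inv-* x y = cases (x ≟ 0#) (y ≟ 0#)
    where
    open ≡-Reasoning
    cases : Dec (x ≡ 0#) → Dec (y ≡ 0#) → inv (x * y) ≡ inv x * inv y
    cases (yes refl) _ = trans (cong inv (zeroˡ y)) (trans inv-0 (sym (trans (cong (_* inv y) inv-0) (zeroˡ _))))
    cases (no _) (yes refl) = trans (cong inv (zeroʳ x)) (trans inv-0 (sym (trans (cong (inv x *_) inv-0) (zeroʳ _))))
    cases (no x≢0) (no y≢0) = inv-unique (begin
      x * y * (inv x * inv y)
        ≡⟨ solve 4 (λ x y z w → x :* y :* (z :* w) := x :* z :* (y :* w)) refl x y (inv x) (inv y) ⟩
      x * inv x * (y * inv y)  ≡⟨ cong₂ _*_ (x*inv≡1 x≢0) (x*inv≡1 y≢0) ⟩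
      1# * 1#                  ≡⟨ *-identityˡ 1# ⟩
      1#                       ∎)

  ∑ᴷ-*ˡ : ∀ c f → ∑ᴷ (λ x → c * f x) ≡ c * ∑ᴷ f
  ∑ᴷ-*ˡ c f = sym (*-distribˡ-sum c (f ∘ from))

  ∑ᴷ-shift : ∀ f r → ∑ᴷ f ≡ ∑ᴷ (λ x → f (x + r))
  ∑ᴷ-shift f r = ∑ᴷ-reindex f (_+ r) (_- r)
    (λ x → solve 2 (λ x r → x :- r :+ r := x) refl x r)
    (λ x → solve 2 (λ x r → x :+ r :- r := x) refl x r)

  ∑ᴷ-dilate : ∀ f {c} → c ≢ 0# → ∑ᴷ f ≡ ∑ᴷ (λ x → f (c * x))
  ∑ᴷ-dilate f {c} c≢0 = ∑ᴷ-reindex f (c *_) (inv c *_)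
    (λ x → trans (sym (*-assoc _ _ _)) (trans (cong (_* x) (x*inv≡1 c≢0)) (*-identityˡ x)))
    (λ x → trans (sym (*-assoc _ _ _)) (trans (cong (_* x) (trans (*-comm _ _) (x*inv≡1 c≢0))) (*-identityˡ x)))

  -- Translating by r adds r ∑ f to ∑ x f(x).
  ∑ᴷ-periodic : ∀ f r → r ≢ 0# → (∀ x → f (x + r) ≡ f x) → ∑ᴷ f ≡ 0#
  ∑ᴷ-periodic f r r≢0 per = xy≡0⇒y≡0 r≢0 (begin
    r * ∑ᴷ f                                          ≡⟨ solve 2 (λ a b → a := b :+ a :- b) refl (r * ∑ᴷ f) s ⟩
    s + r * ∑ᴷ f - s                                  ≡⟨ cong (_- s) (begin
      s + r * ∑ᴷ f                                      ≡⟨ cong (s +_) (∑ᴷ-*ˡ r f) ⟨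
      s + ∑ᴷ (λ x → r * f x)                            ≡⟨ ∑ᴷ-∙ (λ x → x * f x) (λ x → r * f x) ⟨
      ∑ᴷ (λ x → x * f x + r * f x)                      ≡⟨ ∑ᴷ-cong (λ x → trans (sym (distribʳ _ _ _)) (cong ((x + r) *_) (sym (per x)))) ⟩
      ∑ᴷ (λ x → (x + r) * f (x + r))                    ≡⟨ ∑ᴷ-shift (λ x → x * f x) r ⟨
      s                                                 ∎) ⟩
    s - s                                             ≡⟨ -‿inverseʳ s ⟩
    0#                                                ∎)
    where
    open ≡-Reasoning
    s = ∑ᴷ (λ x → x * f x)

  -- A constant has period 1. That |K| vanishes in K is later turned into the characteristic.
  ∑ᴷ-1≡0 : ∑ᴷ (λ _ → 1#) ≡ 0#
  ∑ᴷ-1≡0 = ∑ᴷ-periodic (λ _ → 1#) 1# (λ 1≡0 → 0≢1 (sym 1≡0)) (λ _ → refl)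

  open Mult semiring using (×1-homo-*; ×-assocˡ; ×-assoc-*) renaming (_×_ to _·1_)

  N·1≡0 : N ·1 1# ≡ 0#
  N·1≡0 = trans (sym (MonoidSum.sum-replicate +-commutativeMonoid N {1#})) ∑ᴷ-1≡0

  -- Multiply together all nonzero elements, before and after dilation by c.
  x^N≡x : ∀ c → c ^ N ≡ c
  x^N≡x c with c ≟ 0#
  ... | yes refl = 0^N (to 0#)
    where
    0^N : ∀ {n} → Fin n → 0# ^ n ≡ 0#
    0^N {suc n} _ = zeroˡ _
  ... | no c≢0 = begin
    c ^ N                       ≡⟨ ∏-const ⟨
    ∏.∑ᴷ (λ _ → c)              ≡⟨ ∏.∑ᴷ-cong (λ y → sym (w*w₀≡c y)) ⟩
    ∏.∑ᴷ (λ y → w y * w₀ y)     ≡⟨ ∏.∑ᴷ-∙ w w₀ ⟩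
    ∏.∑ᴷ w * ∏.∑ᴷ w₀            ≡⟨ cong₂ _*_ ∏w≡1 (trans (∏.∑ᴷ-single w₀ 0# w₀≡1) w₀-0) ⟩
    1# * c                      ≡⟨ *-identityˡ c ⟩
    c                           ∎
    where
    open ≡-Reasoning
    -- `u` puts 1 in place of the zero element, and dilation by c multiplies `u` by `w`. The factor
    -- c that `w` lacks at 0 is supplied by `w₀`, which makes the exponent N instead of N - 1.
    w w₀ u : Carrier → Carrier
    w y with y ≟ 0#
    ... | yes _ = 1#
    ... | no  _ = c
    w₀ y with y ≟ 0#
    ... | yes _ = c
    ... | no  _ = 1#
    u y with y ≟ 0#
    ... | yes _ = 1#
    ... | no  _ = y
    w*w₀≡c : ∀ y → w y * w₀ y ≡ c
    w*w₀≡c y with y ≟ 0#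
    ... | yes _ = *-identityˡ c
    ... | no  _ = *-identityʳ c
    w₀≡1 : ∀ y → y ≢ 0# → w₀ y ≡ 1#
    w₀≡1 y y≢0 with y ≟ 0#
    ... | yes y≡0 = contradiction y≡0 y≢0
    ... | no  _   = refl
    w₀-0 : w₀ 0# ≡ c
    w₀-0 with 0# ≟ 0#
    ... | yes _   = refl
    ... | no  0≢0 = contradiction refl 0≢0
    u≢0 : ∀ y → u y ≢ 0#
    u≢0 y with y ≟ 0#
    ... | yes _   = λ 1≡0 → 0≢1 (sym 1≡0)
    ... | no  y≢0 = y≢0
    u-dilate : ∀ y → u (c * y) ≡ w y * u y
    u-dilate y with c * y ≟ 0# | y ≟ 0#
    ... | yes _    | yes _   = sym (*-identityˡ 1#)
    ... | yes cy≡0 | no y≢0  = contradiction cy≡0 (*-nonzero c≢0 y≢0)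
    ... | no cy≢0  | yes refl = contradiction (zeroʳ c) cy≢0
    ... | no _     | no _    = refl
    ∏-nonzero : ∀ {n} (t : Fin n → Carrier) → (∀ i → t i ≢ 0#) → MonoidSum.sum *-commutativeMonoid t ≢ 0#
    ∏-nonzero {zero}  t _  1≡0 = 0≢1 (sym 1≡0)
    ∏-nonzero {suc n} t nz = *-nonzero (nz zero) (∏-nonzero (t ∘ suc) (nz ∘ suc))
    ∏w≡1 : ∏.∑ᴷ w ≡ 1#
    ∏w≡1 = *-cancelˡ (∏-nonzero (u ∘ from) (u≢0 ∘ from)) (begin
      ∏.∑ᴷ u * ∏.∑ᴷ w               ≡⟨ *-comm _ _ ⟩
      ∏.∑ᴷ w * ∏.∑ᴷ u               ≡⟨ ∏.∑ᴷ-∙ w u ⟨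
      ∏.∑ᴷ (λ y → w y * u y)        ≡⟨ ∏.∑ᴷ-cong (λ y → sym (u-dilate y)) ⟩
      ∏.∑ᴷ (λ y → u (c * y))        ≡⟨ ∏.∑ᴷ-reindex u (c *_) (inv c *_)
        (λ x → trans (sym (*-assoc _ _ _)) (trans (cong (_* x) (x*inv≡1 c≢0)) (*-identityˡ x)))
        (λ x → trans (sym (*-assoc _ _ _)) (trans (cong (_* x) (trans (*-comm _ _) (x*inv≡1 c≢0))) (*-identityˡ x))) ⟨
      ∏.∑ᴷ u                        ≡⟨ *-identityʳ _ ⟨
      ∏.∑ᴷ u * 1#                   ∎)
    ^-const : ∀ n → MonoidSum.sum *-commutativeMonoid {n} (λ _ → c) ≡ c ^ n
    ^-const zero    = refl
    ^-const (suc n) = cong (c *_) (^-const n)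
    ∏-const : ∏.∑ᴷ (λ _ → c) ≡ c ^ N
    ∏-const = ^-const N

  ^-* : ∀ x y n → (x * y) ^ n ≡ x ^ n * y ^ n
  ^-* x y zero    = sym (*-identityˡ 1#)
  ^-* x y (suc n) = trans (cong (x * y *_) (^-* x y n))
    (solve 4 (λ x y z w → x :* y :* (z :* w) := x :* z :* (y :* w)) refl x y (x ^ n) (y ^ n))

  1^n≡1 : ∀ n → 1# ^ n ≡ 1#
  1^n≡1 zero    = refl
  1^n≡1 (suc n) = trans (*-identityˡ _) (1^n≡1 n)

  ^-+ : ∀ x m n → x ^ (m ℕ.+ n) ≡ x ^ m * x ^ n
  ^-+ x zero    n = sym (*-identityˡ _)
  ^-+ x (suc m) n = trans (cong (x *_) (^-+ x m n)) (sym (*-assoc _ _ _))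

  ^-^ : ∀ x m n → (x ^ m) ^ n ≡ x ^ (m ℕ.* n)
  ^-^ x m zero    = cong (x ^_) (sym (ℕ.*-zeroʳ m))
  ^-^ x m (suc n) = trans (cong (x ^ m *_) (^-^ x m n))
    (trans (sym (^-+ x m (m ℕ.* n))) (cong (x ^_) (sym (ℕ.*-suc m n))))

  module _ {p : ℕ} (pr : Prime p) (p·1≡0 : p ·1 1# ≡ 0#) where

    ·1-divisible : ∀ {n} z → p ∣ n → n ·1 z ≡ 0#
    ·1-divisible z (divides k refl) = begin
      (k ℕ.* p) ·1 z          ≡⟨ cong (_·1 z) (ℕ.*-comm k p) ⟩
      (p ℕ.* k) ·1 z          ≡⟨ ×-assocˡ z p k ⟨
      p ·1 (k ·1 z)           ≡⟨ cong (p ·1_) (*-identityˡ _) ⟨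
      p ·1 (1# * (k ·1 z))    ≡⟨ ×-assoc-* p 1# _ ⟨
      (p ·1 1#) * (k ·1 z)    ≡⟨ cong (_* (k ·1 z)) p·1≡0 ⟩
      0# * (k ·1 z)           ≡⟨ zeroˡ _ ⟩
      0#                      ∎
      where open ≡-Reasoning

    ^p-+ : ∀ x y → (x + y) ^ p ≡ x ^ p + y ^ p
    ^p-+ x y = frobenius p pr ·1-divisible
      where
      open ≡-Reasoning
      open Binomial commutativeSemiring
      open Exp commutativeSemiring using () renaming (_^_ to _^ˢ_)
      open MonoidSum +-commutativeMonoid
      ^≡^ˢ : ∀ x n → x ^ n ≡ x ^ˢ n
      ^≡^ˢ x zero    = refl
      ^≡^ˢ x (suc n) = cong (x *_) (^≡^ˢ x n)
      -- The module parameter `p` cannot be matched as a successor, as the splitting of the binomial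
      -- sum requires, so the claim is generalised to a variable.
      frobenius : ∀ r → Prime r → (∀ {n} z → r ∣ n → n ·1 z ≡ 0#) → (x + y) ^ r ≡ x ^ r + y ^ r
      frobenius zero    pr _   with () ← ℕ.NonZero.nonZero (prime⇒nonZero pr)
      frobenius (suc r) pr div = begin
        (x + y) ^ suc r               ≡⟨ ^≡^ˢ (x + y) (suc r) ⟩
        (x + y) ^ˢ suc r              ≡⟨ theorem (suc r) x y ⟩
        t zero + sum (tail t)         ≡⟨ cong (t zero +_) (sum-init-last (tail t)) ⟩
        t zero + (sum (init (tail t)) + last (tail t))
          ≡⟨ cong (λ z → t zero + (z + last (tail t))) (trans (sum-cong-≗ middle) (sum-replicate-zero r)) ⟩
        t zero + (0# + last (tail t)) ≡⟨ cong₂ _+_ first (trans (+-identityˡ _) final) ⟩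
        y ^ suc r + x ^ suc r         ≡⟨ +-comm _ _ ⟩
        x ^ suc r + y ^ suc r         ∎
        where
        t : Fin (suc (suc r)) → Carrier
        t = binomialTerm x y (suc r)
        middle : ∀ i → init (tail t) i ≡ 0#
        middle i = div _ (subst (λ k → suc r ∣ suc r C suc k) (sym (F.toℕ-inject₁ i)) (prime∣binomial pr (F.toℕ i) (F.toℕ<n i)))
        first : t zero ≡ y ^ suc r
        first = trans (+-identityʳ _) (trans (*-identityˡ _) (sym (^≡^ˢ y (suc r))))
        final : last (tail t) ≡ x ^ suc r
        final = begin
          (suc r C suc (F.toℕ (F.fromℕ r))) ·1 (x ^ˢ suc (F.toℕ (F.fromℕ r)) * y ^ˢ (r ℕ.∸ F.toℕ (F.fromℕ r)))
            ≡⟨ cong (λ k → (suc r C suc k) ·1 (x ^ˢ suc k * y ^ˢ (r ℕ.∸ k))) (F.toℕ-fromℕ r) ⟩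
          (suc r C suc r) ·1 (x ^ˢ suc r * y ^ˢ (r ℕ.∸ r))
            ≡⟨ cong₂ (λ c k → c ·1 (x ^ˢ suc r * y ^ˢ k)) (nCn≡1 (suc r)) (ℕ.n∸n≡0 r) ⟩
          1 ·1 (x ^ˢ suc r * 1#)    ≡⟨ trans (+-identityʳ _) (*-identityʳ _) ⟩
          x ^ˢ suc r                ≡⟨ ^≡^ˢ x (suc r) ⟨
          x ^ suc r                 ∎

    ^p^n-+ : ∀ n x y → (x + y) ^ (p ℕ.^ n) ≡ x ^ (p ℕ.^ n) + y ^ (p ℕ.^ n)
    ^p^n-+ zero    x y = trans (*-identityʳ _) (sym (cong₂ _+_ (*-identityʳ x) (*-identityʳ y)))
    ^p^n-+ (suc n) x y = begin
      (x + y) ^ (p ℕ.* p ℕ.^ n)                   ≡⟨ ^-^ (x + y) p (p ℕ.^ n) ⟨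
      ((x + y) ^ p) ^ (p ℕ.^ n)                   ≡⟨ cong (_^ (p ℕ.^ n)) (^p-+ x y) ⟩
      (x ^ p + y ^ p) ^ (p ℕ.^ n)                 ≡⟨ ^p^n-+ n (x ^ p) (y ^ p) ⟩
      (x ^ p) ^ (p ℕ.^ n) + (y ^ p) ^ (p ℕ.^ n)   ≡⟨ cong₂ _+_ (^-^ x p (p ℕ.^ n)) (^-^ y p (p ℕ.^ n)) ⟩
      x ^ (p ℕ.* p ℕ.^ n) + y ^ (p ℕ.* p ℕ.^ n)   ∎
      where open ≡-Reasoning

  p^n·1≡0⇒p·1≡0 : ∀ p n → (p ℕ.^ n) ·1 1# ≡ 0# → p ·1 1# ≡ 0#
  p^n·1≡0⇒p·1≡0 p zero    1≡0 = contradiction (trans (sym 1≡0) (+-identityʳ 1#)) 0≢1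
  p^n·1≡0⇒p·1≡0 p (suc n) eq with p ·1 1# ≟ 0#
  ... | yes p≡0 = p≡0
  ... | no  p≢0 = p^n·1≡0⇒p·1≡0 p n (xy≡0⇒y≡0 p≢0 (trans (sym (×1-homo-* p (p ℕ.^ n))) eq))

  frobenius-+ : ∀ {p} → Prime p → ∀ m → N ≡ p ℕ.^ m → ∀ n x y → (x + y) ^ (p ℕ.^ n) ≡ x ^ (p ℕ.^ n) + y ^ (p ℕ.^ n)
  frobenius-+ {p} pr m N≡p^m = ^p^n-+ pr (p^n·1≡0⇒p·1≡0 p m (trans (cong (_·1 1#) (sym N≡p^m)) N·1≡0))

  -- The value at x of the monic polynomial whose lower coefficients are given
  -- (constant term first).
  monicValue : ∀ {n} → Vec Carrier n → Carrier → Carrier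
  monicValue []       x = 1#
  monicValue (c ∷ cs) x = c + x * monicValue cs x

  -- Synthetic division by X - r.
  quotient : ∀ {n} → Vec Carrier (suc n) → Carrier → Vec Carrier n
  quotient (c ∷ [])         r = []
  quotient (c ∷ cs@(_ ∷ _)) r = monicValue cs r ∷ quotient cs r

  quotient-correct : ∀ {n} (cs : Vec Carrier (suc n)) r x →
                     monicValue cs x ≡ monicValue cs r + (x - r) * monicValue (quotient cs r) x
  quotient-correct (c ∷ []) r x =
    solve 3 (λ c r x → c :+ x :* I := c :+ r :* I :+ (x :- r) :* I) refl c r x
  quotient-correct (c ∷ cs@(_ ∷ _)) r x = trans (cong (λ z → c + x * z) (quotient-correct cs r x))
    (solve 5 (λ c r x v w → c :+ x :* (v :+ (x :- r) :* w) := c :+ r :* v :+ (x :- r) :* (v :+ x :* w)) refl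
      c r x (monicValue cs r) (monicValue (quotient cs r) x))

  roots≤degree : ∀ {m n} (cs : Vec Carrier n) (r : Fin m → Carrier) → (∀ {i j} → r i ≡ r j → i ≡ j) →
                 (∀ i → monicValue cs (r i) ≡ 0#) → m ℕ.≤ n
  roots≤degree {zero}          cs r inj root = z≤n
  roots≤degree {suc m} {zero}  [] r inj root = contradiction (sym (root zero)) 0≢1
  roots≤degree {suc m} {suc n} cs r inj root =
    s≤s (roots≤degree (quotient cs (r zero)) (r ∘ suc) (λ eq → F.suc-injective (inj eq)) λ i →
      xy≡0⇒y≡0 (λ eq → F.0≢1+n (sym (inj (x-y≡0⇒x≡y eq)))) (begin
        (r (suc i) - r zero) * q i                              ≡⟨ +-identityˡ _ ⟨
        0# + (r (suc i) - r zero) * q i                         ≡⟨ cong (_+ (r (suc i) - r zero) * q i) (root zero) ⟨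
        monicValue cs (r zero) + (r (suc i) - r zero) * q i     ≡⟨ quotient-correct cs (r zero) (r (suc i)) ⟨
        monicValue cs (r (suc i))                               ≡⟨ root (suc i) ⟩
        0#                                                      ∎))
    where
    open ≡-Reasoning
    q = λ i → monicValue (quotient cs (r zero)) (r (suc i))

-- Counting in finite sets.

Fin-injective⇒surjective : ∀ {n} (f : Fin n → Fin n) → (∀ {i j} → f i ≡ f j → i ≡ j) → ∀ j → ∃[ i ] f i ≡ j
Fin-injective⇒surjective {suc n} f inj j with F.any? (λ i → f i F.≟ j)
... | yes p = p
... | no ¬p = contradiction
  (F.injective⇒≤ {f = λ i → punchOut {i = j} {j = f i} (λ eq → ¬p (i , sym eq))}
    (λ eq → inj (F.punchOut-injective {i = j} _ _ eq)))
  ℕ.1+n≰n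

-- Lists a decidable subset without knowing its size. About the fixed points of φ the final count
-- uses just the bounds `1<s` and `s≤q`.
record Enumeration {n} (P : Fin n → Set) : Set where
  field
    count     : ℕ
    element   : Fin count → Fin n
    injective : ∀ {i j} → element i ≡ element j → i ≡ j
    sound     : ∀ i → P (element i)
    complete  : ∀ x → P x → ∃[ i ] element i ≡ x

enumerate : ∀ {n} {P : Fin n → Set} → (∀ x → Dec (P x)) → Enumeration P
enumerate {zero}      P? = record { count = 0 ; element = λ () ; injective = λ {} ; sound = λ () ; complete = λ () }
enumerate {suc n} {P} P? with enumerate (P? ∘ suc) | P? zero
... | e | yes p = record
  { count     = suc (Enumeration.count e)
  ; element   = el
  ; injective = λ {i} {j} → inj i j
  ; sound     = λ { zero → p ; (suc i) → Enumeration.sound e i }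
  ; complete  = λ { zero _ → zero , refl ; (suc x) Px → let (i , eq) = Enumeration.complete e x Px in suc i , cong suc eq }
  }
  where
  el : Fin (suc (Enumeration.count e)) → Fin (suc n)
  el zero    = zero
  el (suc i) = suc (Enumeration.element e i)
  inj : ∀ i j → el i ≡ el j → i ≡ j
  inj zero    zero    _  = refl
  inj (suc i) (suc j) eq = cong suc (Enumeration.injective e (F.suc-injective eq))
... | e | no ¬p = record
  { count     = Enumeration.count e
  ; element   = suc ∘ Enumeration.element e
  ; injective = Enumeration.injective e ∘ F.suc-injective
  ; sound     = Enumeration.sound e
  ; complete  = λ { zero Px → contradiction Px ¬p ; (suc x) Px → let (i , eq) = Enumeration.complete e x Px in i , cong suc eq }
  }

funToFin-cong : ∀ {m n} {f g : Fin m → Fin n} → f ≗ g → F.funToFin f ≡ F.funToFin g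
funToFin-cong {zero}  f≗g = refl
funToFin-cong {suc m} f≗g = cong₂ F.combine (f≗g zero) (funToFin-cong (f≗g ∘ suc))

-- φ-polynomials: the Moore matrix and interpolation.

module FrobeniusField (K : Field) {N : ℕ} (size : HasSize K N) (frobenius : Frobenius K) where

  open Field K
  open Frobenius frobenius
  open FieldRing K public
  open FiniteField K size public
  open FrobeniusSolver K frobenius public
    using (φ-0; φ-neg; x-y≡0⇒x≡y; Expr; O; I; _:+_; _:*_; :-_; _:-_; Φ; Φ²; Φ³; _:=_; solve)
  open Inverse size using (to; from; strictlyInverseˡ; strictlyInverseʳ)
  open ≡-Reasoning

  φ-injective : ∀ {x y} → φ x ≡ φ y → x ≡ y
  φ-injective {x} {y} eq = trans (sym (φ⁴ x)) (trans (cong (φ ∘ φ ∘ φ) eq) (φ⁴ y))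

  φ-nonzero : ∀ {x} → x ≢ 0# → φ x ≢ 0#
  φ-nonzero x≢0 φx≡0 = x≢0 (φ-injective (trans φx≡0 (sym φ-0)))

  φ-inv : ∀ x → φ (inv x) ≡ inv (φ x)
  φ-inv x with x ≟ 0#
  ... | yes refl = trans φ-0 (sym (trans (cong inv φ-0) inv-0))
  ... | no  x≢0  = sym (inv-unique (trans (sym (φ-* x _)) (trans (cong φ (proj₂ (inverse x x≢0))) φ-1)))

  φ² φ³ : Carrier → Carrier
  φ² x = φ (φ x)
  φ³ x = φ (φ (φ x))

  Fixed : Carrier → Set
  Fixed x = φ x ≡ x

  fixedPoints : Enumeration (λ i → Fixed (from i))
  fixedPoints = enumerate (λ i → φ (from i) ≟ from i)
  module FP = Enumeration fixedPoints

  combine : ∀ {m} → (Fin m → Carrier) → (Fin m → Carrier) → Carrier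
  combine {zero}  c x = 0#
  combine {suc m} c x = c zero * x zero + combine (c ∘ suc) (x ∘ suc)

  Independent : ∀ {m} → (Fin m → Carrier) → Set
  Independent {m} x = ∀ (c : Fin m → Carrier) → (∀ i → Fixed (c i)) → combine c x ≡ 0# → ∀ i → c i ≡ 0#

  -- ∑ⱼ aⱼ φʲ(x)
  skewValue : ∀ {m} → (Fin m → Carrier) → Carrier → Carrier
  skewValue {zero}  a x = 0#
  skewValue {suc m} a x = a zero * x + skewValue (a ∘ suc) (φ x)

  skewᴱ : ∀ {n} → Expr n → Expr n → Expr n → Expr n → Expr n → Expr n
  skewᴱ a b c d x = a :* x :+ (b :* Φ x :+ (c :* Φ² x :+ (d :* Φ³ x :+ O)))

  private
    total : ∀ {m} → (Fin m → Carrier) → Carrier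
    total {zero}  a = 0#
    total {suc m} a = a zero + total (a ∘ suc)

    suffixes : ∀ {m} → (Fin (suc m) → Carrier) → Fin m → Carrier
    suffixes a zero    = total (a ∘ suc)
    suffixes a (suc j) = suffixes (a ∘ suc) j

    rescale : ∀ {m} → (Fin m → Carrier) → Carrier → Fin m → Carrier
    rescale a s zero    = a zero * s
    rescale a s (suc j) = rescale (a ∘ suc) (φ s) j

    -- Summation by parts: right division of ∑ aⱼ φʲ by φ - 1.
    skewValue-suffixes : ∀ {m} (a : Fin (suc m) → Carrier) x →
                         skewValue a x ≡ total a * x + skewValue (suffixes a) (φ x - x)
    skewValue-suffixes {zero} a x =
      solve 2 (λ a x → a :* x :+ O := (a :+ O) :* x :+ O) refl (a zero) x
    skewValue-suffixes {suc m} a x = begin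
      a zero * x + skewValue (a ∘ suc) (φ x)
        ≡⟨ cong (a zero * x +_) (skewValue-suffixes (a ∘ suc) (φ x)) ⟩
      a zero * x + (t * φ x + skewValue (suffixes (a ∘ suc)) (φ² x - φ x))
        ≡⟨ cong (λ z → a zero * x + (t * φ x + skewValue (suffixes (a ∘ suc)) z))
             (solve 1 (λ x → Φ² x :- Φ x := Φ (Φ x :- x)) refl x) ⟩
      a zero * x + (t * φ x + skewValue (suffixes (a ∘ suc)) (φ (φ x - x)))
        ≡⟨ solve 4 (λ a x t r → a :* x :+ (t :* Φ x :+ r) := (a :+ t) :* x :+ (t :* (Φ x :- x) :+ r)) refl
             (a zero) x t (skewValue (suffixes (a ∘ suc)) (φ (φ x - x))) ⟩
      (a zero + t) * x + (t * (φ x - x) + skewValue (suffixes (a ∘ suc)) (φ (φ x - x))) ∎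
      where t = total (a ∘ suc)

    suffixes-zero : ∀ {m} (a : Fin (suc m) → Carrier) → total a ≡ 0# → (∀ j → suffixes a j ≡ 0#) → ∀ j → a j ≡ 0#
    suffixes-zero {zero}  a t≡0 s≡0 zero    = trans (sym (+-identityʳ _)) t≡0
    suffixes-zero {suc m} a t≡0 s≡0 zero    =
      trans (sym (+-identityʳ _)) (trans (cong (a zero +_) (sym (s≡0 zero))) t≡0)
    suffixes-zero {suc m} a t≡0 s≡0 (suc j) = suffixes-zero (a ∘ suc) (s≡0 zero) (s≡0 ∘ suc) j

    rescale-correct : ∀ {m} (a : Fin m → Carrier) s y → skewValue (rescale a s) y ≡ skewValue a (s * y)
    rescale-correct {zero}  a s y = refl
    rescale-correct {suc m} a s y = cong₂ _+_ (*-assoc _ _ _)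
      (trans (rescale-correct (a ∘ suc) (φ s) (φ y)) (cong (skewValue (a ∘ suc)) (sym (φ-* s y))))

    rescale-zero : ∀ {m} (a : Fin m → Carrier) {s} → s ≢ 0# → (∀ j → rescale a s j ≡ 0#) → ∀ j → a j ≡ 0#
    rescale-zero a s≢0 eq zero    = xy≡0⇒y≡0 s≢0 (trans (*-comm _ _) (eq zero))
    rescale-zero a s≢0 eq (suc j) = rescale-zero (a ∘ suc) (φ-nonzero s≢0) (eq ∘ suc) j

  skewValue-0 : ∀ {m} (a : Fin m → Carrier) → skewValue a 0# ≡ 0#
  skewValue-0 {zero}  a = refl
  skewValue-0 {suc m} a = trans (cong₂ _+_ (zeroʳ _) (trans (cong (skewValue (a ∘ suc)) φ-0) (skewValue-0 (a ∘ suc)))) (+-identityʳ _)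

  combine-0ˡ : ∀ {m} (c x : Fin m → Carrier) → (∀ i → c i ≡ 0#) → combine c x ≡ 0#
  combine-0ˡ {zero}  c x c≡0 = refl
  combine-0ˡ {suc m} c x c≡0 = trans (cong₂ _+_ (trans (cong (_* x zero) (c≡0 zero)) (zeroˡ _)) (combine-0ˡ (c ∘ suc) (x ∘ suc) (c≡0 ∘ suc))) (+-identityʳ _)

  combine-*ʳ : ∀ {m} (c x : Fin m → Carrier) s → combine c (λ i → x i * s) ≡ combine c x * s
  combine-*ʳ {zero}  c x s = sym (zeroˡ s)
  combine-*ʳ {suc m} c x s = trans (cong (c zero * (x zero * s) +_) (combine-*ʳ (c ∘ suc) (x ∘ suc) s))
    (solve 4 (λ c x s r → c :* (x :* s) :+ r :* s := (c :* x :+ r) :* s) refl (c zero) (x zero) s (combine (c ∘ suc) (x ∘ suc)))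

  combine-φ-id : ∀ {m} (c x : Fin m → Carrier) → (∀ i → Fixed (c i)) →
                 combine c (λ i → φ (x i) - x i) ≡ φ (combine c x) - combine c x
  combine-φ-id {zero}  c x fixed = sym (solve 0 (Φ O :- O := O) refl)
  combine-φ-id {suc m} c x fixed = begin
    c₀ * (φ x₀ - x₀) + combine (c ∘ suc) (λ i → φ (x (suc i)) - x (suc i))
      ≡⟨ cong (c₀ * (φ x₀ - x₀) +_) (combine-φ-id (c ∘ suc) (x ∘ suc) (fixed ∘ suc)) ⟩
    c₀ * (φ x₀ - x₀) + (φ r - r)
      ≡⟨ solve 3 (λ c x r → c :* (Φ x :- x) :+ (Φ r :- r) := c :* Φ x :+ Φ r :- (c :* x :+ r)) refl c₀ x₀ r ⟩
    c₀ * φ x₀ + φ r - (c₀ * x₀ + r)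
      ≡⟨ cong (λ z → z * φ x₀ + φ r - (c₀ * x₀ + r)) (fixed zero) ⟨
    φ c₀ * φ x₀ + φ r - (c₀ * x₀ + r)
      ≡⟨ solve 3 (λ c x r → Φ c :* Φ x :+ Φ r :- (c :* x :+ r) := Φ (c :* x :+ r) :- (c :* x :+ r)) refl c₀ x₀ r ⟩
    φ (c₀ * x₀ + r) - (c₀ * x₀ + r) ∎
    where
    c₀ = c zero
    x₀ = x zero
    r = combine (c ∘ suc) (x ∘ suc)

  -- Nonsingularity of the Moore matrix.
  skewValue-independent : ∀ {m} (x a : Fin m → Carrier) → Independent x → (∀ i → skewValue a (x i) ≡ 0#) → ∀ j → a j ≡ 0#
  skewValue-independent {suc m} x a indep vanish =
    -- Induction on the number of points. Rescaling moves x₀ to 1, vanishing at 1 makes `b` right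
    -- divisible by φ - 1, and the quotient vanishes at the elements φ(yᵢ) - yᵢ.
    rescale-zero a x₀≢0 (suffixes-zero b total≡0 (skewValue-independent z (suffixes b) z-indep z-vanish))
    where
    x₀ = x zero
    x₀≢0 : x₀ ≢ 0#
    x₀≢0 x₀≡0 = 0≢1 (sym (indep e₀ (λ { zero → φ-1 ; (suc _) → φ-0 })
      (trans (cong₂ _+_ (trans (*-identityˡ _) x₀≡0) (combine-0ˡ (e₀ ∘ suc) (x ∘ suc) (λ _ → refl))) (+-identityʳ _)) zero))
      where
      e₀ : Fin (suc m) → Carrier
      e₀ zero    = 1#
      e₀ (suc _) = 0#
    b = rescale a x₀
    y z : Fin m → Carrier
    y i = x (suc i) * inv x₀
    z i = φ (y i) - y i
    x₀*y : ∀ i → x₀ * y i ≡ x (suc i)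
    x₀*y i = begin
      x₀ * (x (suc i) * inv x₀)   ≡⟨ solve 3 (λ a b c → a :* (b :* c) := b :* (a :* c)) refl x₀ (x (suc i)) (inv x₀) ⟩
      x (suc i) * (x₀ * inv x₀)   ≡⟨ cong (x (suc i) *_) (x*inv≡1 x₀≢0) ⟩
      x (suc i) * 1#              ≡⟨ *-identityʳ _ ⟩
      x (suc i)                   ∎
    total≡0 : total b ≡ 0#
    total≡0 = begin
      total b                                            ≡⟨ solve 1 (λ t → t := t :* I :+ O) refl (total b) ⟩
      total b * 1# + 0#                                  ≡⟨ cong (total b * 1# +_) (skewValue-0 (suffixes b)) ⟨
      total b * 1# + skewValue (suffixes b) 0#           ≡⟨ cong (λ w → total b * 1# + skewValue (suffixes b) w) (solve 0 (O := Φ I :- I) refl) ⟩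
      total b * 1# + skewValue (suffixes b) (φ 1# - 1#)  ≡⟨ skewValue-suffixes b 1# ⟨
      skewValue b 1#                                     ≡⟨ rescale-correct a x₀ 1# ⟩
      skewValue a (x₀ * 1#)                              ≡⟨ cong (skewValue a) (*-identityʳ x₀) ⟩
      skewValue a x₀                                     ≡⟨ vanish zero ⟩
      0#                                                 ∎
    z-vanish : ∀ i → skewValue (suffixes b) (z i) ≡ 0#
    z-vanish i = begin
      skewValue (suffixes b) (z i)                    ≡⟨ solve 2 (λ r y → r := O :* y :+ r) refl (skewValue (suffixes b) (z i)) (y i) ⟩
      0# * y i + skewValue (suffixes b) (z i)         ≡⟨ cong (λ t → t * y i + skewValue (suffixes b) (z i)) total≡0 ⟨
      total b * y i + skewValue (suffixes b) (z i)    ≡⟨ skewValue-suffixes b (y i) ⟨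
      skewValue b (y i)                               ≡⟨ rescale-correct a x₀ (y i) ⟩
      skewValue a (x₀ * y i)                          ≡⟨ cong (skewValue a) (x₀*y i) ⟩
      skewValue a (x (suc i))                         ≡⟨ vanish (suc i) ⟩
      0#                                              ∎
    z-indep : Independent z
    -- A relation among the zᵢ says that w = ∑ cᵢyᵢ is fixed by φ, so that -w is admissible as the
    -- coefficient of x₀.
    z-indep c fixed cz≡0 i = indep c′ c′-fixed c′x≡0 (suc i)
      where
      w = combine c y
      φw≡w : φ w ≡ w
      φw≡w = x-y≡0⇒x≡y (trans (sym (combine-φ-id c y fixed)) cz≡0)
      c′ : Fin (suc m) → Carrier
      c′ zero    = - w
      c′ (suc i) = c i
      c′-fixed : ∀ i → Fixed (c′ i)
      c′-fixed zero    = trans (φ-neg w) (cong -_ φw≡w)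
      c′-fixed (suc i) = fixed i
      c′x≡0 : combine c′ x ≡ 0#
      c′x≡0 = begin
        - w * x₀ + combine c (x ∘ suc)
          ≡⟨ cong (- w * x₀ +_) (trans (sym (*-identityʳ _)) (cong (combine c (x ∘ suc) *_) (sym (x*inv≡1 x₀≢0)))) ⟩
        - w * x₀ + combine c (x ∘ suc) * (x₀ * inv x₀)
          ≡⟨ solve 4 (λ w x₀ r i → :- w :* x₀ :+ r :* (x₀ :* i) := (r :* i :- w) :* x₀) refl w x₀ (combine c (x ∘ suc)) (inv x₀) ⟩
        (combine c (x ∘ suc) * inv x₀ - w) * x₀
          ≡⟨ cong (λ t → (t - w) * x₀) (combine-*ʳ c (x ∘ suc) (inv x₀)) ⟨
        (w - w) * x₀
          ≡⟨ solve 2 (λ w x → (w :- w) :* x := O) refl w x₀ ⟩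
        0# ∎

  -- The φ-polynomial φ⁴ - 1 vanishes identically, yet its leading coefficient is 1.
  ¬independent₅ : (x : Fin 5 → Carrier) → ¬ Independent x
  ¬independent₅ x indep = 0≢1 (sym (skewValue-independent x a indep vanish 4F))
    where
    a : Fin 5 → Carrier
    a 0F = - 1#
    a 1F = 0#
    a 2F = 0#
    a 3F = 0#
    a 4F = 1#
    vanish : ∀ i → skewValue a (x i) ≡ 0#
    vanish i = solve 1 (λ x → :- I :* x :+ (O :* Φ x :+ (O :* Φ² x :+ (O :* Φ³ x :+ (I :* Φ (Φ³ x) :+ O)))) := O) refl (x i)

  record Spanned (x : Fin 4 → Carrier) (z : Carrier) : Set where
    field
      coeff : Fin 4 → Carrier
      fixed : ∀ i → Fixed (coeff i)
      value : z ≡ combine coeff x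

  vec₄ : Carrier → Carrier → Carrier → Carrier → Fin 4 → Carrier
  vec₄ a b c d 0F = a
  vec₄ a b c d 1F = b
  vec₄ a b c d 2F = c
  vec₄ a b c d 3F = d

  module _ (x : Fin 4 → Carrier) (indep : Independent x) where

    -- Exhaustive search for the coefficients; if it fails, z and the four elements are five
    -- independent ones. The degree of K over F enters only through φ⁴ = id.
    independent₄⇒spans : ∀ z → Spanned x z
    independent₄⇒spans z with ∃? (λ a → ∃? (λ b → ∃? (λ c → ∃? (λ d →
      (φ a ≟ a ×-dec φ b ≟ b ×-dec φ c ≟ c ×-dec φ d ≟ d) ×-dec z ≟ combine (vec₄ a b c d) x))))
    ... | yes (a , b , c , d , (a∈F , b∈F , c∈F , d∈F) , z≡) = record
      { coeff = vec₄ a b c d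
      ; fixed = λ { 0F → a∈F ; 1F → b∈F ; 2F → c∈F ; 3F → d∈F }
      ; value = z≡ }
    ... | no ¬spanned = contradiction independent (¬independent₅ z∷x)
      where
      z∷x : Fin 5 → Carrier
      z∷x zero    = z
      z∷x (suc i) = x i
      independent : Independent z∷x
      independent c fixed cz≡0 = zeros
        where
        c₀≡0 : c zero ≡ 0#
        c₀≡0 with c zero ≟ 0#
        ... | yes eq = eq
        ... | no c₀≢0 = contradiction
          (_ , _ , _ , _ , (sc 0F , sc 1F , sc 2F , sc 3F) , z≡)
          ¬spanned
          where
          c′ : Fin 4 → Carrier
          c′ i = - inv (c zero) * c (suc i)
          sc : ∀ i → Fixed (c′ i)
          sc i = trans (φ-* _ _) (cong₂ _*_ (trans (φ-neg _) (cong -_ (trans (φ-inv _) (cong inv (fixed zero))))) (fixed (suc i)))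
          z≡ : z ≡ combine (vec₄ (c′ 0F) (c′ 1F) (c′ 2F) (c′ 3F)) x
          z≡ = begin
            z                                     ≡⟨ solve 1 (λ z → z := I :* z :- O) refl z ⟩
            1# * z - 0#                           ≡⟨ cong₂ (λ s t → s * z - t) (sym (x*inv≡1 c₀≢0)) (sym (trans (cong (inv (c zero) *_) cz≡0) (zeroʳ _))) ⟩
            c zero * i* * z - i* * (c zero * z + combine (c ∘ suc) x)
              ≡⟨ solve 11 (λ z c i a b d e xa xb xd xe → c :* i :* z :- i :* (c :* z :+ (a :* xa :+ (b :* xb :+ (d :* xd :+ (e :* xe :+ O)))))
                    := (:- i :* a) :* xa :+ ((:- i :* b) :* xb :+ ((:- i :* d) :* xd :+ ((:- i :* e) :* xe :+ O)))) refl
                    z (c zero) i* (c 1F) (c 2F) (c 3F) (c 4F) (x 0F) (x 1F) (x 2F) (x 3F) ⟩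
            combine (vec₄ (c′ 0F) (c′ 1F) (c′ 2F) (c′ 3F)) x ∎
            where i* = inv (c zero)
        cx≡0 : combine (c ∘ suc) x ≡ 0#
        cx≡0 = begin
          combine (c ∘ suc) x                   ≡⟨ solve 2 (λ z r → r := O :* z :+ r) refl z _ ⟩
          0# * z + combine (c ∘ suc) x          ≡⟨ cong (λ t → t * z + combine (c ∘ suc) x) c₀≡0 ⟨
          c zero * z + combine (c ∘ suc) x      ≡⟨ cz≡0 ⟩
          0#                                    ∎
        zeros : ∀ i → c i ≡ 0#
        zeros zero    = c₀≡0
        zeros (suc i) = indep (c ∘ suc) (fixed ∘ suc) cx≡0 i

    -- Evaluation at the four points is an injective map of K⁴ to itself by the Moore matrix, hence
    -- surjective by finiteness.
    interpolation : (y : Fin 4 → Carrier) → ∃[ a ] (∀ i → skewValue {4} a (x i) ≡ y i)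
    interpolation y = let (k , fk≡y) = Fin-injective⇒surjective f f-injective (encode y) in
      decode k , λ i → begin
        skewValue (decode k) (x i)               ≡⟨ decode-encode (λ i → skewValue (decode k) (x i)) i ⟨
        decode (f k) i                           ≡⟨ cong (λ m → decode m i) fk≡y ⟩
        decode (encode y) i                      ≡⟨ decode-encode y i ⟩
        y i                                      ∎
      where
      encode : (Fin 4 → Carrier) → Fin (N ℕ.^ 4)
      encode g = F.funToFin (to ∘ g)
      decode : Fin (N ℕ.^ 4) → Fin 4 → Carrier
      decode k = from ∘ F.finToFun {N} {4} k
      decode-encode : ∀ g i → decode (encode g) i ≡ g i
      decode-encode g i = trans (cong from (F.finToFun-funToFin (to ∘ g) i)) (strictlyInverseʳ (g i))
      f : Fin (N ℕ.^ 4) → Fin (N ℕ.^ 4)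
      f k = encode (λ i → skewValue (decode k) (x i))
      values : ∀ {k l} → f k ≡ f l → ∀ i → skewValue (decode k) (x i) ≡ skewValue (decode l) (x i)
      values {k} {l} eq i = trans (sym (decode-encode (λ i → skewValue (decode k) (x i)) i)) (trans (cong (λ m → decode m i) eq) (decode-encode (λ i → skewValue (decode l) (x i)) i))
      difference : ∀ {m} (a b : Fin m → Carrier) z → skewValue (λ j → a j - b j) z ≡ skewValue a z - skewValue b z
      difference {zero}  a b z = sym (-‿inverseʳ 0#)
      difference {suc m} a b z = trans (cong ((a zero - b zero) * z +_) (difference (a ∘ suc) (b ∘ suc) (φ z)))
        (solve 5 (λ a b z s t → (a :- b) :* z :+ (s :- t) := a :* z :+ s :- (b :* z :+ t)) refl
          (a zero) (b zero) z (skewValue (a ∘ suc) (φ z)) (skewValue (b ∘ suc) (φ z)))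
      decode-injective : ∀ {k l} → (∀ i → decode k i ≡ decode l i) → k ≡ l
      decode-injective {k} {l} eq = begin
        k                               ≡⟨ F.funToFin-finToFin {4} {N} k ⟨
        F.funToFin (F.finToFun {N} {4} k)  ≡⟨ funToFin-cong (λ i → trans (sym (strictlyInverseˡ _)) (trans (cong to (eq i)) (strictlyInverseˡ _))) ⟩
        F.funToFin (F.finToFun {N} {4} l)  ≡⟨ F.funToFin-finToFin {4} {N} l ⟩
        l                               ∎
      f-injective : ∀ {k l} → f k ≡ f l → k ≡ l
      f-injective {k} {l} eq = decode-injective λ i → x-y≡0⇒x≡y
        (skewValue-independent x (λ j → decode k j - decode l j) indep
          (λ i → trans (difference (decode k) (decode l) (x i))
            (trans (cong (_- skewValue (decode l) (x i)) (values eq i)) (-‿inverseʳ _))) i)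

-- Character sums with denominator x φ(x) φ²(x).

-- Only 0, 1, 2 are candidates, being the conjugates in the denominator; a triple containing 3
-- necessarily misses one of them.
Missing : Fin 4 → Fin 4 → Fin 4 → Set
Missing i j k = ∃[ l ] (inject₁ {3} l ≢ i × inject₁ l ≢ j × inject₁ l ≢ k)

missing? : ∀ i j k → Dec (Missing i j k)
missing? i j k = F.any? λ l → ¬? (inject₁ l F.≟ i) ×-dec ¬? (inject₁ l F.≟ j) ×-dec ¬? (inject₁ l F.≟ k)

permutations : List (Fin 4 × Fin 4 × Fin 4)
permutations = (0F , 1F , 2F) ∷ (0F , 2F , 1F) ∷ (1F , 0F , 2F) ∷ (1F , 2F , 0F) ∷ (2F , 0F , 1F) ∷ (2F , 1F , 0F) ∷ []

IsPermutation : Fin 4 → Fin 4 → Fin 4 → Set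
IsPermutation i j k = (i , j , k) ∈ permutations

isPermutation? : ∀ i j k → Dec (IsPermutation i j k)
isPermutation? i j k = (i , j , k) ∈? permutations
  where open DecMembership (Product.≡-dec F._≟_ (Product.≡-dec F._≟_ F._≟_)) using (_∈?_)

missing-or-permutation : ∀ i j k → Missing i j k ⊎ IsPermutation i j k
missing-or-permutation = from-yes (F.all? λ i → F.all? λ j → F.all? λ k → missing? i j k ⊎-dec isPermutation? i j k)

module QuarticField (K : Field) {N : ℕ} (size : HasSize K N) (frobenius : Frobenius K)
  (basis : Fin 4 → Field.Carrier K)
  (basis-independent : FrobeniusField.Independent K size frobenius basis) where

  open Field K
  open Frobenius frobenius
  open FrobeniusField K size frobenius public
  open ≡-Reasoning

  1≢0 : 1# ≢ 0#
  1≢0 = 0≢1 ∘ sym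

  Skew : Set
  Skew = Fin 4 → Carrier

  skew-nonvanishing : ∀ (a : Skew) j → a j ≢ 0# → ∃[ z ] skewValue a z ≢ 0#
  skew-nonvanishing a j aj≢0 with F.all? (λ i → skewValue a (basis i) ≟ 0#)
  ... | yes vanish = contradiction (skewValue-independent basis a basis-independent vanish j) aj≢0
  ... | no ¬vanish = let (i , ¬v) = F.¬∀⟶∃¬ 4 _ (λ i → skewValue a (basis i) ≟ 0#) ¬vanish in basis i , ¬v

  dedekind : ∀ (a : Skew) → (∀ z → skewValue a z ≡ 0#) → ∀ j → a j ≡ 0#
  dedekind a vanish = skewValue-independent basis a basis-independent (vanish ∘ basis)

  skewValue-+ : ∀ (a : Skew) x y → skewValue a (x + y) ≡ skewValue a x + skewValue a y
  skewValue-+ a x y = solve 6 (λ x y a b c d →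
    a :* (x :+ y) :+ (b :* Φ (x :+ y) :+ (c :* Φ² (x :+ y) :+ (d :* Φ³ (x :+ y) :+ O)))
    := skewᴱ a b c d x
       :+ skewᴱ a b c d y) refl x y (a 0F) (a 1F) (a 2F) (a 3F)

  ψ : Fin 4 → Carrier → Carrier
  ψ 0F x = x
  ψ 1F x = φ x
  ψ 2F x = φ² x
  ψ 3F x = φ³ x

  ψ-+ : ∀ i x y → ψ i (x + y) ≡ ψ i x + ψ i y
  ψ-+ 0F = solve 2 (λ x y → x :+ y := x :+ y) refl
  ψ-+ 1F = solve 2 (λ x y → Φ (x :+ y) := Φ x :+ Φ y) refl
  ψ-+ 2F = solve 2 (λ x y → Φ² (x :+ y) := Φ² x :+ Φ² y) refl
  ψ-+ 3F = solve 2 (λ x y → Φ³ (x :+ y) := Φ³ x :+ Φ³ y) refl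

  ψ-* : ∀ i x y → ψ i (x * y) ≡ ψ i x * ψ i y
  ψ-* 0F = solve 2 (λ x y → x :* y := x :* y) refl
  ψ-* 1F = solve 2 (λ x y → Φ (x :* y) := Φ x :* Φ y) refl
  ψ-* 2F = solve 2 (λ x y → Φ² (x :* y) := Φ² x :* Φ² y) refl
  ψ-* 3F = solve 2 (λ x y → Φ³ (x :* y) := Φ³ x :* Φ³ y) refl

  ψ-1 : ∀ i → ψ i 1# ≡ 1#
  ψ-1 0F = refl
  ψ-1 1F = solve 0 (Φ I := I) refl
  ψ-1 2F = solve 0 (Φ² I := I) refl
  ψ-1 3F = solve 0 (Φ³ I := I) refl

  ψ-0 : ∀ i → ψ i 0# ≡ 0#
  ψ-0 0F = refl
  ψ-0 1F = solve 0 (Φ O := O) refl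
  ψ-0 2F = solve 0 (Φ² O := O) refl
  ψ-0 3F = solve 0 (Φ³ O := O) refl

  single : Fin 4 → Carrier → Skew
  single i v m = if does (m F.≟ i) then v else 0#

  single-value : ∀ i v c → skewValue (single i v) c ≡ v * ψ i c
  single-value 0F = solve 2 (λ v c → skewᴱ v O O O c := v :* c) refl
  single-value 1F = solve 2 (λ v c → skewᴱ O v O O c := v :* Φ c) refl
  single-value 2F = solve 2 (λ v c → skewᴱ O O v O c := v :* Φ² c) refl
  single-value 3F = solve 2 (λ v c → skewᴱ O O O v c := v :* Φ³ c) refl

  single-≢ : ∀ {i l} v → l ≢ i → single i v l ≡ 0#
  single-≢ {i} {l} v l≢i with l F.≟ i
  ... | yes l≡i = contradiction l≡i l≢i
  ... | no  _   = refl

  cubic : Fin 4 → Fin 4 → Fin 4 → Carrier → Carrier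
  cubic i j k x = ψ i x * ψ j x * ψ k x

  -- The polarisation of `cubic i j k` at (c, d, 1).
  polar : Fin 4 → Fin 4 → Fin 4 → Carrier → Carrier → Carrier
  polar i j k c d = (ψ j d + ψ k d) * ψ i c + (ψ i d + ψ k d) * ψ j c + (ψ i d + ψ j d) * ψ k c

  -- Inclusion and exclusion over the nonempty subsets of c, d, 1; the isolated `1#` is the cubic at
  -- 1.
  polarise : ∀ i j k c d → polar i j k c d ≡
    cubic i j k (c + d + 1#) + cubic i j k c + cubic i j k d + 1#
    - cubic i j k (c + d) - cubic i j k (c + 1#) - cubic i j k (d + 1#)
  polarise i j k c d = begin
    polar i j k c d
      ≡⟨ solve 6 (λ ci cj ck di dj dk →
           (dj :+ dk) :* ci :+ (di :+ dk) :* cj :+ (di :+ dj) :* ck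
           := (ci :+ di :+ I) :* (cj :+ dj :+ I) :* (ck :+ dk :+ I) :+ ci :* cj :* ck :+ di :* dj :* dk :+ I
              :- (ci :+ di) :* (cj :+ dj) :* (ck :+ dk) :- (ci :+ I) :* (cj :+ I) :* (ck :+ I) :- (di :+ I) :* (dj :+ I) :* (dk :+ I)) refl
           (ψ i c) (ψ j c) (ψ k c) (ψ i d) (ψ j d) (ψ k d) ⟩
    (ψ i c + ψ i d + 1#) * (ψ j c + ψ j d + 1#) * (ψ k c + ψ k d + 1#) + cubic i j k c + cubic i j k d + 1#
    - (ψ i c + ψ i d) * (ψ j c + ψ j d) * (ψ k c + ψ k d)
    - (ψ i c + 1#) * (ψ j c + 1#) * (ψ k c + 1#) - (ψ i d + 1#) * (ψ j d + 1#) * (ψ k d + 1#)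
      ≡⟨ cong₂ _-_ (cong₂ _-_ (cong₂ _-_ (cong (λ z → z + cubic i j k c + cubic i j k d + 1#)
           (cong₃ (s3 i) (s3 j) (s3 k))) (cong₃ (sym (ψ-+ i c d)) (sym (ψ-+ j c d)) (sym (ψ-+ k c d))))
           (cong₃ (s1 i c) (s1 j c) (s1 k c))) (cong₃ (s1 i d) (s1 j d) (s1 k d)) ⟩
    _ ∎
    where
    cong₃ : ∀ {x x′ y y′ z z′} → x ≡ x′ → y ≡ y′ → z ≡ z′ → x * y * z ≡ x′ * y′ * z′
    cong₃ refl refl refl = refl
    s1 : ∀ i x → ψ i x + 1# ≡ ψ i (x + 1#)
    s1 i x = trans (cong (ψ i x +_) (sym (ψ-1 i))) (sym (ψ-+ i x 1#))
    s3 : ∀ i → ψ i c + ψ i d + 1# ≡ ψ i (c + d + 1#)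
    s3 i = trans (cong (_+ 1#) (sym (ψ-+ i c d))) (s1 i (c + d))

  private
    polar₀₁₂-coefficients : Carrier → Skew
    polar₀₁₂-coefficients d = vec₄ (φ d + φ² d) (d + φ² d) (d + φ d) 0#

    polar-coefficients : Fin 4 → Fin 4 → Fin 4 → Carrier → Skew
    polar-coefficients i j k d m =
      single i (ψ j d + ψ k d) m + single j (ψ i d + ψ k d) m + single k (ψ i d + ψ j d) m - polar₀₁₂-coefficients d m

    polar-coefficients-value : ∀ i j k d c → skewValue (polar-coefficients i j k d) c ≡ polar i j k c d - polar 0F 1F 2F c d
    polar-coefficients-value i j k d c = begin
      skewValue (polar-coefficients i j k d) c
        ≡⟨ solve 17 (λ c u₀ u₁ u₂ u₃ v₀ v₁ v₂ v₃ w₀ w₁ w₂ w₃ t₀ t₁ t₂ t₃ →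
             skewᴱ (u₀ :+ v₀ :+ w₀ :- t₀) (u₁ :+ v₁ :+ w₁ :- t₁) (u₂ :+ v₂ :+ w₂ :- t₂) (u₃ :+ v₃ :+ w₃ :- t₃) c
             := skewᴱ u₀ u₁ u₂ u₃ c
                :+ skewᴱ v₀ v₁ v₂ v₃ c
                :+ skewᴱ w₀ w₁ w₂ w₃ c
                :- skewᴱ t₀ t₁ t₂ t₃ c) refl
             c (u 0F) (u 1F) (u 2F) (u 3F) (v 0F) (v 1F) (v 2F) (v 3F) (w 0F) (w 1F) (w 2F) (w 3F) (t 0F) (t 1F) (t 2F) (t 3F) ⟩
      skewValue u c + skewValue v c + skewValue w c - skewValue t c
        ≡⟨ cong₂ _-_ (cong₂ _+_ (cong₂ _+_ (single-value i _ c) (single-value j _ c)) (single-value k _ c))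
             (solve 2 (λ c d → skewᴱ (Φ d :+ Φ² d) (d :+ Φ² d) (d :+ Φ d) O c
               := (Φ d :+ Φ² d) :* c :+ (d :+ Φ² d) :* Φ c :+ (d :+ Φ d) :* Φ² c) refl c d) ⟩
      polar i j k c d - polar 0F 1F 2F c d ∎
      where
      u = single i (ψ j d + ψ k d)
      v = single j (ψ i d + ψ k d)
      w = single k (ψ i d + ψ j d)
      t = polar₀₁₂-coefficients d

  -- Equal cubics have equal polarisations, which are φ-polynomials in c. The coefficient of ψ l is
  -- 0 on one side and a sum of two different conjugates of d on the other, which independence in
  -- the variable d excludes. A comparison of the exponents q^i + q^j + q^k would have to deal with
  -- carries for small q.
  cubics-distinct : ∀ {i j k} → Missing i j k → ¬ (∀ x → cubic i j k x ≡ cubic 0F 1F 2F x)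
  cubics-distinct {i} {j} {k} (l , l≢i , l≢j , l≢k) equal = absurd l (λ d → begin
    polar₀₁₂-coefficients d (inject₁ l)
      ≡⟨ solve 1 (λ t → t := :- (O :+ O :+ O :- t)) refl _ ⟩
    - (0# + 0# + 0# - polar₀₁₂-coefficients d (inject₁ l))
      ≡⟨ cong (λ z → - (z - polar₀₁₂-coefficients d (inject₁ l))) (cong₂ _+_ (cong₂ _+_ (single-≢ _ l≢i) (single-≢ _ l≢j)) (single-≢ _ l≢k)) ⟨
    - polar-coefficients i j k d (inject₁ l)
      ≡⟨ cong -_ (dedekind (polar-coefficients i j k d) (λ c → trans (polar-coefficients-value i j k d c)
           (trans (cong (_- polar 0F 1F 2F c d) (polars-equal c d)) (-‿inverseʳ _))) (inject₁ l)) ⟩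
    - 0#  ≡⟨ -0#≈0# ⟩
    0# ∎)
    where
    polars-equal : ∀ c d → polar i j k c d ≡ polar 0F 1F 2F c d
    polars-equal c d = begin
      polar i j k c d       ≡⟨ polarise i j k c d ⟩
      _                     ≡⟨ cong₂ _-_ (cong₂ _-_ (cong₂ _-_ (cong (_+ 1#) (cong₂ _+_ (cong₂ _+_ (equal _) (equal c)) (equal d))) (equal _)) (equal _)) (equal _) ⟩
      _                     ≡⟨ polarise 0F 1F 2F c d ⟨
      polar 0F 1F 2F c d    ∎
    absurd : ∀ l → ¬ (∀ d → polar₀₁₂-coefficients d (inject₁ l) ≡ 0#)
    absurd 0F eq = 1≢0 (dedekind (vec₄ 0# 1# 1# 0#) (λ d → trans
      (solve 1 (λ d → skewᴱ O I I O d := Φ d :+ Φ² d) refl d) (eq d)) 1F)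
    absurd 1F eq = 1≢0 (dedekind (vec₄ 1# 0# 1# 0#) (λ d → trans
      (solve 1 (λ d → skewᴱ I O I O d := d :+ Φ² d) refl d) (eq d)) 0F)
    absurd 2F eq = 1≢0 (dedekind (vec₄ 1# 1# 0# 0#) (λ d → trans
      (solve 1 (λ d → skewᴱ I I O O d := d :+ Φ d) refl d) (eq d)) 0F)

  -- 1 / (x φ(x) φ²(x)), and 0 at x = 0
  J : Carrier → Carrier
  J x = inv x * φ (inv x) * φ² (inv x)

  J-* : ∀ x y → J (x * y) ≡ J x * J y
  J-* x y = trans (cong (λ z → z * φ z * φ² z) (inv-* x y))
    (solve 2 (λ x y → x :* y :* Φ (x :* y) :* Φ² (x :* y) := x :* Φ x :* Φ² x :* (y :* Φ y :* Φ² y)) refl (inv x) (inv y))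

  cubic-*-J : ∀ {x} → x ≢ 0# → cubic 0F 1F 2F x * J x ≡ 1#
  cubic-*-J {x} x≢0 = begin
    cubic 0F 1F 2F x * J x
      ≡⟨ solve 2 (λ x i → x :* Φ x :* Φ² x :* (i :* Φ i :* Φ² i) := x :* i :* Φ (x :* i) :* Φ² (x :* i)) refl x (inv x) ⟩
    x * inv x * φ (x * inv x) * φ² (x * inv x)
      ≡⟨ cong (λ z → z * φ z * φ² z) (x*inv≡1 x≢0) ⟩
    1# * φ 1# * φ² 1#
      ≡⟨ solve 0 (I :* Φ I :* Φ² I := I) refl ⟩
    1# ∎

  J≢0 : ∀ {x} → x ≢ 0# → J x ≢ 0#
  J≢0 {x} x≢0 J≡0 = 0≢1 (trans (sym (zeroʳ (cubic 0F 1F 2F x))) (trans (cong (cubic 0F 1F 2F x *_) (sym J≡0)) (cubic-*-J x≢0)))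

  character : Fin 4 → Fin 4 → Fin 4 → Carrier → Carrier
  character i j k x = cubic i j k x * J x

  character-sum : Fin 4 → Fin 4 → Fin 4 → Carrier
  character-sum i j k = ∑ᴷ (character i j k)

  character-* : ∀ i j k x y → character i j k (x * y) ≡ character i j k x * character i j k y
  character-* i j k x y = begin
    ψ i (x * y) * ψ j (x * y) * ψ k (x * y) * J (x * y)
      ≡⟨ cong₂ _*_ (cong₂ _*_ (cong₂ _*_ (ψ-* i x y) (ψ-* j x y)) (ψ-* k x y)) (J-* x y) ⟩
    ψ i x * ψ i y * (ψ j x * ψ j y) * (ψ k x * ψ k y) * (J x * J y)
      ≡⟨ solve 8 (λ a b c d e f g h → a :* b :* (c :* d) :* (e :* f) :* (g :* h) := a :* c :* e :* g :* (b :* d :* f :* h)) refl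
           (ψ i x) (ψ i y) (ψ j x) (ψ j y) (ψ k x) (ψ k y) (J x) (J y) ⟩
    character i j k x * character i j k y ∎

  -- Dilation by an element where the character is not 1 multiplies the sum by that value.
  character-sum-missing : ∀ {i j k} → Missing i j k → character-sum i j k ≡ 0#
  character-sum-missing {i} {j} {k} miss
    with ∃? (λ c → ¬? (cubic i j k c ≟ cubic 0F 1F 2F c))
  ... | no none = contradiction (λ x → decidable-stable (cubic i j k x ≟ cubic 0F 1F 2F x) (λ differ → none (x , differ))) (cubics-distinct miss)
  ... | yes (c , differ) = xy≡0⇒y≡0 χc-1≢0 (begin
    (χ c - 1#) * s                       ≡⟨ solve 2 (λ c s → (c :- I) :* s := c :* s :- s) refl (χ c) s ⟩
    χ c * s - s                          ≡⟨ cong (_- s) (∑ᴷ-*ˡ (χ c) χ) ⟨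
    ∑ᴷ (λ x → χ c * χ x) - s             ≡⟨ cong (_- s) (∑ᴷ-cong (λ x → character-* i j k c x)) ⟨
    ∑ᴷ (λ x → χ (c * x)) - s             ≡⟨ cong (_- s) (∑ᴷ-dilate χ c≢0) ⟨
    s - s                                ≡⟨ -‿inverseʳ s ⟩
    0#                                   ∎)
    where
    χ = character i j k
    s = character-sum i j k
    cubic-0 : ∀ i j k → cubic i j k 0# ≡ 0#
    cubic-0 i j k = trans (cong (ψ i 0# * ψ j 0# *_) (ψ-0 k)) (zeroʳ _)
    c≢0 : c ≢ 0#
    c≢0 refl = differ (trans (cubic-0 i j k) (sym (cubic-0 0F 1F 2F)))
    χc-1≢0 : χ c - 1# ≢ 0#
    χc-1≢0 eq = differ (*-cancelˡ (J≢0 c≢0) (trans (*-comm _ _) (trans (trans (x-y≡0⇒x≡y eq) (sym (cubic-*-J c≢0))) (*-comm _ _))))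

  indicator : ∀ {P : Set} → Dec P → Carrier
  indicator P? = if does P? then 1# else 0#

  indicator-yes : ∀ {P : Set} (P? : Dec P) → P → indicator P? ≡ 1#
  indicator-yes (yes _) _ = refl
  indicator-yes (no ¬p) p = contradiction p ¬p

  indicator-no : ∀ {P : Set} (P? : Dec P) → ¬ P → indicator P? ≡ 0#
  indicator-no (yes p) ¬p = contradiction p ¬p
  indicator-no (no _)  _  = refl

  -- The sum of the trivial character, |K| - 1 = -1 in K; it serves as a factor to be cancelled.
  ε : Carrier
  ε = character-sum 0F 1F 2F

  ∑ᴷ-indicator-0 : ∑ᴷ (λ x → indicator (x ≟ 0#)) ≡ 1#
  ∑ᴷ-indicator-0 = trans (∑ᴷ-single (λ x → indicator (x ≟ 0#)) 0# (λ x x≢0 → indicator-no (x ≟ 0#) x≢0)) (indicator-yes (0# ≟ 0#) refl)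

  ε≢0 : ε ≢ 0#
  ε≢0 ε≡0 = 1≢0 (begin
    1#                                                                   ≡⟨ +-identityˡ 1# ⟨
    0# + 1#                                                              ≡⟨ cong₂ _+_ ε≡0 ∑ᴷ-indicator-0 ⟨
    ε + ∑ᴷ (λ x → indicator (x ≟ 0#))                                    ≡⟨ ∑ᴷ-∙ (character 0F 1F 2F) (λ x → indicator (x ≟ 0#)) ⟨
    ∑ᴷ (λ x → character 0F 1F 2F x + indicator (x ≟ 0#))                 ≡⟨ ∑ᴷ-cong (λ x → pointwise x (x ≟ 0#)) ⟩
    ∑ᴷ (λ _ → 1#)                                                        ≡⟨ ∑ᴷ-1≡0 ⟩
    0#                                                                   ∎)
    where
    pointwise : ∀ x (d : Dec (x ≡ 0#)) → character 0F 1F 2F x + indicator d ≡ 1#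
    pointwise x (yes refl) = solve 3 (λ a b c → O :* a :* b :* c :+ I := I) refl (φ 0#) (φ² 0#) (J 0#)
    pointwise x (no x≢0)   = trans (+-identityʳ _) (cubic-*-J x≢0)

  character-sum-permutation : ∀ {i j k} → IsPermutation i j k → character-sum i j k ≡ ε
  character-sum-permutation p = All.lookup
    {P = λ (i , j , k) → character-sum i j k ≡ ε}
    (refl
    ∷ ∑ᴷ-cong (λ x → solve 2 (λ x j → x :* Φ² x :* Φ x :* j := x :* Φ x :* Φ² x :* j) refl x (J x))
    ∷ ∑ᴷ-cong (λ x → solve 2 (λ x j → Φ x :* x :* Φ² x :* j := x :* Φ x :* Φ² x :* j) refl x (J x))
    ∷ ∑ᴷ-cong (λ x → solve 2 (λ x j → Φ x :* Φ² x :* x :* j := x :* Φ x :* Φ² x :* j) refl x (J x))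
    ∷ ∑ᴷ-cong (λ x → solve 2 (λ x j → Φ² x :* x :* Φ x :* j := x :* Φ x :* Φ² x :* j) refl x (J x))
    ∷ ∑ᴷ-cong (λ x → solve 2 (λ x j → Φ² x :* Φ x :* x :* j := x :* Φ x :* Φ² x :* j) refl x (J x))
    ∷ []) p

  private
    -- All six orders count with 1, so a permanent arises and not a determinant.
    sign : Fin 4 → Fin 4 → Fin 4 → Carrier
    sign i j k = if does (isPermutation? i j k) then 1# else 0#

    signᴱ : ∀ {n} → Fin 4 → Fin 4 → Fin 4 → Expr n
    signᴱ i j k = if does (isPermutation? i j k) then I else O

    character-sum-value : ∀ i j k → character-sum i j k ≡ ε * sign i j k
    character-sum-value i j k = cases (isPermutation? i j k) (missing-or-permutation i j k)
      where
      cases : (d : Dec (IsPermutation i j k)) → Missing i j k ⊎ IsPermutation i j k →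
              character-sum i j k ≡ ε * (if does d then 1# else 0#)
      cases (yes p) _        = trans (character-sum-permutation p) (sym (*-identityʳ ε))
      cases (no _)  (inj₁ m) = trans (character-sum-missing m) (sym (zeroʳ ε))
      cases (no ¬p) (inj₂ p) = contradiction p ¬p

    sum₄ : (Fin 4 → Carrier) → Carrier
    sum₄ f = f 0F + (f 1F + (f 2F + (f 3F + 0#)))

    sum₄ᴱ : ∀ {n} → (Fin 4 → Expr n) → Expr n
    sum₄ᴱ f = f 0F :+ (f 1F :+ (f 2F :+ (f 3F :+ O)))

    vec₄ᴱ : ∀ {n} → Expr n → Expr n → Expr n → Expr n → Fin 4 → Expr n
    vec₄ᴱ a b c d 0F = a
    vec₄ᴱ a b c d 1F = b
    vec₄ᴱ a b c d 2F = c
    vec₄ᴱ a b c d 3F = d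

    sum₄-cong : ∀ {f g} → (∀ i → f i ≡ g i) → sum₄ f ≡ sum₄ g
    sum₄-cong eq = cong₂ _+_ (eq 0F) (cong₂ _+_ (eq 1F) (cong₂ _+_ (eq 2F) (cong (_+ 0#) (eq 3F))))

    ∑ᴷ-skewValue : ∀ (u : Skew) (R : Carrier → Carrier) → ∑ᴷ (λ x → skewValue u x * R x) ≡ sum₄ (λ i → u i * ∑ᴷ (λ x → ψ i x * R x))
    ∑ᴷ-skewValue u R = begin
      ∑ᴷ (λ x → skewValue u x * R x)
        ≡⟨ ∑ᴷ-cong (λ x → solve 6 (λ x r a b c d →
             (skewᴱ a b c d x) :* r
             := a :* (x :* r) :+ (b :* (Φ x :* r) :+ (c :* (Φ² x :* r) :+ d :* (Φ³ x :* r)))) refl x (R x) (u 0F) (u 1F) (u 2F) (u 3F)) ⟩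
      ∑ᴷ (λ x → t 0F x + (t 1F x + (t 2F x + t 3F x)))
        ≡⟨ ∑ᴷ-∙ (t 0F) (λ x → t 1F x + (t 2F x + t 3F x)) ⟩
      ∑ᴷ (t 0F) + ∑ᴷ (λ x → t 1F x + (t 2F x + t 3F x))
        ≡⟨ cong (∑ᴷ (t 0F) +_) (trans (∑ᴷ-∙ (t 1F) (λ x → t 2F x + t 3F x)) (cong (∑ᴷ (t 1F) +_) (∑ᴷ-∙ (t 2F) (t 3F)))) ⟩
      ∑ᴷ (t 0F) + (∑ᴷ (t 1F) + (∑ᴷ (t 2F) + ∑ᴷ (t 3F)))
        ≡⟨ cong (λ z → ∑ᴷ (t 0F) + (∑ᴷ (t 1F) + (∑ᴷ (t 2F) + z))) (+-identityʳ _) ⟨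
      sum₄ (λ i → ∑ᴷ (t i))
        ≡⟨ sum₄-cong (λ i → ∑ᴷ-*ˡ (u i) (λ x → ψ i x * R x)) ⟩
      sum₄ (λ i → u i * ∑ᴷ (λ x → ψ i x * R x)) ∎
      where
      t : Fin 4 → Carrier → Carrier
      t i x = u i * (ψ i x * R x)

  permanent : Skew → Skew → Skew → Carrier
  permanent u v w = u 0F * (v 1F * w 2F + v 2F * w 1F) + u 1F * (v 0F * w 2F + v 2F * w 0F) + u 2F * (v 0F * w 1F + v 1F * w 0F)

  ∑ᴷ-triple : ∀ (u v w : Skew) → ∑ᴷ (λ x → skewValue u x * (skewValue v x * (skewValue w x * J x))) ≡ ε * permanent u v w
  ∑ᴷ-triple u v w = begin
    ∑ᴷ (λ x → skewValue u x * (skewValue v x * (skewValue w x * J x)))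
      ≡⟨ ∑ᴷ-skewValue u (λ x → skewValue v x * (skewValue w x * J x)) ⟩
    sum₄ (λ i → u i * ∑ᴷ (λ x → ψ i x * (skewValue v x * (skewValue w x * J x))))
      ≡⟨ sum₄-cong (λ i → cong (u i *_) (trans (∑ᴷ-cong (λ x → swap (ψ i x) (skewValue v x) (skewValue w x * J x))) (∑ᴷ-skewValue v (λ x → ψ i x * (skewValue w x * J x))))) ⟩
    sum₄ (λ i → u i * sum₄ (λ j → v j * ∑ᴷ (λ x → ψ j x * (ψ i x * (skewValue w x * J x)))))
      ≡⟨ sum₄-cong (λ i → cong (u i *_) (sum₄-cong (λ j → cong (v j *_)
           (trans (∑ᴷ-cong (λ x → swap₂ (ψ j x) (ψ i x) (skewValue w x) (J x))) (∑ᴷ-skewValue w (λ x → ψ j x * (ψ i x * J x))))))) ⟩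
    sum₄ (λ i → u i * sum₄ (λ j → v j * sum₄ (λ k → w k * ∑ᴷ (λ x → ψ k x * (ψ j x * (ψ i x * J x))))))
      ≡⟨ sum₄-cong (λ i → cong (u i *_) (sum₄-cong (λ j → cong (v j *_) (sum₄-cong (λ k → cong (w k *_)
           (trans (∑ᴷ-cong (λ x → reorder (ψ k x) (ψ j x) (ψ i x) (J x))) (character-sum-value i j k))))))) ⟩
    sum₄ (λ i → u i * sum₄ (λ j → v j * sum₄ (λ k → w k * (ε * sign i j k))))
      ≡⟨ solve 13 (λ e u₀ u₁ u₂ u₃ v₀ v₁ v₂ v₃ w₀ w₁ w₂ w₃ →
           sum₄ᴱ (λ i → vec₄ᴱ u₀ u₁ u₂ u₃ i :* sum₄ᴱ (λ j → vec₄ᴱ v₀ v₁ v₂ v₃ j :* sum₄ᴱ (λ k → vec₄ᴱ w₀ w₁ w₂ w₃ k :* (e :* signᴱ i j k))))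
           := e :* (u₀ :* (v₁ :* w₂ :+ v₂ :* w₁) :+ u₁ :* (v₀ :* w₂ :+ v₂ :* w₀) :+ u₂ :* (v₀ :* w₁ :+ v₁ :* w₀))) refl
           ε (u 0F) (u 1F) (u 2F) (u 3F) (v 0F) (v 1F) (v 2F) (v 3F) (w 0F) (w 1F) (w 2F) (w 3F) ⟩
    ε * permanent u v w ∎
    where
    swap : ∀ a b c → a * (b * c) ≡ b * (a * c)
    swap = solve 3 (λ a b c → a :* (b :* c) := b :* (a :* c)) refl
    swap₂ : ∀ a b c d → a * (b * (c * d)) ≡ c * (a * (b * d))
    swap₂ = solve 4 (λ a b c d → a :* (b :* (c :* d)) := c :* (a :* (b :* d))) refl
    reorder : ∀ a b c d → a * (b * (c * d)) ≡ c * b * a * d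
    reorder = solve 4 (λ a b c d → a :* (b :* (c :* d)) := c :* b :* a :* d) refl

  -- The values f(x)/x and the invariants of their set.

  EigenValue : (Carrier → Carrier) → Carrier → Set
  EigenValue f z = ∃[ x ] (x ≢ 0# × f x ≡ z * x)

  module _ (a : Skew) where

    private
      f : Carrier → Carrier
      f = skewValue a

    eigenvalue? : ∀ z → Dec (EigenValue f z)
    eigenvalue? z = ∃? λ x → ¬? (x ≟ 0#) ×-dec f x ≟ z * x

    -- A nonzero element of ker(f - z) is a period of the indicator of this kernel, so the sum
    -- vanishes; in a trivial kernel only x = 0 contributes.
    ∑ᴷ-eigen : ∀ z → ∑ᴷ (λ x → indicator (f x ≟ z * x)) ≡ (if does (eigenvalue? z) then 0# else 1#)
    ∑ᴷ-eigen z = cases (eigenvalue? z)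
      where
      cases : (d : Dec (EigenValue f z)) → ∑ᴷ (λ x → indicator (f x ≟ z * x)) ≡ (if does d then 0# else 1#)
      cases (yes (r , r≢0 , fr≡zr)) = ∑ᴷ-periodic _ r r≢0 λ x → periodic x (f (x + r) ≟ z * (x + r)) (f x ≟ z * x)
        where
        shift : ∀ x → f (x + r) ≡ f x + z * r
        shift x = trans (skewValue-+ a x r) (cong (f x +_) fr≡zr)
        periodic : ∀ x (d : Dec (f (x + r) ≡ z * (x + r))) (d′ : Dec (f x ≡ z * x)) → indicator d ≡ indicator d′
        periodic x (yes _)  (yes _)  = refl
        periodic x (no _)   (no _)   = refl
        periodic x (yes eq) (no ¬eq) = contradiction (begin
          f x                     ≡⟨ solve 3 (λ f z r → f := f :+ z :* r :- z :* r) refl (f x) z r ⟩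
          f x + z * r - z * r     ≡⟨ cong (_- z * r) (trans (sym (shift x)) eq) ⟩
          z * (x + r) - z * r     ≡⟨ solve 3 (λ x z r → z :* (x :+ r) :- z :* r := z :* x) refl x z r ⟩
          z * x                   ∎) ¬eq
        periodic x (no ¬eq) (yes eq) = contradiction (trans (shift x) (trans (cong (_+ z * r) eq) (sym (distribˡ z x r)))) ¬eq
      cases (no ¬eigen) = trans
        (∑ᴷ-single _ 0# (λ x x≢0 → indicator-no (f x ≟ z * x) (λ eq → ¬eigen (x , x≢0 , eq))))
        (indicator-yes (f 0# ≟ z * 0#) (trans (skewValue-0 a) (sym (zeroʳ z))))

    -- The subtracted `1#` is the element x = 0: it lies in ker(f - z), but not in the fibre over z
    -- ≠ 0 since `inv 0#` is 0.
    ∑ᴷ-ratio-indicator : ∀ z → z ≢ 0# →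
      ∑ᴷ (λ x → indicator (z ≟ f x * inv x)) ≡ (if does (eigenvalue? z) then 0# else 1#) - 1#
    ∑ᴷ-ratio-indicator z z≢0 = begin
      s                                              ≡⟨ solve 1 (λ s → s := s :+ I :- I) refl s ⟩
      s + 1# - 1#                                    ≡⟨ cong (λ t → s + t - 1#) ∑ᴷ-indicator-0 ⟨
      s + ∑ᴷ (λ x → indicator (x ≟ 0#)) - 1#         ≡⟨ cong (_- 1#) (∑ᴷ-∙ (λ x → indicator (z ≟ f x * inv x)) (λ x → indicator (x ≟ 0#))) ⟨
      ∑ᴷ (λ x → indicator (z ≟ f x * inv x) + indicator (x ≟ 0#)) - 1#
        ≡⟨ cong (_- 1#) (∑ᴷ-cong (λ x → pointwise x (z ≟ f x * inv x) (x ≟ 0#) (f x ≟ z * x))) ⟩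
      ∑ᴷ (λ x → indicator (f x ≟ z * x)) - 1#        ≡⟨ cong (_- 1#) (∑ᴷ-eigen z) ⟩
      (if does (eigenvalue? z) then 0# else 1#) - 1# ∎
      where
      s = ∑ᴷ (λ x → indicator (z ≟ f x * inv x))
      pointwise : ∀ x (d : Dec (z ≡ f x * inv x)) (d₀ : Dec (x ≡ 0#)) (d′ : Dec (f x ≡ z * x)) →
                  indicator d + indicator d₀ ≡ indicator d′
      pointwise x (yes eq) (yes refl) d′ = contradiction (trans eq (trans (cong (f 0# *_) inv-0) (zeroʳ _))) z≢0
      pointwise x (no _) (yes refl) d′ = trans (+-identityˡ 1#) (sym (indicator-yes d′ (trans (skewValue-0 a) (sym (zeroʳ z)))))
      pointwise x (yes eq) (no x≢0) d′ = trans (+-identityʳ 1#) (sym (indicator-yes d′ (begin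
        f x                  ≡⟨ *-identityʳ _ ⟨
        f x * 1#             ≡⟨ cong (f x *_) (x*inv≡1 x≢0) ⟨
        f x * (x * inv x)    ≡⟨ solve 3 (λ f x i → f :* (x :* i) := f :* i :* x) refl (f x) x (inv x) ⟩
        f x * inv x * x      ≡⟨ cong (_* x) eq ⟨
        z * x                ∎)))
      pointwise x (no ¬eq) (no x≢0) d′ = trans (+-identityʳ 0#) (sym (indicator-no d′ (λ eq → ¬eq (begin
        z                    ≡⟨ *-identityʳ z ⟨
        z * 1#               ≡⟨ cong (z *_) (x*inv≡1 x≢0) ⟨
        z * (x * inv x)      ≡⟨ *-assoc _ _ _ ⟨
        z * x * inv x        ≡⟨ cong (_* inv x) eq ⟨
        f x * inv x          ∎))))

    -- Sum over the fibres of f(x)/x. Θ(0) = 0 removes the fibre over 0, to which x = 0 has been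
    -- added artificially.
    ∑ᴷ-ratio : ∀ (Θ : Carrier → Carrier) → Θ 0# ≡ 0# →
      ∑ᴷ (λ x → Θ (f x * inv x)) ≡ ∑ᴷ (λ z → Θ z * ((if does (eigenvalue? z) then 0# else 1#) - 1#))
    ∑ᴷ-ratio Θ Θ0≡0 = begin
      ∑ᴷ (λ x → Θ (f x * inv x))
        ≡⟨ ∑ᴷ-cong (λ x → sym (trans
             (∑ᴷ-single (λ z → Θ z * indicator (z ≟ f x * inv x)) (f x * inv x)
               (λ z z≢ → trans (cong (Θ z *_) (indicator-no (z ≟ f x * inv x) z≢)) (zeroʳ _)))
             (trans (cong (Θ (f x * inv x) *_) (indicator-yes (f x * inv x ≟ f x * inv x) refl)) (*-identityʳ _)))) ⟩
      ∑ᴷ (λ x → ∑ᴷ (λ z → Θ z * indicator (z ≟ f x * inv x)))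
        ≡⟨ ∑ᴷ-comm (λ x z → Θ z * indicator (z ≟ f x * inv x)) ⟩
      ∑ᴷ (λ z → ∑ᴷ (λ x → Θ z * indicator (z ≟ f x * inv x)))
        ≡⟨ ∑ᴷ-cong (λ z → trans (∑ᴷ-*ˡ (Θ z) (λ x → indicator (z ≟ f x * inv x))) (pointwise z (z ≟ 0#))) ⟩
      ∑ᴷ (λ z → Θ z * ((if does (eigenvalue? z) then 0# else 1#) - 1#)) ∎
      where
      pointwise : ∀ z → Dec (z ≡ 0#) → Θ z * ∑ᴷ (λ x → indicator (z ≟ f x * inv x)) ≡ Θ z * ((if does (eigenvalue? z) then 0# else 1#) - 1#)
      pointwise z (yes refl) = trans (trans (cong (λ t → t * ∑ᴷ (λ x → indicator (0# ≟ f x * inv x))) Θ0≡0) (zeroˡ _))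
        (sym (trans (cong (λ t → t * ((if does (eigenvalue? 0#) then 0# else 1#) - 1#)) Θ0≡0) (zeroˡ _)))
      pointwise z (no z≢0)   = cong (Θ z *_) (∑ᴷ-ratio-indicator z z≢0)

  SameEigenvalues : Skew → Skew → Set
  SameEigenvalues a b = ∀ z → (EigenValue (skewValue a) z → EigenValue (skewValue b) z) × (EigenValue (skewValue b) z → EigenValue (skewValue a) z)

  ∑ᴷ-ratio-invariant : ∀ a b → SameEigenvalues a b → ∀ (Θ : Carrier → Carrier) → Θ 0# ≡ 0# →
    ∑ᴷ (λ x → Θ (skewValue a x * inv x)) ≡ ∑ᴷ (λ x → Θ (skewValue b x * inv x))
  ∑ᴷ-ratio-invariant a b same Θ Θ0≡0 = trans (∑ᴷ-ratio a Θ Θ0≡0)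
    (trans (∑ᴷ-cong (λ z → cong (λ t → Θ z * (t - 1#)) (equal z (eigenvalue? a z) (eigenvalue? b z)))) (sym (∑ᴷ-ratio b Θ Θ0≡0)))
    where
    equal : ∀ z (d : Dec (EigenValue (skewValue a) z)) (d′ : Dec (EigenValue (skewValue b) z)) →
            (if does d then 0# else 1#) ≡ (if does d′ then 0# else 1#)
    equal z (yes _) (yes _) = refl
    equal z (no _)  (no _)  = refl
    equal z (yes e) (no ¬e) = contradiction (proj₁ (same z) e) ¬e
    equal z (no ¬e) (yes e) = contradiction (proj₂ (same z) e) ¬e

  twist : Skew → Skew
  twist a = vec₄ (φ (a 3F)) (φ (a 0F)) (φ (a 1F)) (φ (a 2F))

  twist-value : ∀ a x → skewValue (twist a) x ≡ φ (skewValue a x)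
  twist-value a x = solve 5 (λ x a b c d →
    Φ d :* x :+ (Φ a :* Φ x :+ (Φ b :* Φ² x :+ (Φ c :* Φ³ x :+ O)))
    := Φ (skewᴱ a b c d x)) refl x (a 0F) (a 1F) (a 2F) (a 3F)

  private
    -- This and the two lemmas after it hold at x = 0 too, so the expansions of Θ(f(x)/x) need no
    -- case distinction.
    inv-absorb : ∀ x → inv x * (x * inv x) ≡ inv x
    inv-absorb x = cases (x ≟ 0#)
      where
      cases : Dec (x ≡ 0#) → inv x * (x * inv x) ≡ inv x
      cases (yes refl) = trans (cong (inv 0# *_) (zeroˡ _)) (trans (zeroʳ _) (sym inv-0))
      cases (no x≢0)   = trans (cong (inv x *_) (x*inv≡1 x≢0)) (*-identityʳ _)

    unit-φ : ∀ x → φ (x * inv x) ≡ x * inv x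
    unit-φ x = cases (x ≟ 0#)
      where
      cases : Dec (x ≡ 0#) → φ (x * inv x) ≡ x * inv x
      cases (yes refl) = trans (cong φ (zeroˡ _)) (trans φ-0 (sym (zeroˡ _)))
      cases (no x≢0)   = trans (cong φ (x*inv≡1 x≢0)) (trans φ-1 (sym (x*inv≡1 x≢0)))

    unit-φ² : ∀ x → φ² (x * inv x) ≡ x * inv x
    unit-φ² x = trans (cong φ (unit-φ x)) (unit-φ x)

  -- Over the common denominator x φ(x) φ²(x) the numerator of Θ(f(x)/x) is a product of three
  -- φ-polynomials, and its sum is a permanent of their coefficients.
  ratio-sum : ∀ a b → SameEigenvalues a b → ∀ (Θ : Carrier → Carrier) → Θ 0# ≡ 0# → ∀ (v w : Skew → Skew) →
    (∀ a x → Θ (skewValue a x * inv x) ≡ skewValue a x * (skewValue (v a) x * (skewValue (w a) x * J x))) →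
    permanent a (v a) (w a) ≡ permanent b (v b) (w b)
  ratio-sum a b same Θ Θ0≡0 v w expand = *-cancelˡ ε≢0 (begin
    ε * permanent a (v a) (w a)         ≡⟨ ∑ᴷ-triple a (v a) (w a) ⟨
    _                                   ≡⟨ ∑ᴷ-cong (expand a) ⟨
    ∑ᴷ (λ x → Θ (skewValue a x * inv x)) ≡⟨ ∑ᴷ-ratio-invariant a b same Θ Θ0≡0 ⟩
    ∑ᴷ (λ x → Θ (skewValue b x * inv x)) ≡⟨ ∑ᴷ-cong (expand b) ⟩
    _                                   ≡⟨ ∑ᴷ-triple b (v b) (w b) ⟩
    ε * permanent b (v b) (w b)         ∎)

  φᴸ φ²ᴸ : Skew
  φᴸ  = vec₄ 0# 1# 0# 0#
  φ²ᴸ = vec₄ 0# 0# 1# 0#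

  φᴸ-value : ∀ x → skewValue φᴸ x ≡ φ x
  φᴸ-value = solve 1 (λ x → skewᴱ O I O O x := Φ x) refl

  φ²ᴸ-value : ∀ x → skewValue φ²ᴸ x ≡ φ² x
  φ²ᴸ-value = solve 1 (λ x → skewᴱ O O I O x := Φ² x) refl

  module Invariants (a b : Skew) (same : SameEigenvalues a b) where

    invariant₀ : a 0F ≡ b 0F
    invariant₀ = begin
      a 0F                       ≡⟨ simplify a ⟩
      permanent a φᴸ φ²ᴸ         ≡⟨ ratio-sum a b same (λ z → z) refl (λ _ → φᴸ) (λ _ → φ²ᴸ) expand ⟩
      permanent b φᴸ φ²ᴸ         ≡⟨ simplify b ⟨
      b 0F                       ∎
      where
      simplify : ∀ a → a 0F ≡ permanent a φᴸ φ²ᴸ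
      simplify a = solve 3 (λ a b c → a := a :* (I :* I :+ O :* O) :+ b :* (O :* I :+ O :* O) :+ c :* (O :* O :+ I :* O)) refl (a 0F) (a 1F) (a 2F)
      expand : ∀ a x → skewValue a x * inv x ≡ skewValue a x * (skewValue φᴸ x * (skewValue φ²ᴸ x * J x))
      expand a x = sym (begin
        f * (skewValue φᴸ x * (skewValue φ²ᴸ x * J x))  ≡⟨ cong₂ (λ s t → f * (s * (t * J x))) (φᴸ-value x) (φ²ᴸ-value x) ⟩
        f * (φ x * (φ² x * J x))
          ≡⟨ solve 3 (λ f x i → f :* (Φ x :* (Φ² x :* (i :* Φ i :* Φ² i))) := f :* (i :* Φ (x :* i) :* Φ² (x :* i))) refl f x (inv x) ⟩
        f * (inv x * φ (x * inv x) * φ² (x * inv x))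
          ≡⟨ cong₂ (λ s t → f * (inv x * s * t)) (unit-φ x) (unit-φ² x) ⟩
        f * (inv x * (x * inv x) * (x * inv x))
          ≡⟨ cong (f *_) (trans (cong (_* (x * inv x)) (inv-absorb x)) (inv-absorb x)) ⟩
        f * inv x ∎)
        where f = skewValue a x

    module _ (a₀≡0 : a 0F ≡ 0#) (b₀≡0 : b 0F ≡ 0#) where

      -- The permanent of f, φ ∘ f and φ² is a₀φ(a₀) + a₁φ(a₃); the normalisation a₀ = 0 isolates
      -- the second term.
      invariant₁ : a 1F * φ (a 3F) ≡ b 1F * φ (b 3F)
      invariant₁ = begin
        a 1F * φ (a 3F)                    ≡⟨ simplify a a₀≡0 ⟩
        permanent a (twist a) φ²ᴸ          ≡⟨ ratio-sum a b same (λ z → z * φ z) (zeroˡ _) twist (λ _ → φ²ᴸ) expand ⟩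
        permanent b (twist b) φ²ᴸ          ≡⟨ simplify b b₀≡0 ⟨
        b 1F * φ (b 3F)                    ∎
        where
        simplify : ∀ a → a 0F ≡ 0# → a 1F * φ (a 3F) ≡ permanent a (twist a) φ²ᴸ
        simplify a a₀≡0 = trans
          (solve 4 (λ a₁ a₂ a₃ p → a₁ :* Φ a₃ := O :* (p :* I :+ Φ a₁ :* O) :+ a₁ :* (Φ a₃ :* I :+ Φ a₁ :* O) :+ a₂ :* (Φ a₃ :* O :+ p :* O)) refl
            (a 1F) (a 2F) (a 3F) (φ (a 0F)))
          (cong (λ z → z * (φ (a 0F) * 1# + φ (a 1F) * 0#) + a 1F * (φ (a 3F) * 1# + φ (a 1F) * 0#) + a 2F * (φ (a 3F) * 0# + φ (a 0F) * 0#)) (sym a₀≡0))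
        expand : ∀ a x → skewValue a x * inv x * φ (skewValue a x * inv x) ≡ skewValue a x * (skewValue (twist a) x * (skewValue φ²ᴸ x * J x))
        expand a x = sym (begin
          f * (skewValue (twist a) x * (skewValue φ²ᴸ x * J x))  ≡⟨ cong₂ (λ s t → f * (s * (t * J x))) (twist-value a x) (φ²ᴸ-value x) ⟩
          f * (φ f * (φ² x * J x))
            ≡⟨ solve 3 (λ f x i → f :* (Φ f :* (Φ² x :* (i :* Φ i :* Φ² i))) := f :* Φ (f :* i) :* (i :* Φ² (x :* i))) refl f x (inv x) ⟩
          f * φ (f * inv x) * (inv x * φ² (x * inv x))
            ≡⟨ cong (f * φ (f * inv x) *_) (trans (cong (inv x *_) (unit-φ² x)) (inv-absorb x)) ⟩
          f * φ (f * inv x) * inv x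
            ≡⟨ solve 2 (λ f i → f :* Φ (f :* i) :* i := f :* i :* Φ (f :* i)) refl f (inv x) ⟩
          f * inv x * φ (f * inv x) ∎)
          where f = skewValue a x

      invariant₂ : a 2F * φ² (a 2F) ≡ b 2F * φ² (b 2F)
      invariant₂ = begin
        a 2F * φ² (a 2F)                ≡⟨ simplify a a₀≡0 ⟩
        permanent a φᴸ (twist (twist a))   ≡⟨ ratio-sum a b same (λ z → z * φ² z) (zeroˡ _) (λ _ → φᴸ) (λ a → twist (twist a)) expand ⟩
        permanent b φᴸ (twist (twist b))   ≡⟨ simplify b b₀≡0 ⟨
        b 2F * φ² (b 2F)                ∎
        where
        simplify : ∀ a → a 0F ≡ 0# → a 2F * φ² (a 2F) ≡ permanent a φᴸ (twist (twist a))
        simplify a a₀≡0 = trans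
          (solve 4 (λ a₁ a₂ a₃ p → a₂ :* Φ² a₂ := O :* (I :* p :+ O :* Φ² a₃) :+ a₁ :* (O :* p :+ O :* Φ² a₂) :+ a₂ :* (O :* Φ² a₃ :+ I :* Φ² a₂)) refl
            (a 1F) (a 2F) (a 3F) (φ² (a 0F)))
          (cong (λ z → z * (1# * φ² (a 0F) + 0# * φ² (a 3F)) + a 1F * (0# * φ² (a 0F) + 0# * φ² (a 2F)) + a 2F * (0# * φ² (a 3F) + 1# * φ² (a 2F))) (sym a₀≡0))
        expand : ∀ a x → skewValue a x * inv x * φ² (skewValue a x * inv x) ≡ skewValue a x * (skewValue φᴸ x * (skewValue (twist (twist a)) x * J x))
        expand a x = sym (begin
          f * (skewValue φᴸ x * (skewValue (twist (twist a)) x * J x))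
            ≡⟨ cong₂ (λ s t → f * (s * (t * J x))) (φᴸ-value x) (trans (twist-value (twist a) x) (cong φ (twist-value a x))) ⟩
          f * (φ x * (φ² f * J x))
            ≡⟨ solve 3 (λ f x i → f :* (Φ x :* (Φ² f :* (i :* Φ i :* Φ² i))) := f :* Φ² (f :* i) :* (i :* Φ (x :* i))) refl f x (inv x) ⟩
          f * φ² (f * inv x) * (inv x * φ (x * inv x))
            ≡⟨ cong (f * φ² (f * inv x) *_) (trans (cong (inv x *_) (unit-φ x)) (inv-absorb x)) ⟩
          f * φ² (f * inv x) * inv x
            ≡⟨ solve 2 (λ f i → f :* Φ² (f :* i) :* i := f :* i :* Φ² (f :* i)) refl f (inv x) ⟩
          f * inv x * φ² (f * inv x) ∎)
          where f = skewValue a x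

      -- Among the four choices of Θ this is the one whose sum mixes the coefficient of φ² with the
      -- other two.
      invariant₃ : a 1F * φ (a 1F) * φ² (a 2F) + a 2F * φ (a 3F) * φ² (a 3F) ≡ b 1F * φ (b 1F) * φ² (b 2F) + b 2F * φ (b 3F) * φ² (b 3F)
      invariant₃ = begin
        _                                        ≡⟨ simplify a a₀≡0 ⟩
        permanent a (twist a) (twist (twist a))  ≡⟨ ratio-sum a b same (λ z → z * φ z * φ² z) (trans (cong (_* φ² 0#) (zeroˡ _)) (zeroˡ _)) twist (λ a → twist (twist a)) expand ⟩
        permanent b (twist b) (twist (twist b))  ≡⟨ simplify b b₀≡0 ⟨
        _                                        ∎
        where
        P : Carrier → Carrier → Carrier → Carrier → Carrier
        P a₀ a₁ a₂ a₃ = a₀ * (φ a₀ * φ² a₀ + φ a₁ * φ² a₃) + a₁ * (φ a₃ * φ² a₀ + φ a₁ * φ² a₂) + a₂ * (φ a₃ * φ² a₃ + φ a₀ * φ² a₂)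
        simplify : ∀ a → a 0F ≡ 0# → a 1F * φ (a 1F) * φ² (a 2F) + a 2F * φ (a 3F) * φ² (a 3F) ≡ permanent a (twist a) (twist (twist a))
        simplify a a₀≡0 = trans
          (solve 3 (λ a₁ a₂ a₃ → a₁ :* Φ a₁ :* Φ² a₂ :+ a₂ :* Φ a₃ :* Φ² a₃ :=
            O :* (Φ O :* Φ² O :+ Φ a₁ :* Φ² a₃) :+ a₁ :* (Φ a₃ :* Φ² O :+ Φ a₁ :* Φ² a₂) :+ a₂ :* (Φ a₃ :* Φ² a₃ :+ Φ O :* Φ² a₂)) refl
            (a 1F) (a 2F) (a 3F))
          (cong (λ z → P z (a 1F) (a 2F) (a 3F)) (sym a₀≡0))
        expand : ∀ a x → skewValue a x * inv x * φ (skewValue a x * inv x) * φ² (skewValue a x * inv x) ≡ skewValue a x * (skewValue (twist a) x * (skewValue (twist (twist a)) x * J x))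
        expand a x = sym (begin
          f * (skewValue (twist a) x * (skewValue (twist (twist a)) x * J x))
            ≡⟨ cong₂ (λ s t → f * (s * (t * J x))) (twist-value a x) (trans (twist-value (twist a) x) (cong φ (twist-value a x))) ⟩
          f * (φ f * (φ² f * J x))
            ≡⟨ solve 2 (λ f i → f :* (Φ f :* (Φ² f :* (i :* Φ i :* Φ² i))) := f :* i :* Φ (f :* i) :* Φ² (f :* i)) refl f (inv x) ⟩
          f * inv x * φ (f * inv x) * φ² (f * inv x) ∎)
          where f = skewValue a x

  -- Equivalence of graphs and self-dual forms.

  -- Proof by certificate: after adding the multiples c(l - r) of the hypotheses, the goal is an
  -- identity that `solve` checks. The cofactors c are the whole content of such a proof.
  use : ∀ {x y l r} c → l ≡ r → x ≡ y + c * (l - r) → x ≡ y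
  use {x} {y} {l} c refl eq = trans eq (solve 3 (λ y c l → y :+ c :* (l :- l) := y) refl y c l)

  -- a ~ b: an invertible K-linear map of K² carries the graph of a onto that of b.
  infix 4 _~_
  record _~_ (a b : Skew) : Set where
    field
      α β γ δ : Carrier
      det≢0   : α * δ - β * γ ≢ 0#
      maps    : ∀ x → skewValue b (α * x + β * skewValue a x) ≡ γ * x + δ * skewValue a x

  ~-trans : ∀ {a b c} → a ~ b → b ~ c → a ~ c
  ~-trans {a} {b} {c} p q = record
    { α = q.α * p.α + q.β * p.γ
    ; β = q.α * p.β + q.β * p.δ
    ; γ = q.γ * p.α + q.δ * p.γ
    ; δ = q.γ * p.β + q.δ * p.δ
    ; det≢0 = λ eq → *-nonzero p.det≢0 q.det≢0 (trans
        (solve 8 (λ α β γ δ α′ β′ γ′ δ′ → (α :* δ :- β :* γ) :* (α′ :* δ′ :- β′ :* γ′)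
          := (α′ :* α :+ β′ :* γ) :* (γ′ :* β :+ δ′ :* δ) :- (α′ :* β :+ β′ :* δ) :* (γ′ :* α :+ δ′ :* γ)) refl
          p.α p.β p.γ p.δ q.α q.β q.γ q.δ) eq)
    ; maps = λ x → let y = p.α * x + p.β * skewValue a x in begin
        skewValue c ((q.α * p.α + q.β * p.γ) * x + (q.α * p.β + q.β * p.δ) * skewValue a x)
          ≡⟨ cong (skewValue c) (regroup q.α q.β p.α p.β p.γ p.δ x (skewValue a x)) ⟩
        skewValue c (q.α * y + q.β * (p.γ * x + p.δ * skewValue a x))
          ≡⟨ cong (λ z → skewValue c (q.α * y + q.β * z)) (p.maps x) ⟨
        skewValue c (q.α * y + q.β * skewValue b y)
          ≡⟨ q.maps y ⟩
        q.γ * y + q.δ * skewValue b y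
          ≡⟨ cong (λ z → q.γ * y + q.δ * z) (p.maps x) ⟩
        q.γ * y + q.δ * (p.γ * x + p.δ * skewValue a x)
          ≡⟨ regroup q.γ q.δ p.α p.β p.γ p.δ x (skewValue a x) ⟨
        (q.γ * p.α + q.δ * p.γ) * x + (q.γ * p.β + q.δ * p.δ) * skewValue a x ∎
    }
    where
    module p = _~_ p
    module q = _~_ q
    regroup : ∀ s t α β γ δ x f → (s * α + t * γ) * x + (s * β + t * δ) * f ≡ s * (α * x + β * f) + t * (γ * x + δ * f)
    regroup = solve 8 (λ s t α β γ δ x f → (s :* α :+ t :* γ) :* x :+ (s :* β :+ t :* δ) :* f := s :* (α :* x :+ β :* f) :+ t :* (γ :* x :+ δ :* f)) refl

  ~-shift : ∀ {a b} μ → b 0F ≡ a 0F + μ → b 1F ≡ a 1F → b 2F ≡ a 2F → b 3F ≡ a 3F → a ~ b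
  ~-shift {a} {b} μ e₀ e₁ e₂ e₃ = record
    { α = 1# ; β = 0# ; γ = μ ; δ = 1#
    ; det≢0 = λ eq → 1≢0 (trans (solve 1 (λ μ → I := I :* I :- O :* μ) refl μ) eq)
    ; maps = λ x → begin
        skewValue b (1# * x + 0# * skewValue a x)
          ≡⟨ cong (skewValue b) (solve 2 (λ x f → I :* x :+ O :* f := x) refl x (skewValue a x)) ⟩
        skewValue b x
          ≡⟨ cong₂ _+_ (cong (_* x) e₀) (cong₂ _+_ (cong (_* _) e₁) (cong₂ _+_ (cong (_* _) e₂) (cong (λ z → z * φ³ x + 0#) e₃))) ⟩
        (a 0F + μ) * x + (a 1F * φ x + (a 2F * φ² x + (a 3F * φ³ x + 0#)))
          ≡⟨ solve 4 (λ x a m r → (a :+ m) :* x :+ r := m :* x :+ I :* (a :* x :+ r)) refl x (a 0F) μ (a 1F * φ x + (a 2F * φ² x + (a 3F * φ³ x + 0#))) ⟩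
        μ * x + 1# * skewValue a x ∎
    }

  ~-diagonal : ∀ {a b} κ δ → κ ≢ 0# → δ ≢ 0# → (∀ i → b i * ψ i κ ≡ δ * a i) → a ~ b
  ~-diagonal {a} {b} κ δ κ≢0 δ≢0 eq = record
    { α = κ ; β = 0# ; γ = 0# ; δ = δ
    ; det≢0 = λ e → *-nonzero κ≢0 δ≢0 (trans (solve 2 (λ κ δ → κ :* δ := κ :* δ :- O :* O) refl κ δ) e)
    ; maps = λ x → begin
        skewValue b (κ * x + 0# * skewValue a x)
          ≡⟨ cong (skewValue b) (solve 3 (λ k x f → k :* x :+ O :* f := k :* x) refl κ x (skewValue a x)) ⟩
        skewValue b (κ * x)
          ≡⟨ solve 6 (λ a b c d k x → a :* (k :* x) :+ (b :* Φ (k :* x) :+ (c :* Φ² (k :* x) :+ (d :* Φ³ (k :* x) :+ O)))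
               := a :* k :* x :+ (b :* Φ k :* Φ x :+ (c :* Φ² k :* Φ² x :+ d :* Φ³ k :* Φ³ x))) refl (b 0F) (b 1F) (b 2F) (b 3F) κ x ⟩
        b 0F * ψ 0F κ * x + (b 1F * ψ 1F κ * φ x + (b 2F * ψ 2F κ * φ² x + b 3F * ψ 3F κ * φ³ x))
          ≡⟨ cong₂ _+_ (cong (_* x) (eq 0F)) (cong₂ _+_ (cong (_* _) (eq 1F)) (cong₂ _+_ (cong (_* _) (eq 2F)) (cong (_* _) (eq 3F)))) ⟩
        δ * a 0F * x + (δ * a 1F * φ x + (δ * a 2F * φ² x + δ * a 3F * φ³ x))
          ≡⟨ solve 6 (λ a b c d k x → k :* a :* x :+ (k :* b :* Φ x :+ (k :* c :* Φ² x :+ k :* d :* Φ³ x))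
               := O :* x :+ k :* skewᴱ a b c d x) refl (a 0F) (a 1F) (a 2F) (a 3F) δ x ⟩
        0# * x + δ * skewValue a x ∎
    }

  -- The adjoint of a with respect to the trace form (x, y) ↦ Tr(xy).
  adjoint : Skew → Skew
  adjoint a = vec₄ (a 0F) (φ (a 3F)) (φ² (a 2F)) (φ³ (a 1F))

  -- A nondegenerate symmetric K-bilinear form β yy′ + α (xy′ + x′y) + Γ xx′ on K²
  -- whose trace vanishes on the graph of a.
  record SelfDual (a : Skew) : Set where
    field
      α β Γ  : Carrier
      eq₀    : Γ + (α * a 0F + α * a 0F) + β * (a 0F * a 0F) + φ (β * (a 3F * a 3F)) + φ² (β * (a 2F * a 2F)) + φ³ (β * (a 1F * a 1F)) ≡ 0#
      eq₁    : β * (a 0F * a 1F) + φ (β * (a 3F * a 0F)) + φ² (β * (a 2F * a 3F)) + φ³ (β * (a 1F * a 2F)) + φ (α * a 3F) + α * a 1F ≡ 0#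
      eq₂    : β * (a 0F * a 2F) + φ (β * (a 3F * a 1F)) + φ² (β * (a 2F * a 0F)) + φ³ (β * (a 1F * a 3F)) + φ² (α * a 2F) + α * a 2F ≡ 0#
      nondegenerate : β * Γ ≢ α * α

  -- With f̂ the adjoint, the coefficients of f̂(αx + βf(x)) + Γx + αf(x) are the left sides of
  -- `eq₀`, `eq₁`, `eq₂` and φ³ of that of `eq₁`. The fourth needs no equation of its own because
  -- the symmetry of the form makes this map self-adjoint.
  SelfDual⇒~adjoint : ∀ {a} → SelfDual a → a ~ adjoint a
  SelfDual⇒~adjoint {a} sd = record
    { α = α ; β = β ; γ = - Γ ; δ = - α
    ; det≢0 = λ eq → nondegenerate (x-y≡0⇒x≡y (trans (solve 3 (λ α β Γ → β :* Γ :- α :* α := α :* (:- α) :- β :* (:- Γ)) refl α β Γ) eq))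
    ; maps = λ x → use x eq₀ (use (φ x) eq₁ (use (φ² x) eq₂ (use (φ³ x) (trans (cong φ³ eq₁) (trans (cong φ² φ-0) (trans (cong φ φ-0) φ-0)))
        (solve 8 (λ α β Γ a b c d x →
          (let f = skewᴱ a b c d x
               y = α :* x :+ β :* f
               e₁ = β :* (a :* b) :+ Φ (β :* (d :* a)) :+ Φ² (β :* (c :* d)) :+ Φ³ (β :* (b :* c)) :+ Φ (α :* d) :+ α :* b
           in
          a :* y :+ (Φ d :* Φ y :+ (Φ² c :* Φ² y :+ (Φ³ b :* Φ³ y :+ O)))
          := :- Γ :* x :+ :- α :* f
             :+ x :* (Γ :+ (α :* a :+ α :* a) :+ β :* (a :* a) :+ Φ (β :* (d :* d)) :+ Φ² (β :* (c :* c)) :+ Φ³ (β :* (b :* b)) :- O)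
             :+ Φ x :* (e₁ :- O)
             :+ Φ² x :* (β :* (a :* c) :+ Φ (β :* (d :* b)) :+ Φ² (β :* (c :* a)) :+ Φ³ (β :* (b :* d)) :+ Φ² (α :* c) :+ α :* c :- O)
             :+ Φ³ x :* (Φ³ e₁ :- O))) refl
          α β Γ (a 0F) (a 1F) (a 2F) (a 3F) x))))
    }
    where open SelfDual sd

  -- Hilbert 90 and diagonal equivalences.

  -- The resolvent z + φ²(t)φ²(z), which is nonzero for some z by independence of the powers of φ.
  hilbert90² : ∀ t → t * φ² t ≡ 1# → ∃[ s ] (s ≢ 0# × φ² s ≡ t * s)
  hilbert90² t tt≡1 = let (z , nz) = skew-nonvanishing (vec₄ 1# 0# (φ² t) 0#) 0F 1≢0 in
    _ , nz , use (- φ² z) tt≡1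
      (solve 2 (λ t z → let s = I :* z :+ (O :* Φ z :+ (Φ² t :* Φ² z :+ (O :* Φ³ z :+ O))) in
        Φ² s := t :* s :+ :- Φ² z :* (t :* Φ² t :- I)) refl t z)

  unit⇒nonzero : ∀ {x y} → x * y ≡ 1# → x ≢ 0#
  unit⇒nonzero {x} {y} xy≡1 refl = 0≢1 (trans (sym (zeroˡ y)) xy≡1)

  -- The resolvent of E over F at z + φ²(z). Taking z in K instead of an element of E lets the
  -- independence of all four powers of φ provide a nonzero value.
  hilbert90ᴱ : ∀ s → s * φ s ≡ 1# → ∃[ η ] (η ≢ 0# × φ² η ≡ η × φ η ≡ s * η)
  hilbert90ᴱ s ss≡1 = let (z , nz) = skew-nonvanishing (vec₄ 1# (φ s) 1# (φ s)) 0F 1≢0 in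
    _ , nz ,
    use (φ³ z + φ z) φφφs≡φs
      (solve 2 (λ s z → let η = I :* z :+ (Φ s :* Φ z :+ (I :* Φ² z :+ (Φ s :* Φ³ z :+ O))) in
        Φ² η := η :+ (Φ³ z :+ Φ z) :* (Φ³ s :- Φ s)) refl s z) ,
    use (φ² z + z) φφs≡s (use (- (φ z + φ³ z)) ss≡1
      (solve 2 (λ s z → let η = I :* z :+ (Φ s :* Φ z :+ (I :* Φ² z :+ (Φ s :* Φ³ z :+ O))) in
        Φ η := s :* η :+ (Φ² z :+ z) :* (Φ² s :- s) :+ :- (Φ z :+ Φ³ z) :* (s :* Φ s :- I)) refl s z))
    where
    φφs≡s : φ² s ≡ s
    φφs≡s = *-cancelˡ (φ-nonzero (unit⇒nonzero ss≡1)) (begin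
      φ s * φ² s  ≡⟨ φ-* _ _ ⟨
      φ (s * φ s)    ≡⟨ cong φ ss≡1 ⟩
      φ 1#           ≡⟨ φ-1 ⟩
      1#             ≡⟨ ss≡1 ⟨
      s * φ s        ≡⟨ *-comm _ _ ⟩
      φ s * s        ∎)
    φφφs≡φs : φ³ s ≡ φ s
    φφφs≡φs = cong φ φφs≡s

  divide : ∀ x {y} → y ≢ 0# → ∃[ z ] z * y ≡ x
  divide x {y} y≢0 = x * inv y , (begin
    x * inv y * y    ≡⟨ solve 3 (λ x i y → x :* i :* y := x :* (y :* i)) refl x (inv y) y ⟩
    x * (y * inv y)  ≡⟨ cong (x *_) (x*inv≡1 y≢0) ⟩
    x * 1#           ≡⟨ *-identityʳ x ⟩
    x                ∎)

  antifixed : ∃[ θ ] (θ ≢ 0# × φ² θ ≡ - θ)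
  antifixed = let (z , nz) = skew-nonvanishing (vec₄ 1# 0# (- 1#) 0#) 0F 1≢0 in
    _ , nz , solve 1 (λ z → let θ = skewᴱ I O (:- I) O z in Φ² θ := :- θ) refl z

  -- Hilbert 90 for K/E adjusts the coefficient of φ², then Hilbert 90 for E/F the other two.
  module _ (p r t p′ r′ : Carrier) (e₁ : p * φ r ≡ p′ * φ r′) (e₂ : t * φ² t ≡ 1#)
           (eA : p * φ p ≡ p′ * φ p′ * φ² t) (eB : φ r * φ² r ≡ t * φ r′ * φ² r′) where

    private
      t≢0 : t ≢ 0#
      t≢0 = unit⇒nonzero e₂

      H₀ : ∃[ κ ] (κ ≢ 0# × φ² κ ≡ φ² t * κ)
      H₀ = hilbert90² (φ² t) (trans (solve 1 (λ t → Φ² t :* Φ (Φ³ t) := t :* Φ² t) refl t) e₂)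

      κ₀ : Carrier
      κ₀ = proj₁ H₀
      κ₀≢0 : κ₀ ≢ 0#
      κ₀≢0 = proj₁ (proj₂ H₀)
      φφκ₀ : φ² κ₀ ≡ φ² t * κ₀
      φφκ₀ = proj₂ (proj₂ H₀)
      tφφκ₀ : t * φ² κ₀ ≡ κ₀
      tφφκ₀ = use κ₀ e₂ (use t φφκ₀ (solve 2 (λ t k → t :* Φ² k := k :+ k :* (t :* Φ² t :- I) :+ t :* (Φ² k :- Φ² t :* k)) refl t κ₀))

      scale : ∀ κ → κ ≢ 0# → p′ * φ κ ≡ κ * p → t * φ² κ ≡ κ → r′ * φ³ κ ≡ κ * r →
              vec₄ 0# p 1# r ~ vec₄ 0# p′ t r′
      scale κ κ≢0 eq₁ eq₂ eq₃ = ~-diagonal κ κ κ≢0 κ≢0 λ where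
        0F → trans (zeroˡ _) (sym (zeroʳ _))
        1F → eq₁
        2F → trans eq₂ (sym (*-identityʳ _))
        3F → eq₃

    ~-matching : vec₄ 0# p 1# r ~ vec₄ 0# p′ t r′
    ~-matching with p ≟ 0#
    -- A factor η in E leaves the equation for φ² intact. The one for φ becomes φ(η) = sη with s =
    -- κ₀p / (p′φ(κ₀)), of norm 1 by `eA`; the one for φ³ then follows from `e₁`.
    ... | no p≢0 = scale (κ₀ * η) (*-nonzero κ₀≢0 η≢0) first second third
      where
      p′≢0 : p′ ≢ 0#
      p′≢0 refl = *-nonzero p≢0 (φ-nonzero p≢0) (trans eA (trans (cong (_* φ² t) (zeroˡ _)) (zeroˡ _)))
      D = p′ * φ κ₀
      D≢0 : D ≢ 0#
      D≢0 = *-nonzero p′≢0 (φ-nonzero κ₀≢0)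
      s = proj₁ (divide (κ₀ * p) D≢0)
      sD : s * D ≡ κ₀ * p
      sD = proj₂ (divide (κ₀ * p) D≢0)
      ss≡1 : s * φ s ≡ 1#
      ss≡1 = *-cancelˡ (*-nonzero D≢0 (φ-nonzero D≢0)) (begin
        D * φ D * (s * φ s)          ≡⟨ solve 2 (λ s d → d :* Φ d :* (s :* Φ s) := s :* d :* Φ (s :* d)) refl s D ⟩
        s * D * φ (s * D)            ≡⟨ cong₂ (λ x y → x * φ y) sD sD ⟩
        κ₀ * p * φ (κ₀ * p)          ≡⟨ use (κ₀ * φ κ₀) eA (use (- (p′ * φ p′ * φ κ₀)) φφκ₀
          (solve 4 (λ k p p′ t → k :* p :* Φ (k :* p) := p′ :* Φ k :* Φ (p′ :* Φ k) :* I
            :+ k :* Φ k :* (p :* Φ p :- p′ :* Φ p′ :* Φ² t) :+ :- (p′ :* Φ p′ :* Φ k) :* (Φ² k :- Φ² t :* k)) refl κ₀ p p′ t)) ⟩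
        D * φ D * 1#                 ∎)
      H = hilbert90ᴱ s ss≡1
      η = proj₁ H
      η≢0 : η ≢ 0#
      η≢0 = proj₁ (proj₂ H)
      φφη : φ² η ≡ η
      φφη = proj₁ (proj₂ (proj₂ H))
      φη : φ η ≡ s * η
      φη = proj₂ (proj₂ (proj₂ H))
      first : p′ * φ (κ₀ * η) ≡ κ₀ * η * p
      first = use (p′ * φ κ₀) φη (use η sD
        (solve 5 (λ k h p p′ s → p′ :* Φ (k :* h) := k :* h :* p :+ p′ :* Φ k :* (Φ h :- s :* h) :+ h :* (s :* (p′ :* Φ k) :- k :* p)) refl κ₀ η p p′ s))
      second : t * φ² (κ₀ * η) ≡ κ₀ * η
      second = use η tφφκ₀ (use (t * φ² κ₀) φφη
        (solve 3 (λ k h t → t :* Φ² (k :* h) := k :* h :+ h :* (t :* Φ² k :- k) :+ t :* Φ² k :* (Φ² h :- h)) refl κ₀ η t))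
      third : r′ * φ³ (κ₀ * η) ≡ κ₀ * η * r
      third = φ-injective (*-cancelˡ p′≢0 (use (- (κ₀ * η)) e₁ (use (- φ r) first
        (solve 5 (λ k p r p′ r′ → p′ :* Φ (r′ :* Φ³ k) := p′ :* Φ (k :* r) :+ :- k :* (p :* Φ r :- p′ :* Φ r′) :+ :- Φ r :* (p′ :* Φ k :- k :* p)) refl (κ₀ * η) p r p′ r′))))
    -- Now p′ = 0 as well and `e₁` says nothing, so the coefficients of φ³ are matched through `eB`.
    ... | yes refl = branch (r ≟ 0#)
      where
      p′≡0 : p′ ≡ 0#
      p′≡0 with p′ ≟ 0#
      ... | yes eq = eq
      ... | no p′≢0 = contradiction (trans (sym eA) (zeroˡ _)) (*-nonzero (*-nonzero p′≢0 (φ-nonzero p′≢0)) (φ-nonzero (φ-nonzero t≢0)))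
      first : ∀ κ → p′ * φ κ ≡ κ * 0#
      first κ = trans (cong (_* φ κ) p′≡0) (trans (zeroˡ _) (sym (zeroʳ _)))
      branch : Dec (r ≡ 0#) → vec₄ 0# 0# 1# r ~ vec₄ 0# p′ t r′
      branch (yes refl) = scale κ₀ κ₀≢0 (first κ₀) tφφκ₀ (trans (cong (_* φ³ κ₀) r′≡0) (trans (zeroˡ _) (sym (zeroʳ _))))
        where
        r′≡0 : r′ ≡ 0#
        r′≡0 with r′ ≟ 0#
        ... | yes eq = eq
        ... | no r′≢0 = contradiction (trans (sym eB) (trans (cong (_* φ² 0#) φ-0) (zeroˡ _)))
          (*-nonzero (*-nonzero t≢0 (φ-nonzero r′≢0)) (φ-nonzero (φ-nonzero r′≢0)))
      branch (no r≢0) = scale (κ₀ * η) (*-nonzero κ₀≢0 η≢0) (first (κ₀ * η)) second third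
        where
        r′≢0 : r′ ≢ 0#
        r′≢0 refl = *-nonzero (φ-nonzero r≢0) (φ-nonzero (φ-nonzero r≢0)) (trans eB (trans (cong (λ z → t * z * φ² 0#) φ-0) (trans (cong (_* φ² 0#) (zeroʳ t)) (zeroˡ _))))
        D = r′ * φ³ κ₀
        D≢0 : D ≢ 0#
        D≢0 = *-nonzero r′≢0 (φ-nonzero (φ-nonzero (φ-nonzero κ₀≢0)))
        s = proj₁ (divide (κ₀ * r) D≢0)
        sD : s * D ≡ κ₀ * r
        sD = proj₂ (divide (κ₀ * r) D≢0)
        ss≡1 : s * φ s ≡ 1#
        ss≡1 = *-cancelˡ (*-nonzero D≢0 (φ-nonzero D≢0)) (begin
          D * φ D * (s * φ s)          ≡⟨ solve 2 (λ s d → d :* Φ d :* (s :* Φ s) := s :* d :* Φ (s :* d)) refl s D ⟩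
          s * D * φ (s * D)            ≡⟨ cong₂ (λ x y → x * φ y) sD sD ⟩
          κ₀ * r * φ (κ₀ * r)          ≡⟨ use (κ₀ * φ κ₀) (cong φ³ eB) (use (- (r′ * φ r′ * κ₀)) (cong φ φφκ₀)
            (solve 4 (λ k r r′ t → k :* r :* Φ (k :* r) := r′ :* Φ³ k :* Φ (r′ :* Φ³ k) :* I
              :+ k :* Φ k :* (Φ³ (Φ r :* Φ² r) :- Φ³ (t :* Φ r′ :* Φ² r′))
              :+ :- (r′ :* Φ r′ :* k) :* (Φ³ k :- Φ (Φ² t :* k))) refl κ₀ r r′ t)) ⟩
          D * φ D * 1#                 ∎)
        H = hilbert90ᴱ s ss≡1
        η = proj₁ H
        η≢0 : η ≢ 0#
        η≢0 = proj₁ (proj₂ H)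
        φφη : φ² η ≡ η
        φφη = proj₁ (proj₂ (proj₂ H))
        φη : φ η ≡ s * η
        φη = proj₂ (proj₂ (proj₂ H))
        second : t * φ² (κ₀ * η) ≡ κ₀ * η
        second = use η tφφκ₀ (use (t * φ² κ₀) φφη
          (solve 3 (λ k h t → t :* Φ² (k :* h) := k :* h :+ h :* (t :* Φ² k :- k) :+ t :* Φ² k :* (Φ² h :- h)) refl κ₀ η t))
        third : r′ * φ³ (κ₀ * η) ≡ κ₀ * η * r
        third = use (r′ * φ³ κ₀) (trans (cong φ φφη) φη) (use η sD
          (solve 5 (λ k h r r′ s → r′ :* Φ³ (k :* h) := k :* h :* r :+ r′ :* Φ³ k :* (Φ³ h :- s :* h) :+ h :* (s :* (r′ :* Φ³ k) :- k :* r)) refl κ₀ η r r′ s))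

  -- The coordinate swap works up to scalars unless rφ²(r) = pφ²(p), when a diagonal map does.
  binomial-~adjoint : ∀ p r → p ≢ 0# → r ≢ 0# → vec₄ 0# p 0# r ~ adjoint (vec₄ 0# p 0# r)
  binomial-~adjoint p r p≢0 r≢0 with r * φ² r ≟ p * φ² p
  ... | yes eq = ~-diagonal (φ³ κ) δ (φ-nonzero (φ-nonzero (φ-nonzero κ≢0))) δ≢0 λ where
      0F → trans (zeroˡ _) (sym (zeroʳ _))
      1F → use 1# (sym δp) (solve 4 (λ k d r p → Φ r :* Φ (Φ³ k) := d :* p :+ I :* (Φ r :* k :- d :* p)) refl κ δ r p)
      2F → solve 2 (λ k d → Φ² O :* Φ² (Φ³ k) := d :* O) refl κ δ
      3F → *-cancelˡ p≢0 (use (p * φ³ p) φφκ (use κ tD (use (- r) δp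
             (solve 5 (λ p r k t d → p :* (Φ³ p :* Φ³ (Φ³ k)) := p :* (d :* r)
               :+ p :* Φ³ p :* (Φ² k :- t :* k) :+ k :* (t :* (p :* Φ³ p) :- r :* Φ r) :+ :- r :* (d :* p :- Φ r :* k)) refl p r κ t δ))))
    where
    D = p * φ³ p
    D≢0 : D ≢ 0#
    D≢0 = *-nonzero p≢0 (φ-nonzero (φ-nonzero (φ-nonzero p≢0)))
    -- Eliminating δ from φ(r)κ = δp and φ³(p)φ²(κ) = δr leaves φ²(κ) = tκ.
    t = proj₁ (divide (r * φ r) D≢0)
    tD : t * D ≡ r * φ r
    tD = proj₂ (divide (r * φ r) D≢0)
    tt≡1 : t * φ² t ≡ 1#
    tt≡1 = *-cancelˡ (*-nonzero D≢0 (φ-nonzero (φ-nonzero D≢0))) (begin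
      D * φ² D * (t * φ² t)    ≡⟨ solve 2 (λ t d → d :* Φ² d :* (t :* Φ² t) := t :* d :* Φ² (t :* d)) refl t D ⟩
      t * D * φ² (t * D)          ≡⟨ cong₂ (λ x y → x * φ² y) tD tD ⟩
      r * φ r * φ² (r * φ r)      ≡⟨ use (φ (r * φ² r)) eq (use (p * φ² p) (cong φ eq)
        (solve 2 (λ p r → r :* Φ r :* Φ² (r :* Φ r) := p :* Φ³ p :* Φ² (p :* Φ³ p) :* I
          :+ Φ (r :* Φ² r) :* (r :* Φ² r :- p :* Φ² p) :+ p :* Φ² p :* (Φ (r :* Φ² r) :- Φ (p :* Φ² p))) refl p r)) ⟩
      D * φ² D * 1#               ∎)
    H = hilbert90² t tt≡1
    κ = proj₁ H
    κ≢0 : κ ≢ 0#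
    κ≢0 = proj₁ (proj₂ H)
    φφκ : φ² κ ≡ t * κ
    φφκ = proj₂ (proj₂ H)
    δ = proj₁ (divide (φ r * κ) p≢0)
    δp : δ * p ≡ φ r * κ
    δp = proj₂ (divide (φ r * κ) p≢0)
    δ≢0 : δ ≢ 0#
    δ≢0 δ≡0 = *-nonzero (φ-nonzero r≢0) κ≢0 (trans (sym δp) (trans (cong (_* p) δ≡0) (zeroˡ p)))
  ... | no differ = SelfDual⇒~adjoint record
    { α = 0# ; β = β ; Γ = Γ
    ; eq₀ = solve 3 (λ b p r → :- (Φ (b :* (r :* r)) :+ Φ³ (b :* (p :* p))) :+ (O :* O :+ O :* O) :+ b :* (O :* O) :+ Φ (b :* (r :* r)) :+ Φ² (b :* (O :* O)) :+ Φ³ (b :* (p :* p)) := O) refl β p r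
    ; eq₁ = solve 3 (λ b p r → b :* (O :* p) :+ Φ (b :* (r :* O)) :+ Φ² (b :* (O :* r)) :+ Φ³ (b :* (p :* O)) :+ Φ (O :* r) :+ O :* p := O) refl β p r
    ; eq₂ = use 1# (cong φ βpr) (use 1# (cong φ³ βpr) (use 1# (cong φ φφθ)
        (solve 4 (λ b p r t → b :* (O :* O) :+ Φ (b :* (r :* p)) :+ Φ² (b :* (O :* O)) :+ Φ³ (b :* (p :* r)) :+ Φ² (O :* O) :+ O :* O
          := O :+ I :* (Φ (b :* (p :* r)) :- Φ t) :+ I :* (Φ³ (b :* (p :* r)) :- Φ³ t) :+ I :* (Φ³ t :- Φ (:- t))) refl β p r θ)))
    ; nondegenerate = λ eq → *-nonzero β≢0 Γ≢0 (trans eq (zeroˡ 0#))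
    }
    where
    θ = proj₁ antifixed
    θ≢0 : θ ≢ 0#
    θ≢0 = proj₁ (proj₂ antifixed)
    φφθ : φ² θ ≡ - θ
    φφθ = proj₂ (proj₂ antifixed)
    -- With α = 0 and Γ given by `eq₀`, the remaining condition is φ(βpr) + φ³(βpr) = 0, which βpr =
    -- θ satisfies.
    β = proj₁ (divide θ (*-nonzero p≢0 r≢0))
    βpr : β * (p * r) ≡ θ
    βpr = proj₂ (divide θ (*-nonzero p≢0 r≢0))
    β≢0 : β ≢ 0#
    β≢0 β≡0 = θ≢0 (trans (sym βpr) (trans (cong (_* (p * r)) β≡0) (zeroˡ _)))
    Γ = - (φ (β * (r * r)) + φ³ (β * (p * p)))
    Γ≢0 : Γ ≢ 0#
    Γ≢0 Γ≡0 = differ (φ-injective (*-cancelˡ (φ-nonzero θ≢0) (use (φ p * φ³ r) (sym Γ≡0) (use (- (φ r * φ³ r)) (cong φ βpr) (use (- (φ p * φ³ p)) (cong φ³ βpr) (use (- (φ p * φ³ p)) (cong φ φφθ)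
      (solve 4 (λ b p r t → Φ t :* Φ (r :* Φ² r) := Φ t :* Φ (p :* Φ² p)
        :+ Φ p :* Φ³ r :* (O :- :- (Φ (b :* (r :* r)) :+ Φ³ (b :* (p :* p))))
        :+ :- (Φ r :* Φ³ r) :* (Φ (b :* (p :* r)) :- Φ t)
        :+ :- (Φ p :* Φ³ p) :* (Φ³ (b :* (p :* r)) :- Φ³ t)
        :+ :- (Φ p :* Φ³ p) :* (Φ³ t :- Φ (:- t))) refl β p r θ)))))))

  -- Symmetric forms whose trace vanishes on the graph.

  open Inverse size using (to; from; strictlyInverseˡ; strictlyInverseʳ)

  Tr : Carrier → Carrier
  Tr x = x + φ x + φ² x + φ³ x

  trace-nonzero : ∃[ y ] Tr y ≢ 0#
  trace-nonzero = let (y , nz) = skew-nonvanishing (vec₄ 1# 1# 1# 1#) 0F 1≢0 in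
    y , λ eq → nz (trans (solve 1 (λ y → skewᴱ I I I I y := y :+ Φ y :+ Φ² y :+ Φ³ y) refl y) eq)

  quadratic : ∃[ ω ] (φ² ω ≡ ω × φ ω ≢ ω)
  quadratic = let (z , nz) = skew-nonvanishing (vec₄ 1# (- 1#) 1# (- 1#)) 0F 1≢0 in
    z + φ² z , solve 1 (λ z → Φ² (z :+ Φ² z) := z :+ Φ² z) refl z ,
    λ eq → nz (use (- 1#) eq (solve 1 (λ z → skewᴱ I (:- I) I (:- I) z
      := O :+ :- I :* (Φ (z :+ Φ² z) :- (z :+ Φ² z))) refl z))

  -- By counting, an additive map G on K × {ε : φ²(ε) = -ε} to K has a nontrivial
  -- zero with Tr(cβ) = 0, since {ε : φ²(ε) = -ε} has more elements than the base field.
  module _ (G : Carrier → Carrier → Carrier) (G-- : ∀ β ε β′ ε′ → G (β - β′) (ε - ε′) ≡ G β ε - G β′ ε′) where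

    nontrivial-zero : ∀ c → ∃₂ λ β ε → φ² ε ≡ - ε × ¬ (β ≡ 0# × ε ≡ 0#) × G β ε ≡ 0# × Tr (c * β) ≡ 0#
    nontrivial-zero c = difference (F.pigeonhole (N*s<N*[1+s] (to 0#)) code)
      where
      N*s<N*[1+s] : ∀ {m s} → Fin m → m ℕ.* s ℕ.< m ℕ.* suc s
      N*s<N*[1+s] {suc m} {s} _ = ℕ.*-monoʳ-< (suc m) (ℕ.n<1+n s)
      θ = proj₁ antifixed
      θ≢0 : θ ≢ 0#
      θ≢0 = proj₁ (proj₂ antifixed)
      ω = proj₁ quadratic
      -- The multiples of θ by F and by one element ω of E outside F are one more than the possible
      -- values of the trace.
      m e : Fin (suc FP.count) → Carrier
      m zero    = ω
      m (suc i) = from (FP.element i)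
      e i = θ * m i
      trace : ∀ x → φ (Tr x) ≡ Tr x
      trace = solve 1 (λ x → Φ (x :+ Φ x :+ Φ² x :+ Φ³ x) := x :+ Φ x :+ Φ² x :+ Φ³ x) refl
      index : Carrier → Fin FP.count
      index β = proj₁ (FP.complete (to (Tr (c * β))) (trans (cong φ (strictlyInverseʳ _)) (trans (trace _) (sym (strictlyInverseʳ _)))))
      index-Tr : ∀ β → from (FP.element (index β)) ≡ Tr (c * β)
      index-Tr β = trans (cong from (proj₂ (FP.complete (to (Tr (c * β))) _))) (strictlyInverseʳ _)
      from-injective : ∀ {i j} → from i ≡ from j → i ≡ j
      from-injective {i} {j} eq = trans (sym (strictlyInverseˡ i)) (trans (cong to eq) (strictlyInverseˡ j))
      to-injective : ∀ {x y} → to x ≡ to y → x ≡ y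
      to-injective {x} {y} eq = trans (sym (strictlyInverseʳ x)) (trans (cong from eq) (strictlyInverseʳ y))
      e-anti : ∀ i → φ² (e i) ≡ - e i
      e-anti i = trans (solve 2 (λ x y → Φ² (x :* y) := Φ² x :* Φ² y) refl θ (m i))
        (trans (cong₂ _*_ (proj₂ (proj₂ antifixed)) (m-fixed i)) (solve 2 (λ x y → :- x :* y := :- (x :* y)) refl θ (m i)))
        where
        m-fixed : ∀ i → φ² (m i) ≡ m i
        m-fixed zero    = proj₁ (proj₂ quadratic)
        m-fixed (suc i) = trans (cong φ (FP.sound i)) (FP.sound i)
      e-injective : ∀ i j → e i ≡ e j → i ≡ j
      e-injective zero    zero    eq = refl
      e-injective (suc i) (suc j) eq = cong suc (FP.injective (from-injective (*-cancelˡ θ≢0 eq)))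
      e-injective zero    (suc j) eq = contradiction (subst Fixed (sym (*-cancelˡ θ≢0 eq)) (FP.sound j)) (proj₂ (proj₂ quadratic))
      e-injective (suc i) zero    eq = contradiction (subst Fixed (*-cancelˡ θ≢0 eq) (FP.sound i)) (proj₂ (proj₂ quadratic))
      code : Fin (N ℕ.* suc FP.count) → Fin (N ℕ.* FP.count)
      code k = let (i , j) = F.remQuot {N} (suc FP.count) k in F.combine (to (G (from i) (e j))) (index (from i))
      difference : (∃₂ λ k l → k F.< l × code k ≡ code l) →
        ∃₂ λ β ε → φ² ε ≡ - ε × ¬ (β ≡ 0# × ε ≡ 0#) × G β ε ≡ 0# × Tr (c * β) ≡ 0#
      difference (k , l , k<l , eq) = β - β′ , e i - e j ,
        (begin
          φ² (e i - e j)            ≡⟨ solve 2 (λ x y → Φ² (x :- y) := Φ² x :- Φ² y) refl (e i) (e j) ⟩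
          φ² (e i) - φ² (e j)    ≡⟨ cong₂ _-_ (e-anti i) (e-anti j) ⟩
          - e i - - e j                ≡⟨ solve 2 (λ x y → :- x :- :- y := :- (x :- y)) refl (e i) (e j) ⟩
          - (e i - e j)                ∎) ,
        (λ (β-β′≡0 , e-e′≡0) → F.<⇒≢ k<l (begin
          k                                            ≡⟨ F.combine-remQuot {N} (suc FP.count) k ⟨
          F.combine (proj₁ (F.remQuot {N} (suc FP.count) k)) i
            ≡⟨ cong₂ F.combine (from-injective (x-y≡0⇒x≡y β-β′≡0)) (e-injective i j (x-y≡0⇒x≡y e-e′≡0)) ⟩
          F.combine (proj₁ (F.remQuot {N} (suc FP.count) l)) j
            ≡⟨ F.combine-remQuot {N} (suc FP.count) l ⟩
          l                                            ∎)) ,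
        (begin
          G (β - β′) (e i - e j)    ≡⟨ G-- β (e i) β′ (e j) ⟩
          G β (e i) - G β′ (e j)    ≡⟨ cong (_- G β′ (e j)) (to-injective (proj₁ split)) ⟩
          G β′ (e j) - G β′ (e j)   ≡⟨ -‿inverseʳ _ ⟩
          0#                        ∎) ,
        (begin
          Tr (c * (β - β′))         ≡⟨ solve 3 (λ c x y → let T = λ x → x :+ Φ x :+ Φ² x :+ Φ³ x in T (c :* (x :- y)) := T (c :* x) :- T (c :* y)) refl c β β′ ⟩
          Tr (c * β) - Tr (c * β′)  ≡⟨ cong (_- Tr (c * β′)) (trans (sym (index-Tr β)) (trans (cong (from ∘ FP.element) (proj₂ split)) (index-Tr β′))) ⟩
          Tr (c * β′) - Tr (c * β′) ≡⟨ -‿inverseʳ _ ⟩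
          0#                        ∎)
        where
        β = from (proj₁ (F.remQuot {N} (suc FP.count) k))
        β′ = from (proj₁ (F.remQuot {N} (suc FP.count) l))
        i = proj₂ (F.remQuot {N} (suc FP.count) k)
        j = proj₂ (F.remQuot {N} (suc FP.count) l)
        split : to (G β (e i)) ≡ to (G β′ (e j)) × index β ≡ index β′
        split = F.combine-injective (to (G β (e i))) (index β) (to (G β′ (e j))) (index β′) eq

  module _ (a b : Carrier) where

    -- `eq₀` solved for Γ, which leaves α and β as the unknowns.
    Γ₀ : Carrier → Carrier
    Γ₀ β = - (φ (β * (b * b)) + φ² β + φ³ (β * (a * a)))

    -- The conditions eq₁ and eq₂ of SelfDual for the coefficients (0, a, 1, b).
    record Isotropic (α β : Carrier) : Set where
      field
        iso₁ : φ² (β * b) + φ³ (β * a) + φ (α * b) + α * a ≡ 0#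
        iso₂ : φ (β * (b * a)) + φ³ (β * (a * b)) + φ² α + α ≡ 0#
    open Isotropic

    isotropic⇒selfDual : ∀ {α β} → Isotropic α β → β * Γ₀ β ≢ α * α → SelfDual (vec₄ 0# a 1# b)
    isotropic⇒selfDual {α} {β} iso nd = record
      { α = α ; β = β ; Γ = Γ₀ β
      ; eq₀ = solve 4 (λ α β a b → :- (Φ (β :* (b :* b)) :+ Φ² β :+ Φ³ (β :* (a :* a))) :+ (α :* O :+ α :* O) :+ β :* (O :* O)
          :+ Φ (β :* (b :* b)) :+ Φ² (β :* (I :* I)) :+ Φ³ (β :* (a :* a)) := O) refl α β a b
      ; eq₁ = use 1# (iso₁ iso) (solve 4 (λ α β a b → β :* (O :* a) :+ Φ (β :* (b :* O)) :+ Φ² (β :* (I :* b)) :+ Φ³ (β :* (a :* I)) :+ Φ (α :* b) :+ α :* a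
          := O :+ I :* (Φ² (β :* b) :+ Φ³ (β :* a) :+ Φ (α :* b) :+ α :* a :- O)) refl α β a b)
      ; eq₂ = use 1# (iso₂ iso) (solve 4 (λ α β a b → β :* (O :* I) :+ Φ (β :* (b :* a)) :+ Φ² (β :* (I :* O)) :+ Φ³ (β :* (a :* b)) :+ Φ² (α :* I) :+ α :* I
          := O :+ I :* (Φ (β :* (b :* a)) :+ Φ³ (β :* (a :* b)) :+ Φ² α :+ α :- O)) refl α β a b)
      ; nondegenerate = nd
      }

    isotropic-+ : ∀ {α β α′ β′} → Isotropic α β → Isotropic α′ β′ → Isotropic (α + α′) (β + β′)
    isotropic-+ {α} {β} {α′} {β′} i i′ = record
      { iso₁ = use 1# (iso₁ i) (use 1# (iso₁ i′) (solve 6 (λ α β α′ β′ a b →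
          let e = λ α β → Φ² (β :* b) :+ Φ³ (β :* a) :+ Φ (α :* b) :+ α :* a in
          e (α :+ α′) (β :+ β′) := O :+ I :* (e α β :- O) :+ I :* (e α′ β′ :- O)) refl α β α′ β′ a b))
      ; iso₂ = use 1# (iso₂ i) (use 1# (iso₂ i′) (solve 6 (λ α β α′ β′ a b →
          let e = λ α β → Φ (β :* (b :* a)) :+ Φ³ (β :* (a :* b)) :+ Φ² α :+ α in
          e (α :+ α′) (β :+ β′) := O :+ I :* (e α β :- O) :+ I :* (e α′ β′ :- O)) refl α β α′ β′ a b))
      }

    -- For c chosen after a first solution, the trace condition prevents a second one from being a
    -- multiple of it by an element of F.
    record Solution (c : Carrier) : Set where
      field
        α β       : Carrier
        isotropic : Isotropic α β
        nonzero   : ¬ (α ≡ 0# × β ≡ 0#)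
        trace     : Tr (c * β) ≡ 0#

    -- eq₂ is solved by α = ε - φ(βab) with φ²(ε) = -ε.
    solution : ∀ c → Solution c
    solution c = let (β , ε , anti , nonzero , Gβε≡0 , tr) = nontrivial-zero G G-- c in record
      { α = ε - φ (β * (a * b))
      ; β = β
      ; isotropic = record
          { iso₁ = Gβε≡0
          ; iso₂ = use 1# anti (solve 4 (λ β ε a b → Φ (β :* (b :* a)) :+ Φ³ (β :* (a :* b)) :+ Φ² (ε :- Φ (β :* (a :* b))) :+ (ε :- Φ (β :* (a :* b)))
              := O :+ I :* (Φ² ε :- :- ε)) refl β ε a b)
          }
      ; nonzero = λ (α≡0 , β≡0) → nonzero (β≡0 , trans
          (use (φ (a * b)) (trans (cong φ β≡0) φ-0) (solve 4 (λ β ε a b → ε := (ε :- Φ (β :* (a :* b))) :+ Φ (a :* b) :* (Φ β :- O)) refl β ε a b)) α≡0)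
      ; trace = tr
      }
      where
      G : Carrier → Carrier → Carrier
      G β ε = φ² (β * b) + φ³ (β * a) + φ ((ε - φ (β * (a * b))) * b) + (ε - φ (β * (a * b))) * a
      G-- : ∀ β ε β′ ε′ → G (β - β′) (ε - ε′) ≡ G β ε - G β′ ε′
      G-- β ε β′ ε′ = solve 6 (λ β ε β′ ε′ a b →
        let G = λ β ε → Φ² (β :* b) :+ Φ³ (β :* a) :+ Φ ((ε :- Φ (β :* (a :* b))) :* b) :+ (ε :- Φ (β :* (a :* b))) :* a in
        G (β :- β′) (ε :- ε′) := G β ε :- G β′ ε′) refl β ε β′ ε′ a b

    -- The trace of the rank one form β (y + μx)(y′ + μx′) vanishes on the graph.
    record RankOne (μ β : Carrier) : Set where
      field
        rk₀ : β * (μ * μ) + φ (β * (b * b)) + φ² β + φ³ (β * (a * a)) ≡ 0#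
        rk₁ : β * (μ * a) + φ (β * (b * μ)) + φ² (β * b) + φ³ (β * a) ≡ 0#
        rk₂ : β * μ + φ (β * (b * a)) + φ² (β * μ) + φ³ (β * (a * b)) ≡ 0#

    -- If β were 0, degeneracy would give α² = 0. Otherwise μ = α/β completes the square without a
    -- division by 2.
    degenerate⇒rankOne : ∀ {α β} → Isotropic α β → ¬ (α ≡ 0# × β ≡ 0#) → β * Γ₀ β ≡ α * α →
                         β ≢ 0# × ∃[ μ ] (μ * β ≡ α × RankOne μ β)
    degenerate⇒rankOne {α} {β} iso nonzero deg = β≢0 , μ , μβ≡α , record
      { rk₀ = use (- 1#) Γ₀β≡ (solve 4 (λ β μ a b → β :* (μ :* μ) :+ Φ (β :* (b :* b)) :+ Φ² β :+ Φ³ (β :* (a :* a))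
          := O :+ :- I :* (:- (Φ (β :* (b :* b)) :+ Φ² β :+ Φ³ (β :* (a :* a))) :- μ :* μ :* β)) refl β μ a b)
      ; rk₁ = use 1# (iso₁ iso) (use a μβ≡α (use (φ b) (cong φ μβ≡α) (solve 5 (λ α β μ a b → β :* (μ :* a) :+ Φ (β :* (b :* μ)) :+ Φ² (β :* b) :+ Φ³ (β :* a)
          := O :+ I :* (Φ² (β :* b) :+ Φ³ (β :* a) :+ Φ (α :* b) :+ α :* a :- O) :+ a :* (μ :* β :- α) :+ Φ b :* (Φ (μ :* β) :- Φ α)) refl α β μ a b)))
      ; rk₂ = use 1# (iso₂ iso) (use 1# μβ≡α (use 1# (cong φ² μβ≡α) (solve 5 (λ α β μ a b → β :* μ :+ Φ (β :* (b :* a)) :+ Φ² (β :* μ) :+ Φ³ (β :* (a :* b))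
          := O :+ I :* (Φ (β :* (b :* a)) :+ Φ³ (β :* (a :* b)) :+ Φ² α :+ α :- O) :+ I :* (μ :* β :- α) :+ I :* (Φ² (μ :* β) :- Φ² α)) refl α β μ a b)))
      }
      where
      β≢0 : β ≢ 0#
      β≢0 refl = nonzero (xx≡0⇒x≡0 (trans (sym deg) (zeroˡ _)) , refl)
      μ = proj₁ (divide α β≢0)
      μβ≡α : μ * β ≡ α
      μβ≡α = proj₂ (divide α β≢0)
      Γ₀β≡ : Γ₀ β ≡ μ * μ * β
      Γ₀β≡ = *-cancelˡ β≢0 (trans deg (sym (trans (solve 2 (λ μ β → β :* (μ :* μ :* β) := μ :* β :* (μ :* β)) refl μ β) (cong₂ _*_ μβ≡α μβ≡α))))

    module _ {μ : Carrier} where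

      -- The columns of the Dickson matrix of (μ, a, 1, b).
      column : Fin 4 → Fin 4 → Carrier
      column 0F = vec₄ μ a 1# b
      column 1F = vec₄ (φ b) (φ μ) (φ a) 1#
      column 2F = vec₄ 1# (φ² b) (φ² μ) (φ² a)
      column 3F = vec₄ (φ³ a) 1# (φ³ b) (φ³ μ)

      private
        relationᴱ : ∀ {n} → Fin 4 → Fin 4 → (μ β a b : Expr n) → Expr n
        relationᴱ k l μ β a b =
          vec₄ᴱ μ a I b k :* vec₄ᴱ μ a I b l :* β
          :+ vec₄ᴱ (Φ b) (Φ μ) (Φ a) I k :* vec₄ᴱ (Φ b) (Φ μ) (Φ a) I l :* Φ β
          :+ vec₄ᴱ I (Φ² b) (Φ² μ) (Φ² a) k :* vec₄ᴱ I (Φ² b) (Φ² μ) (Φ² a) l :* Φ² β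
          :+ vec₄ᴱ (Φ³ a) I (Φ³ b) (Φ³ μ) k :* vec₄ᴱ (Φ³ a) I (Φ³ b) (Φ³ μ) l :* Φ³ β

        rk₀ᴱ rk₁ᴱ rk₂ᴱ : ∀ {n} → (μ β a b : Expr n) → Expr n
        rk₀ᴱ μ β a b = β :* (μ :* μ) :+ Φ (β :* (b :* b)) :+ Φ² β :+ Φ³ (β :* (a :* a))
        rk₁ᴱ μ β a b = β :* (μ :* a) :+ Φ (β :* (b :* μ)) :+ Φ² (β :* b) :+ Φ³ (β :* a)
        rk₂ᴱ μ β a b = β :* μ :+ Φ (β :* (b :* a)) :+ Φ² (β :* μ) :+ Φ³ (β :* (a :* b))

      -- With D the matrix of the columns, this is D diag(β, φ(β), φ²(β), φ³(β)) times the transpose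
      -- of D. Its entries are permuted by φ, so `rk₀`, `rk₁`, `rk₂` and their conjugates cover all
      -- of them.
      relation : ∀ {β} → RankOne μ β → ∀ k l →
        column 0F k * column 0F l * β + column 1F k * column 1F l * φ β + column 2F k * column 2F l * φ² β + column 3F k * column 3F l * φ³ β ≡ 0#
      relation {β} rk = λ where
          0F 0F → trans (solve 4 (λ μ β a b → relationᴱ 0F 0F μ β a b := rk₀ᴱ μ β a b) refl μ β a b) rk₀
          0F 1F → trans (solve 4 (λ μ β a b → relationᴱ 0F 1F μ β a b := rk₁ᴱ μ β a b) refl μ β a b) rk₁
          1F 0F → trans (solve 4 (λ μ β a b → relationᴱ 1F 0F μ β a b := rk₁ᴱ μ β a b) refl μ β a b) rk₁
          0F 2F → trans (solve 4 (λ μ β a b → relationᴱ 0F 2F μ β a b := rk₂ᴱ μ β a b) refl μ β a b) rk₂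
          2F 0F → trans (solve 4 (λ μ β a b → relationᴱ 2F 0F μ β a b := rk₂ᴱ μ β a b) refl μ β a b) rk₂
          0F 3F → trans (solve 4 (λ μ β a b → relationᴱ 0F 3F μ β a b := Φ³ (rk₁ᴱ μ β a b)) refl μ β a b) (vanish³ rk₁)
          3F 0F → trans (solve 4 (λ μ β a b → relationᴱ 3F 0F μ β a b := Φ³ (rk₁ᴱ μ β a b)) refl μ β a b) (vanish³ rk₁)
          1F 1F → trans (solve 4 (λ μ β a b → relationᴱ 1F 1F μ β a b := Φ (rk₀ᴱ μ β a b)) refl μ β a b) (vanish¹ rk₀)
          1F 2F → trans (solve 4 (λ μ β a b → relationᴱ 1F 2F μ β a b := Φ (rk₁ᴱ μ β a b)) refl μ β a b) (vanish¹ rk₁)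
          2F 1F → trans (solve 4 (λ μ β a b → relationᴱ 2F 1F μ β a b := Φ (rk₁ᴱ μ β a b)) refl μ β a b) (vanish¹ rk₁)
          1F 3F → trans (solve 4 (λ μ β a b → relationᴱ 1F 3F μ β a b := Φ (rk₂ᴱ μ β a b)) refl μ β a b) (vanish¹ rk₂)
          3F 1F → trans (solve 4 (λ μ β a b → relationᴱ 3F 1F μ β a b := Φ (rk₂ᴱ μ β a b)) refl μ β a b) (vanish¹ rk₂)
          2F 2F → trans (solve 4 (λ μ β a b → relationᴱ 2F 2F μ β a b := Φ² (rk₀ᴱ μ β a b)) refl μ β a b) (vanish² rk₀)
          2F 3F → trans (solve 4 (λ μ β a b → relationᴱ 2F 3F μ β a b := Φ² (rk₁ᴱ μ β a b)) refl μ β a b) (vanish² rk₁)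
          3F 2F → trans (solve 4 (λ μ β a b → relationᴱ 3F 2F μ β a b := Φ² (rk₁ᴱ μ β a b)) refl μ β a b) (vanish² rk₁)
          3F 3F → trans (solve 4 (λ μ β a b → relationᴱ 3F 3F μ β a b := Φ³ (rk₀ᴱ μ β a b)) refl μ β a b) (vanish³ rk₀)
        where
        open RankOne rk
        vanish¹ : ∀ {x} → x ≡ 0# → φ x ≡ 0#
        vanish¹ eq = trans (cong φ eq) φ-0
        vanish² : ∀ {x} → x ≡ 0# → φ² x ≡ 0#
        vanish² eq = vanish¹ (vanish¹ eq)
        vanish³ : ∀ {x} → x ≡ 0# → φ³ x ≡ 0#
        vanish³ eq = vanish¹ (vanish² eq)

      minor : Fin 4 → Fin 4 → Fin 4 → Fin 4 → Carrier
      minor m n i j = column m i * column n j - column m j * column n i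

      -- Contracting the relations with vectors orthogonal to the columns 1 and 2
      -- leaves only β and φ³(β).
      contract : ∀ {β} → RankOne μ β → ∀ i j l →
        minor 0F 1F i j * minor 0F 2F 0F l * β + minor 3F 1F i j * minor 3F 2F 0F l * φ³ β ≡ 0#
      contract {β} rk i j l = use (c 1F j * c 2F l) (relation rk i 0F) (use (- (c 1F j * c 2F 0F)) (relation rk i l)
        (use (- (c 1F i * c 2F l)) (relation rk j 0F) (use (c 1F i * c 2F 0F) (relation rk j l)
        (solve 17 (λ β i₀ j₀ o₀ l₀ i₁ j₁ o₁ l₁ i₂ j₂ o₂ l₂ i₃ j₃ o₃ l₃ →
          let R = λ k₀ m₀ k₁ m₁ k₂ m₂ k₃ m₃ → k₀ :* m₀ :* β :+ k₁ :* m₁ :* Φ β :+ k₂ :* m₂ :* Φ² β :+ k₃ :* m₃ :* Φ³ β in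
          (i₀ :* j₁ :- j₀ :* i₁) :* (o₀ :* l₂ :- l₀ :* o₂) :* β :+ (i₃ :* j₁ :- j₃ :* i₁) :* (o₃ :* l₂ :- l₃ :* o₂) :* Φ³ β
          := O :+ j₁ :* l₂ :* (R i₀ o₀ i₁ o₁ i₂ o₂ i₃ o₃ :- O) :+ :- (j₁ :* o₂) :* (R i₀ l₀ i₁ l₁ i₂ l₂ i₃ l₃ :- O)
             :+ :- (i₁ :* l₂) :* (R j₀ o₀ j₁ o₁ j₂ o₂ j₃ o₃ :- O) :+ i₁ :* o₂ :* (R j₀ l₀ j₁ l₁ j₂ l₂ j₃ l₃ :- O)) refl
          β (c 0F i) (c 0F j) (c 0F 0F) (c 0F l) (c 1F i) (c 1F j) (c 1F 0F) (c 1F l)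
          (c 2F i) (c 2F j) (c 2F 0F) (c 2F l) (c 3F i) (c 3F j) (c 3F 0F) (c 3F l)))))
        where c = column

      -- `contract` fixes φ³(β)/β as -X/Y, the same for all solutions with this μ. The quotient of
      -- two solutions is therefore fixed by φ³, hence by φ.
      rankOne-proportional : ∀ {i j l} → minor 0F 1F i j ≢ 0# → minor 0F 2F 0F l ≢ 0# →
        ∀ {β β′} → β ≢ 0# → RankOne μ β → RankOne μ β′ → φ β * β′ ≡ φ β′ * β
      rankOne-proportional {i} {j} {l} m₁≢0 m₂≢0 {β} {β′} β≢0 rk rk′ = begin
        φ β * β′                     ≡⟨ solve 2 (λ x y → Φ x :* y := Φ (x :* Φ³ y)) refl β β′ ⟩
        φ (β * φ³ β′)         ≡⟨ cong φ proportional ⟩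
        φ (β′ * φ³ β)         ≡⟨ solve 2 (λ x y → Φ (y :* Φ³ x) := Φ y :* x) refl β β′ ⟩
        φ β′ * β                     ∎
        where
        X = minor 0F 1F i j * minor 0F 2F 0F l
        Y = minor 3F 1F i j * minor 3F 2F 0F l
        Y≢0 : Y ≢ 0#
        Y≢0 Y≡0 = *-nonzero (*-nonzero m₁≢0 m₂≢0) β≢0 (begin
          X * β                            ≡⟨ solve 2 (λ x y → x := x :+ O :* y) refl (X * β) (φ³ β) ⟩
          X * β + 0# * φ³ β         ≡⟨ cong (λ y → X * β + y * φ³ β) Y≡0 ⟨
          X * β + Y * φ³ β          ≡⟨ contract rk i j l ⟩
          0#                               ∎)
        proportional : β * φ³ β′ ≡ β′ * φ³ β
        proportional = *-cancelˡ Y≢0 (use β (contract rk′ i j l) (use (- β′) (contract rk i j l)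
          (solve 4 (λ X Y β β′ → Y :* (β :* Φ³ β′) := Y :* (β′ :* Φ³ β)
            :+ β :* (X :* β′ :+ Y :* Φ³ β′ :- O) :+ :- β′ :* (X :* β :+ Y :* Φ³ β :- O)) refl X Y β β′)))

  -- Maps with values in a multiple of E.

  ½trace-nonzero : ∃[ y ] y + φ² y ≢ 0#
  ½trace-nonzero = let (y , nz) = skew-nonvanishing (vec₄ 1# 0# 1# 0#) 0F 1≢0 in
    y , λ eq → nz (trans (solve 1 (λ y → skewᴱ I O I O y := y :+ Φ² y) refl y) eq)

  -- The trace from K to E is E-linear, so a nonzero value n only has to be multiplied by t/n.
  ½trace-surjective : ∀ t → φ² t ≡ t → ∃[ β ] β + φ² β ≡ t
  ½trace-surjective t t∈E = y * τ , trans
      (use (φ² y) φφτ (solve 2 (λ y τ → y :* τ :+ Φ² (y :* τ) := τ :* (y :+ Φ² y) :+ Φ² y :* (Φ² τ :- τ)) refl y τ)) τn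
    where
    y = proj₁ ½trace-nonzero
    n = y + φ² y
    τ = proj₁ (divide t (proj₂ ½trace-nonzero))
    τn : τ * n ≡ t
    τn = proj₂ (divide t (proj₂ ½trace-nonzero))
    φφτ : φ² τ ≡ τ
    φφτ = *-cancelˡ (proj₂ ½trace-nonzero) (use 1# (cong φ² τn) (use 1# t∈E (use (- 1#) τn
      (solve 3 (λ y τ t → let n = y :+ Φ² y in n :* Φ² τ := n :* τ
        :+ I :* (Φ² (τ :* n) :- Φ² t) :+ I :* (Φ² t :- t) :+ :- I :* (τ :* n :- t)) refl y τ t))))

  -- The F-linear map t ↦ tP - φ(t)Q of E has determinant Pφ(P) - Qφ(Q). If that vanishes, Hilbert
  -- 90 gives a kernel element and e = 0 serves; otherwise the map is bijective and e ≠ 0 can be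
  -- prescribed.
  quadratic-equation : ∀ P Q M → φ² P ≡ P → φ² Q ≡ Q → φ² M ≡ M → P ≢ 0# →
    ∃₂ λ t e → φ² t ≡ t × φ e ≡ - e × φ t * Q + e * M ≡ t * P × ¬ (t ≡ 0# × e ≡ 0#)
  quadratic-equation P Q M P∈E Q∈E M∈E P≢0 with P * φ P ≟ Q * φ Q
  ... | yes PP≡QQ = η , 0# , φφη , trans φ-0 (sym -0#≈0#) ,
      use Q φη (use η sQ (solve 5 (λ P Q M s η → Φ η :* Q :+ O :* M := η :* P :+ Q :* (Φ η :- s :* η) :+ η :* (s :* Q :- P)) refl P Q M s η)) ,
      λ (η≡0 , _) → η≢0 η≡0
    where
    Q≢0 : Q ≢ 0#
    Q≢0 refl = *-nonzero P≢0 (φ-nonzero P≢0) (trans PP≡QQ (zeroˡ _))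
    s = proj₁ (divide P Q≢0)
    sQ : s * Q ≡ P
    sQ = proj₂ (divide P Q≢0)
    ss≡1 : s * φ s ≡ 1#
    ss≡1 = *-cancelˡ (*-nonzero Q≢0 (φ-nonzero Q≢0)) (begin
      Q * φ Q * (s * φ s)      ≡⟨ solve 2 (λ s Q → Q :* Φ Q :* (s :* Φ s) := s :* Q :* Φ (s :* Q)) refl s Q ⟩
      s * Q * φ (s * Q)        ≡⟨ cong₂ (λ x y → x * φ y) sQ sQ ⟩
      P * φ P                  ≡⟨ PP≡QQ ⟩
      Q * φ Q                  ≡⟨ *-identityʳ _ ⟨
      Q * φ Q * 1#             ∎)
    H = hilbert90ᴱ s ss≡1
    η = proj₁ H
    η≢0 : η ≢ 0#
    η≢0 = proj₁ (proj₂ H)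
    φφη : φ² η ≡ η
    φφη = proj₁ (proj₂ (proj₂ H))
    φη : φ η ≡ s * η
    φη = proj₂ (proj₂ (proj₂ H))
  ... | no PP≢QQ = e * τ , e , t∈E , φe , *-cancelˡ D≢0 equation , λ (_ , e≡0) → e≢0 e≡0
    where
    ω = proj₁ quadratic
    ω∈E : φ² ω ≡ ω
    ω∈E = proj₁ (proj₂ quadratic)
    e = φ ω - ω
    e≢0 : e ≢ 0#
    e≢0 eq = proj₂ (proj₂ quadratic) (x-y≡0⇒x≡y eq)
    φe : φ e ≡ - e
    φe = use 1# ω∈E (solve 1 (λ ω → Φ (Φ ω :- ω) := :- (Φ ω :- ω) :+ I :* (Φ² ω :- ω)) refl ω)
    D = P * φ P - Q * φ Q
    D≢0 : D ≢ 0#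
    D≢0 eq = PP≢QQ (x-y≡0⇒x≡y eq)
    -- With t = eτ the equation reads τP + φ(τ)Q = M; Cramer's rule applies to it and its conjugate
    -- under φ.
    R = M * φ P - Q * φ M
    τ = proj₁ (divide R D≢0)
    τD : τ * D ≡ R
    τD = proj₂ (divide R D≢0)
    φτD : D * φ τ ≡ φ M * P - φ Q * M
    φτD = use 1# (cong φ τD) (use (- (φ τ * φ P) + φ M) P∈E (use (φ τ * φ Q) Q∈E (use (- φ Q) M∈E
      (solve 4 (λ P Q M τ → (P :* Φ P :- Q :* Φ Q) :* Φ τ := Φ M :* P :- Φ Q :* M
        :+ I :* (Φ (τ :* (P :* Φ P :- Q :* Φ Q)) :- Φ (M :* Φ P :- Q :* Φ M))
        :+ (:- (Φ τ :* Φ P) :+ Φ M) :* (Φ² P :- P) :+ Φ τ :* Φ Q :* (Φ² Q :- Q) :+ :- Φ Q :* (Φ² M :- M)) refl P Q M τ))))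
    τ∈E : φ² τ ≡ τ
    τ∈E = *-cancelˡ D≢0 (begin
      D * φ² τ
        ≡⟨ use 1# (cong φ φτD) (use (- (φ P * φ² τ)) P∈E (use (φ Q * φ² τ) Q∈E (use (φ P) M∈E (use (- φ M) Q∈E
             (solve 4 (λ P Q M τ → (P :* Φ P :- Q :* Φ Q) :* Φ² τ := M :* Φ P :- Q :* Φ M
               :+ I :* (Φ ((P :* Φ P :- Q :* Φ Q) :* Φ τ) :- Φ (Φ M :* P :- Φ Q :* M))
               :+ :- (Φ P :* Φ² τ) :* (Φ² P :- P) :+ Φ Q :* Φ² τ :* (Φ² Q :- Q) :+ Φ P :* (Φ² M :- M) :+ :- Φ M :* (Φ² Q :- Q)) refl P Q M τ))))) ⟩
      R         ≡⟨ τD ⟨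
      τ * D     ≡⟨ *-comm _ _ ⟩
      D * τ     ∎)
    t∈E : φ² (e * τ) ≡ e * τ
    t∈E = begin
      φ² (e * τ)          ≡⟨ solve 2 (λ e τ → Φ² (e :* τ) := Φ² e :* Φ² τ) refl e τ ⟩
      φ² e * φ² τ      ≡⟨ cong₂ _*_ (trans (cong φ φe) (trans (φ-neg e) (trans (cong -_ φe) (-‿involutive e)))) τ∈E ⟩
      e * τ                  ∎
    equation : D * (φ (e * τ) * Q + e * M) ≡ D * (e * τ * P)
    equation = use (D * φ τ * Q) φe (use (- (e * Q)) φτD (use (- (e * P)) τD
      (solve 5 (λ P Q M τ e → let D = P :* Φ P :- Q :* Φ Q in
        D :* (Φ (e :* τ) :* Q :+ e :* M) := D :* (e :* τ :* P)
        :+ D :* Φ τ :* Q :* (Φ e :- :- e) :+ :- (e :* Q) :* (D :* Φ τ :- (Φ M :* P :- Φ Q :* M)) :+ :- (e :* P) :* (τ :* D :- (M :* Φ P :- Q :* Φ M))) refl P Q M τ e)))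

  -- The coefficients (0, a, 1, b) are those of σ⁻¹(u, φ(v), φ²(u), φ³(v)) up to the coefficient
  -- of x, where σ = φ²(u); the graph is then, up to equivalence, that of a map into
  -- the quadratic subfield.
  module _ (a b u v : Carrier) (a-eq : a * φ² u ≡ φ v) (b-eq : b * φ² u ≡ φ³ v)
           (u≢0 : u ≢ 0#) (independent : u * φ² v ≢ v * φ² u) where

    module _ (t e : Carrier) (t∈E : φ² t ≡ t) (φe : φ e ≡ - e)
      (tPQM : φ t * (v * φ² v) + e * (u * φ² v + v * φ² u) ≡ t * (u * φ² u)) (te≢0 : ¬ (t ≡ 0# × e ≡ 0#)) where

      private
        -- Chosen so that `core₁` reduces to φ(e) = -e, and `core₂` to `tPQM` together with t and e
        -- being in E.
        α : Carrier
        α = e * v - t * u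

        φφe : φ² e ≡ e
        φφe = trans (cong φ φe) (trans (φ-neg e) (trans (cong -_ φe) (-‿involutive e)))

        Γ′ : Carrier
        Γ′ = - (α * u + α * u + t * (u * u) + φ t * (v * v))

        -- ev = tu with e and t in E contradicts the independence of u and v over E, unless both are
        -- 0.
        α≢0 : α ≢ 0#
        α≢0 α≡0 = te≢0 (t≡0 , e≡0)
          where
          e≡0 : e ≡ 0#
          e≡0 with e ≟ 0#
          ... | yes eq = eq
          ... | no e≢0 = contradiction (*-cancelˡ e≢0 (use u (trans (cong φ² α≡0) (trans (cong φ φ-0) φ-0)) (use (- φ² u) α≡0
            (use (- (u * φ² v)) φφe (use (u * φ² u) t∈E
            (solve 4 (λ u v t e → e :* (u :* Φ² v) := e :* (v :* Φ² u)
              :+ u :* (Φ² (e :* v :- t :* u) :- O) :+ :- Φ² u :* (e :* v :- t :* u :- O)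
              :+ :- (u :* Φ² v) :* (Φ² e :- e) :+ u :* Φ² u :* (Φ² t :- t)) refl u v t e)))))) independent
          t≡0 : t ≡ 0#
          t≡0 = xy≡0⇒y≡0 u≢0 (use (- 1#) α≡0 (use v e≡0 (solve 4 (λ u v t e → u :* t := O :+ :- I :* (e :* v :- t :* u :- O) :+ v :* (e :- O)) refl u v t e)))

        -- A form in the coordinates x and h, where h(x) = σf(x) + ux has values in E. There the
        -- trace of βhh′ depends only on β + φ²(β) = t. `A` and `B` come from substituting h = σy +
        -- ux.
        module Candidate (β : Carrier) (β-trace : β + φ² β ≡ t) where

          σ A B : Carrier
          σ = φ² u
          B = β * (σ * σ)
          A = σ * (α + β * u)

          core₁ : t * (u * φ v) + φ t * (v * φ u) + v * φ α + φ v * α ≡ 0#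
          core₁ = use (v * φ v) φe (solve 4 (λ u v t e → let α = e :* v :- t :* u in
            t :* (u :* Φ v) :+ Φ t :* (v :* Φ u) :+ v :* Φ α :+ Φ v :* α := O :+ v :* Φ v :* (Φ e :- :- e)) refl u v t e)

          core₂ : φ t * (v * φ² v) + t * (u * φ² u) + u * φ² α + φ² u * α ≡ 0#
          core₂ = use 1# tPQM (use (u * φ² v) φφe (use (- (u * φ² u)) t∈E (solve 4 (λ u v t e → let α = e :* v :- t :* u in
            Φ t :* (v :* Φ² v) :+ t :* (u :* Φ² u) :+ u :* Φ² α :+ Φ² u :* α
            := O :+ I :* (Φ t :* (v :* Φ² v) :+ e :* (u :* Φ² v :+ v :* Φ² u) :- t :* (u :* Φ² u))
               :+ u :* Φ² v :* (Φ² e :- e) :+ :- (u :* Φ² u) :* (Φ² t :- t)) refl u v t e)))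

          aσ : a * σ ≡ φ v
          aσ = a-eq
          bσ : b * σ ≡ φ³ v
          bσ = b-eq

          isotropic : Isotropic a b A B
          isotropic = record
            { iso₁ = begin
                φ² (B * b) + φ³ (B * a) + φ (A * b) + A * a
                  ≡⟨ solve 5 (λ β α u a b → let σ = Φ² u ; B = β :* (σ :* σ) ; A = σ :* (α :+ β :* u) in
                       Φ² (B :* b) :+ Φ³ (B :* a) :+ Φ (A :* b) :+ A :* a
                       := Φ² (β :* σ :* (b :* σ)) :+ Φ³ (β :* σ :* (a :* σ)) :+ Φ ((α :+ β :* u) :* (b :* σ)) :+ (α :+ β :* u) :* (a :* σ)) refl β α u a b ⟩
                φ² (β * σ * (b * σ)) + φ³ (β * σ * (a * σ)) + φ ((α + β * u) * (b * σ)) + (α + β * u) * (a * σ)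
                  ≡⟨ cong₂ (λ x y → φ² (β * σ * y) + φ³ (β * σ * x) + φ ((α + β * u) * y) + (α + β * u) * x) aσ bσ ⟩
                φ² (β * σ * φ³ v) + φ³ (β * σ * φ v) + φ ((α + β * u) * φ³ v) + (α + β * u) * φ v
                  ≡⟨ use (u * φ v) β-trace (use (v * φ u) (cong φ β-trace)
                       (solve 5 (λ β α u v t → let σ = Φ² u in
                         Φ² (β :* σ :* Φ³ v) :+ Φ³ (β :* σ :* Φ v) :+ Φ ((α :+ β :* u) :* Φ³ v) :+ (α :+ β :* u) :* Φ v
                         := t :* (u :* Φ v) :+ Φ t :* (v :* Φ u) :+ v :* Φ α :+ Φ v :* α
                            :+ u :* Φ v :* (β :+ Φ² β :- t) :+ v :* Φ u :* (Φ (β :+ Φ² β) :- Φ t)) refl β α u v t)) ⟩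
                t * (u * φ v) + φ t * (v * φ u) + v * φ α + φ v * α ≡⟨ core₁ ⟩
                0# ∎
            ; iso₂ = begin
                φ (B * (b * a)) + φ³ (B * (a * b)) + φ² A + A
                  ≡⟨ solve 5 (λ β α u a b → let σ = Φ² u ; B = β :* (σ :* σ) ; A = σ :* (α :+ β :* u) in
                       Φ (B :* (b :* a)) :+ Φ³ (B :* (a :* b)) :+ Φ² A :+ A
                       := Φ (β :* (b :* σ :* (a :* σ))) :+ Φ³ (β :* (a :* σ :* (b :* σ))) :+ Φ² A :+ A) refl β α u a b ⟩
                φ (β * (b * σ * (a * σ))) + φ³ (β * (a * σ * (b * σ))) + φ² A + A
                  ≡⟨ cong₂ (λ x y → φ (β * (y * x)) + φ³ (β * (x * y)) + φ² A + A) aσ bσ ⟩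
                φ (β * (φ³ v * φ v)) + φ³ (β * (φ v * φ³ v)) + φ² A + A
                  ≡⟨ use (u * φ² u) β-trace (use (v * φ² v) (cong φ β-trace)
                       (solve 5 (λ β α u v t → let A = Φ² u :* (α :+ β :* u) in
                         Φ (β :* (Φ³ v :* Φ v)) :+ Φ³ (β :* (Φ v :* Φ³ v)) :+ Φ² A :+ A
                         := Φ t :* (v :* Φ² v) :+ t :* (u :* Φ² u) :+ u :* Φ² α :+ Φ² u :* α
                            :+ u :* Φ² u :* (β :+ Φ² β :- t) :+ v :* Φ² v :* (Φ (β :+ Φ² β) :- Φ t)) refl β α u v t)) ⟩
                φ t * (v * φ² v) + t * (u * φ² u) + u * φ² α + φ² u * α ≡⟨ core₂ ⟩
                0# ∎
            }

          Γ₀B : Γ₀ a b B ≡ Γ′ + (α * u + α * u) + β * (u * u)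
          Γ₀B = begin
            - (φ (B * (b * b)) + φ² B + φ³ (B * (a * a)))
              ≡⟨ solve 4 (λ β u a b → let σ = Φ² u ; B = β :* (σ :* σ) in
                   :- (Φ (B :* (b :* b)) :+ Φ² B :+ Φ³ (B :* (a :* a)))
                   := :- (Φ (β :* (b :* σ :* (b :* σ))) :+ Φ² B :+ Φ³ (β :* (a :* σ :* (a :* σ))))) refl β u a b ⟩
            - (φ (β * (b * σ * (b * σ))) + φ² B + φ³ (β * (a * σ * (a * σ))))
              ≡⟨ cong₂ (λ x y → - (φ (β * (y * y)) + φ² B + φ³ (β * (x * x)))) aσ bσ ⟩
            - (φ (β * (φ³ v * φ³ v)) + φ² B + φ³ (β * (φ v * φ v)))
              ≡⟨ use (- (u * u)) β-trace (use (- (v * v)) (cong φ β-trace)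
                   (solve 5 (λ β α u v t → let B = β :* (Φ² u :* Φ² u) in
                     :- (Φ (β :* (Φ³ v :* Φ³ v)) :+ Φ² B :+ Φ³ (β :* (Φ v :* Φ v)))
                     := :- (α :* u :+ α :* u :+ t :* (u :* u) :+ Φ t :* (v :* v)) :+ (α :* u :+ α :* u) :+ β :* (u :* u)
                        :+ :- (u :* u) :* (β :+ Φ² β :- t) :+ :- (v :* v) :* (Φ (β :+ Φ² β) :- Φ t)) refl β α u v t)) ⟩
            Γ′ + (α * u + α * u) + β * (u * u) ∎

          selfDual : β * Γ′ ≢ α * α → SelfDual (vec₄ 0# a 1# b)
          selfDual nd = isotropic⇒selfDual a b isotropic λ eq → nd (*-cancelˡ (*-nonzero σ≢0 σ≢0) (use (- B) Γ₀B (use 1# eq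
            (solve 6 (λ β Γ′ α u σ G → σ :* σ :* (β :* Γ′) := σ :* σ :* (α :* α)
              :+ :- (β :* (σ :* σ)) :* (G :- (Γ′ :+ (α :* u :+ α :* u) :+ β :* (u :* u)))
              :+ I :* (β :* (σ :* σ) :* G :- σ :* (α :+ β :* u) :* (σ :* (α :+ β :* u)))) refl β Γ′ α u σ (Γ₀ a b B)))))
            where
            σ≢0 : σ ≢ 0#
            σ≢0 = φ-nonzero (φ-nonzero u≢0)

      -- Adding θ to β keeps its trace to E and changes βΓ′ - α² by θΓ′. If the first candidate is
      -- degenerate then Γ′ ≠ 0, because α ≠ 0, so the second is not.
      quadratic-selfDual′ : ∀ β → β + φ² β ≡ t → SelfDual (vec₄ 0# a 1# b)
      quadratic-selfDual′ β β-trace = cases (β * Γ′ ≟ α * α)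
        where
        cases : Dec (β * Γ′ ≡ α * α) → SelfDual (vec₄ 0# a 1# b)
        cases (no nd)     = Candidate.selfDual β β-trace nd
        cases (yes βΓ≡αα) = Candidate.selfDual (β + θ) trace nd
          where
          θ = proj₁ antifixed
          trace : β + θ + φ² (β + θ) ≡ t
          trace = use 1# β-trace (use 1# (proj₂ (proj₂ antifixed))
            (solve 3 (λ β θ t → β :+ θ :+ Φ² (β :+ θ) := t :+ I :* (β :+ Φ² β :- t) :+ I :* (Φ² θ :- :- θ)) refl β θ t))
          nd : (β + θ) * Γ′ ≢ α * α
          nd eq = *-nonzero (proj₁ (proj₂ antifixed)) Γ≢0 (use 1# eq (use (- 1#) βΓ≡αα
            (solve 4 (λ β θ Γ α → θ :* Γ := O :+ I :* ((β :+ θ) :* Γ :- α :* α) :+ :- I :* (β :* Γ :- α :* α)) refl β θ Γ′ α)))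
            where
            Γ≢0 : Γ′ ≢ 0#
            Γ≢0 Γ≡0 = α≢0 (xx≡0⇒x≡0 (trans (sym βΓ≡αα) (trans (cong (β *_) Γ≡0) (zeroʳ β))))

    quadratic-selfDual : SelfDual (vec₄ 0# a 1# b)
    quadratic-selfDual =
      let (t , e , t∈E , φe , eq , te≢0) = quadratic-equation (u * φ² u) (v * φ² v) (u * φ² v + v * φ² u)
            (solve 1 (λ u → Φ² (u :* Φ² u) := u :* Φ² u) refl u)
            (solve 1 (λ u → Φ² (u :* Φ² u) := u :* Φ² u) refl v)
            (solve 2 (λ u v → Φ² (u :* Φ² v :+ v :* Φ² u) := u :* Φ² v :+ v :* Φ² u) refl u v)
            (*-nonzero u≢0 (φ-nonzero (φ-nonzero u≢0)))
          (β , β-trace) = ½trace-surjective t t∈E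
      in quadratic-selfDual′ t e t∈E φe eq te≢0 β β-trace

  -- A nondegenerate form when A ≠ B.

  module _ (a b : Carrier) (A≢B : a * φ a ≢ φ b * φ² b) where

    private
      -- The Dickson columns 0 and 2 are parallel.
      parallel : ∀ μ → μ * φ² b ≡ a → μ * φ² μ ≡ 1# → μ * φ² a ≡ b → SelfDual (vec₄ 0# a 1# b)
      -- With φ²(σ) = μσ the map σ(f + μ) is invariant under φ², so its values lie in E; u and v are
      -- read off from its coefficients.
      parallel μ eq-a eq-1 eq-b = quadratic-selfDual a b (φ² σ) (φ³ (a * σ))
          (solve 2 (λ a σ → a :* Φ (Φ³ σ) := Φ (Φ³ (a :* σ))) refl a σ)
          (use (- σ) eq-b (use (- φ² a) φφσ
            (solve 4 (λ a b μ σ → b :* Φ (Φ³ σ) := Φ³ (Φ³ (a :* σ))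
              :+ :- σ :* (μ :* Φ² a :- b) :+ :- Φ² a :* (Φ² σ :- μ :* σ)) refl a b μ σ)))
          (φ-nonzero (φ-nonzero σ≢0)) independent
        where
        H = hilbert90² μ eq-1
        σ = proj₁ H
        σ≢0 : σ ≢ 0#
        σ≢0 = proj₁ (proj₂ H)
        φφσ : φ² σ ≡ μ * σ
        φφσ = proj₂ (proj₂ H)
        independent : φ² σ * φ² (φ³ (a * σ)) ≢ φ³ (a * σ) * φ (φ³ σ)
        -- Dependence of u and v gives a = bφ(μ), and then `eq-b` turns aφ(a) into φ(b)φ²(b).
        independent eq = A≢B (begin
          a * φ a                    ≡⟨ cong (λ z → a * φ z) bφμ≡a ⟨
          a * φ (b * φ μ)            ≡⟨ solve 3 (λ a b μ → a :* Φ (b :* Φ μ) := Φ b :* Φ² (μ :* Φ² a)) refl a b μ ⟩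
          φ b * φ² (μ * φ² a)  ≡⟨ cong (λ z → φ b * φ² z) eq-b ⟩
          φ b * φ² b              ∎)
          where
          bφμ≡a : b * φ μ ≡ a
          bφμ≡a = *-cancelˡ (*-nonzero σ≢0 (φ-nonzero σ≢0)) (use 1# (cong φ eq) (use (- (φ μ * φ σ * σ)) eq-b
            (use (- (φ μ * φ σ * φ² a)) φφσ (use (- (φ² a * φ² σ)) (cong φ φφσ)
            (solve 4 (λ a b μ σ → σ :* Φ σ :* (b :* Φ μ) := σ :* Φ σ :* a
              :+ I :* (Φ (Φ² σ :* Φ² (Φ³ (a :* σ))) :- Φ (Φ³ (a :* σ) :* Φ (Φ³ σ)))
              :+ :- (Φ μ :* Φ σ :* σ) :* (μ :* Φ² a :- b)
              :+ :- (Φ μ :* Φ σ :* Φ² a) :* (Φ² σ :- μ :* σ)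
              :+ :- (Φ² a :* Φ² σ) :* (Φ³ σ :- Φ (μ :* σ))) refl a b μ σ)))))

      -- If the minors at (1, 2) and (0, 3) both vanish, then φ(μ) = aφ(a) and μ = bφ(b), against
      -- `A≢B`.
      minor₀₁ : ∀ μ → ∃₂ λ i j → minor a b {μ} 0F 1F i j ≢ 0#
      minor₀₁ μ with a * φ a - 1# * φ μ ≟ 0#
      ... | no ≢0 = 1F , 2F , ≢0
      ... | yes eq = 0F , 3F , λ eq′ → A≢B (use 1# eq (use 1# (cong φ eq′) (use 1# φ-0
        (solve 3 (λ a b μ → a :* Φ a := Φ b :* Φ² b :+ I :* (a :* Φ a :- I :* Φ μ :- O) :+ I :* (Φ (μ :* I :- b :* Φ b) :- Φ O) :+ I :* (Φ O :- O)) refl a b μ))))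

      minor₀₂ : ∀ μ → (μ * φ² b ≡ a × μ * φ² μ ≡ 1# × μ * φ² a ≡ b) ⊎ (∃[ l ] minor a b {μ} 0F 2F 0F l ≢ 0#)
      minor₀₂ μ with μ * φ² b - a * 1# ≟ 0# | μ * φ² μ - 1# * 1# ≟ 0# | μ * φ² a - b * 1# ≟ 0#
      ... | no ≢0 | _      | _      = inj₂ (1F , ≢0)
      ... | yes _ | no ≢0  | _      = inj₂ (2F , ≢0)
      ... | yes _ | yes _  | no ≢0  = inj₂ (3F , ≢0)
      ... | yes e | yes e′ | yes e″ = inj₁ (simplify e , simplify e′ , simplify e″)
        where
        simplify : ∀ {x y} → x - y * 1# ≡ 0# → x ≡ y
        simplify eq = trans (x-y≡0⇒x≡y eq) (*-identityʳ _)

    -- The determinant of the sum of the two rank one forms is β₁β₂(μ - μ′)².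
    distinct-selfDual : ∀ {α₁ β₁ α₂ β₂ μ μ′} → Isotropic a b α₁ β₁ → Isotropic a b α₂ β₂ → β₁ ≢ 0# → β₂ ≢ 0# →
      μ * β₁ ≡ α₁ → μ′ * β₂ ≡ α₂ → RankOne a b μ β₁ → RankOne a b μ′ β₂ → μ ≢ μ′ → SelfDual (vec₄ 0# a 1# b)
    distinct-selfDual {α₁} {β₁} {α₂} {β₂} {μ} {μ′} iso₁ iso₂ β₁≢0 β₂≢0 μβ₁≡α₁ μ′β₂≡α₂ rk₁ rk₂ μ≢μ′ =
      isotropic⇒selfDual a b (isotropic-+ a b iso₁ iso₂) λ eq →
        *-nonzero (*-nonzero β₁≢0 β₂≢0) (*-nonzero μ-μ′≢0 μ-μ′≢0) (begin
          β₁ * β₂ * ((μ - μ′) * (μ - μ′))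
            ≡⟨ solve 4 (λ β β′ μ μ′ → β :* β′ :* ((μ :- μ′) :* (μ :- μ′)) := (β :+ β′) :* (μ :* μ :* β :+ μ′ :* μ′ :* β′) :- (μ :* β :+ μ′ :* β′) :* (μ :* β :+ μ′ :* β′)) refl β₁ β₂ μ μ′ ⟩
          (β₁ + β₂) * (μ * μ * β₁ + μ′ * μ′ * β₂) - (μ * β₁ + μ′ * β₂) * (μ * β₁ + μ′ * β₂)
            ≡⟨ cong₂ (λ x z → (β₁ + β₂) * x - z * z) Γ-+ (sym (cong₂ _+_ μβ₁≡α₁ μ′β₂≡α₂)) ⟨
          (β₁ + β₂) * Γ₀ a b (β₁ + β₂) - (α₁ + α₂) * (α₁ + α₂)
            ≡⟨ cong (_- (α₁ + α₂) * (α₁ + α₂)) eq ⟩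
          (α₁ + α₂) * (α₁ + α₂) - (α₁ + α₂) * (α₁ + α₂) ≡⟨ -‿inverseʳ _ ⟩
          0# ∎)
      where
      μ-μ′≢0 : μ - μ′ ≢ 0#
      μ-μ′≢0 eq = μ≢μ′ (x-y≡0⇒x≡y eq)
      Γ₀-value : ∀ {β μ} → RankOne a b μ β → Γ₀ a b β ≡ μ * μ * β
      Γ₀-value {β} {μ} rk = use (- 1#) (RankOne.rk₀ rk) (solve 4 (λ β μ a b → :- (Φ (β :* (b :* b)) :+ Φ² β :+ Φ³ (β :* (a :* a))) := μ :* μ :* β
        :+ :- I :* (β :* (μ :* μ) :+ Φ (β :* (b :* b)) :+ Φ² β :+ Φ³ (β :* (a :* a)) :- O)) refl β μ a b)
      Γ-+ : Γ₀ a b (β₁ + β₂) ≡ μ * μ * β₁ + μ′ * μ′ * β₂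
      Γ-+ = trans (solve 4 (λ β β′ a b → let G = λ β → :- (Φ (β :* (b :* b)) :+ Φ² β :+ Φ³ (β :* (a :* a))) in G (β :+ β′) := G β :+ G β′) refl β₁ β₂ a b)
        (cong₂ _+_ (Γ₀-value rk₁) (Γ₀-value rk₂))

    -- β₂/β₁ is a nonzero element of F, so Tr(cβ₁) and Tr(cβ₂) can only vanish together.
    proportional-absurd : ∀ {μ β₁ β₂ c l} → RankOne a b μ β₁ → RankOne a b μ β₂ → β₁ ≢ 0# → β₂ ≢ 0# →
      minor a b {μ} 0F 2F 0F l ≢ 0# → Tr (c * β₁) ≢ 0# → ¬ Tr (c * β₂) ≡ 0#
    proportional-absurd {μ} {β₁} {β₂} {c} {l} rk₁ rk₂ β₁≢0 β₂≢0 m₀₂ tr₁ tr₂ = ρ≢0 (xy≡0⇒y≡0 tr₁ (begin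
        Tr (c * β₁) * ρ
          ≡⟨ solve 2 (λ y ρ → (y :+ Φ y :+ Φ² y :+ Φ³ y) :* ρ := y :* ρ :+ Φ y :* ρ :+ Φ² y :* ρ :+ Φ³ y :* ρ) refl y ρ ⟩
        y * ρ + φ y * ρ + φ² y * ρ + φ³ y * ρ
          ≡⟨ cong₂ _+_ (cong₂ _+_ (cong (λ z → y * ρ + φ y * z) φρ≡ρ) (cong (φ² y *_) φφρ≡ρ)) (cong (φ³ y *_) (trans (cong φ φφρ≡ρ) φρ≡ρ)) ⟨
        y * ρ + φ y * φ ρ + φ² y * φ² ρ + φ³ y * φ³ ρ
          ≡⟨ solve 3 (λ c β ρ → let y = c :* β ; z = c :* (ρ :* β) in y :* ρ :+ Φ y :* Φ ρ :+ Φ² y :* Φ² ρ :+ Φ³ y :* Φ³ ρ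
               := z :+ Φ z :+ Φ² z :+ Φ³ z) refl c β₁ ρ ⟩
        Tr (c * (ρ * β₁))    ≡⟨ cong (λ z → Tr (c * z)) ρβ₁ ⟩
        Tr (c * β₂)          ≡⟨ tr₂ ⟩
        0#                   ∎))
      where
      y = c * β₁
      m₀₁ = minor₀₁ μ
      proportional : φ β₁ * β₂ ≡ φ β₂ * β₁
      proportional = rankOne-proportional a b {μ} {proj₁ m₀₁} {proj₁ (proj₂ m₀₁)} {l} (proj₂ (proj₂ m₀₁)) m₀₂ β₁≢0 rk₁ rk₂
      ρ = proj₁ (divide β₂ β₁≢0)
      ρβ₁ : ρ * β₁ ≡ β₂
      ρβ₁ = proj₂ (divide β₂ β₁≢0)
      ρ≢0 : ρ ≢ 0#
      ρ≢0 ρ≡0 = β₂≢0 (trans (sym ρβ₁) (trans (cong (_* β₁) ρ≡0) (zeroˡ _)))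
      φρ≡ρ : φ ρ ≡ ρ
      φρ≡ρ = *-cancelˡ (*-nonzero β₁≢0 (φ-nonzero β₁≢0)) (use β₁ (cong φ ρβ₁) (use (- 1#) proportional (use (- φ β₁) ρβ₁
        (solve 3 (λ ρ β₁ β₂ → β₁ :* Φ β₁ :* Φ ρ := β₁ :* Φ β₁ :* ρ :+ β₁ :* (Φ (ρ :* β₁) :- Φ β₂) :+ :- I :* (Φ β₁ :* β₂ :- Φ β₂ :* β₁) :+ :- Φ β₁ :* (ρ :* β₁ :- β₂)) refl ρ β₁ β₂))))
      φφρ≡ρ : φ² ρ ≡ ρ
      φφρ≡ρ = trans (cong φ φρ≡ρ) φρ≡ρ

    binary-selfDual : SelfDual (vec₄ 0# a 1# b)
    -- c = 0 imposes nothing on the first solution; the second is taken for a c with Tr(cβ₁) ≠ 0.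
    binary-selfDual = first (solution a b 0#)
      where
      selfDual-or-rankOne : ∀ {c} (s : Solution a b c) → let open Solution s in
        SelfDual (vec₄ 0# a 1# b) ⊎ (β ≢ 0# × ∃[ μ ] (μ * β ≡ α × RankOne a b μ β))
      selfDual-or-rankOne s = cases (β * Γ₀ a b β ≟ α * α)
        where
        open Solution s
        cases : Dec (β * Γ₀ a b β ≡ α * α) → SelfDual (vec₄ 0# a 1# b) ⊎ (β ≢ 0# × ∃[ μ ] (μ * β ≡ α × RankOne a b μ β))
        cases (no nd)   = inj₁ (isotropic⇒selfDual a b isotropic nd)
        cases (yes deg) = inj₂ (degenerate⇒rankOne a b isotropic nonzero deg)
      first : Solution a b 0# → SelfDual (vec₄ 0# a 1# b)
      first s₁ = cases (selfDual-or-rankOne s₁)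
        where
        open Solution s₁ renaming (α to α₁; β to β₁; isotropic to isotropic₁)
        second : ∀ {c μ l} → β₁ ≢ 0# → μ * β₁ ≡ α₁ → RankOne a b μ β₁ → minor a b {μ} 0F 2F 0F l ≢ 0# →
                 Tr (c * β₁) ≢ 0# → Solution a b c → SelfDual (vec₄ 0# a 1# b)
        second {c} {μ} β₁≢0 μβ₁≡α₁ rk₁ m₀₂ tr₁ s₂ = cases (selfDual-or-rankOne s₂)
          where
          open Solution s₂ renaming (α to α₂; β to β₂; isotropic to isotropic₂; trace to trace₂)
          compare : ∀ {μ′} → β₂ ≢ 0# → μ′ * β₂ ≡ α₂ → RankOne a b μ′ β₂ → Dec (μ ≡ μ′) → SelfDual (vec₄ 0# a 1# b)
          compare β₂≢0 _       rk₂ (yes refl) = contradiction trace₂ (proportional-absurd rk₁ rk₂ β₁≢0 β₂≢0 m₀₂ tr₁)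
          compare β₂≢0 μ′β₂≡α₂ rk₂ (no μ≢μ′)  = distinct-selfDual isotropic₁ isotropic₂ β₁≢0 β₂≢0 μβ₁≡α₁ μ′β₂≡α₂ rk₁ rk₂ μ≢μ′
          cases : SelfDual (vec₄ 0# a 1# b) ⊎ (β₂ ≢ 0# × ∃[ μ ] (μ * β₂ ≡ α₂ × RankOne a b μ β₂)) → SelfDual (vec₄ 0# a 1# b)
          cases (inj₁ sd) = sd
          cases (inj₂ (β₂≢0 , μ′ , μ′β₂≡α₂ , rk₂)) = compare β₂≢0 μ′β₂≡α₂ rk₂ (μ ≟ μ′)
        columns : ∀ {μ} → β₁ ≢ 0# → μ * β₁ ≡ α₁ → RankOne a b μ β₁ →
          (μ * φ² b ≡ a × μ * φ² μ ≡ 1# × μ * φ² a ≡ b) ⊎ (∃[ l ] minor a b {μ} 0F 2F 0F l ≢ 0#) → SelfDual (vec₄ 0# a 1# b)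
        columns {μ} β₁≢0 μβ₁≡α₁ rk₁ (inj₁ (eq-a , eq-1 , eq-b)) = parallel μ eq-a eq-1 eq-b
        columns {μ} β₁≢0 μβ₁≡α₁ rk₁ (inj₂ (l , m₀₂)) =
          let (y , Tr≢0) = trace-nonzero
              (c , cβ₁≡y) = divide y β₁≢0
          in second {l = l} β₁≢0 μβ₁≡α₁ rk₁ m₀₂ (subst (λ z → Tr z ≢ 0#) (sym cβ₁≡y) Tr≢0) (solution a b c)
        cases : SelfDual (vec₄ 0# a 1# b) ⊎ (β₁ ≢ 0# × ∃[ μ ] (μ * β₁ ≡ α₁ × RankOne a b μ β₁)) → SelfDual (vec₄ 0# a 1# b)
        cases (inj₁ sd) = sd
        cases (inj₂ (β₁≢0 , μ , μβ₁≡α₁ , rk₁)) = columns β₁≢0 μβ₁≡α₁ rk₁ (minor₀₂ μ)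

  -- A and B are the roots of the same quadratic polynomial as A′ and B′.
  module _ (p r t p′ r′ : Carrier) (e₁ : p * φ r ≡ p′ * φ r′) (e₂ : t * φ² t ≡ 1#)
           (e₃ : p * φ p + φ r * φ² r ≡ p′ * φ p′ * φ² t + t * φ r′ * φ² r′) where

    private
      A B A′ B′ : Carrier
      A  = p * φ p
      B  = φ r * φ² r
      A′ = p′ * φ p′ * φ² t
      B′ = t * φ r′ * φ² r′

      AB≡A′B′ : A * B ≡ A′ * B′
      AB≡A′B′ = begin
        A * B                                            ≡⟨ solve 2 (λ p r → p :* Φ p :* (Φ r :* Φ² r) := p :* Φ r :* Φ (p :* Φ r)) refl p r ⟩
        p * φ r * φ (p * φ r)                            ≡⟨ cong (λ z → z * φ z) e₁ ⟩
        p′ * φ r′ * φ (p′ * φ r′)                        ≡⟨ *-identityʳ _ ⟨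
        p′ * φ r′ * φ (p′ * φ r′) * 1#                   ≡⟨ cong (p′ * φ r′ * φ (p′ * φ r′) *_) e₂ ⟨
        p′ * φ r′ * φ (p′ * φ r′) * (t * φ² t)        ≡⟨ solve 3 (λ p r t → p :* Φ r :* Φ (p :* Φ r) :* (t :* Φ² t) := p :* Φ p :* Φ² t :* (t :* Φ r :* Φ² r)) refl p′ r′ t ⟩
        A′ * B′                                          ∎

      roots : (A - A′) * (A - B′) ≡ 0#
      roots = use A e₃ (use (- 1#) AB≡A′B′ (solve 4 (λ A B A′ B′ → (A :- A′) :* (A :- B′) := O :+ A :* (A :+ B :- (A′ :+ B′)) :+ :- I :* (A :* B :- A′ :* B′)) refl A B A′ B′))

      other : ∀ {A B A′ B′} → A + B ≡ A′ + B′ → A ≡ A′ → B ≡ B′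
      other {A} {B} {_} {B′} sum refl = use 1# sum (solve 3 (λ A B B′ → B := B′ :+ I :* (A :+ B :- (A :+ B′))) refl A B B′)

    ~-trinomial : vec₄ 0# p 1# r ~ vec₄ 0# p′ t r′
    ~-trinomial = cases (A ≟ A′)
      where
      cases : Dec (A ≡ A′) → vec₄ 0# p 1# r ~ vec₄ 0# p′ t r′
      cases (yes A≡A′) = ~-matching p r t p′ r′ e₁ e₂ A≡A′ (other e₃ A≡A′)
      cases (no A≢A′)  = ~-trans (SelfDual⇒~adjoint (binary-selfDual p r A≢B))
        -- The shift by 0 merely rewrites the coefficient φ²(1) of the adjoint as 1.
        (~-trans (~-shift {b = vec₄ 0# (φ r) 1# (φ³ p)} 0# (sym (+-identityʳ 0#)) refl (solve 0 (I := Φ² I) refl) refl)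
          (~-matching (φ r) (φ³ p) t p′ r′
            (trans (solve 2 (λ p r → Φ r :* Φ (Φ³ p) := p :* Φ r) refl p r) e₁) e₂ B≡A′
            (trans (solve 1 (λ p → Φ (Φ³ p) :* Φ² (Φ³ p) := p :* Φ p) refl p) A≡B′)))
        where
        A≡B′ : A ≡ B′
        A≡B′ = x-y≡0⇒x≡y (xy≡0⇒y≡0 (λ eq → A≢A′ (x-y≡0⇒x≡y eq)) roots)
        B≡A′ : B ≡ A′
        B≡A′ = other (trans e₃ (+-comm _ _)) A≡B′
        A≢B : A ≢ B
        A≢B A≡B = A≢A′ (trans A≡B B≡A′)

  -- Binomials pφ + rφ³.

  module _ (p r p′ r′ : Carrier) (same : SameEigenvalues (vec₄ 0# p 0# r) (vec₄ 0# p′ 0# r′))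
           (e₁ : p * φ r ≡ p′ * φ r′) where

    private
      a b : Skew
      a = vec₄ 0# p 0# r
      b = vec₄ 0# p′ 0# r′

      value : ∀ p r x → skewValue (vec₄ 0# p 0# r) x ≡ p * φ x + r * φ³ x
      value p r x = solve 3 (λ p r x → skewᴱ O p O r x := p :* Φ x :+ r :* Φ³ x) refl p r x

      diagonal : ∀ κ δ → κ ≢ 0# → δ ≢ 0# → p′ * φ κ ≡ δ * p → r′ * φ³ κ ≡ δ * r → a ~ b
      diagonal κ δ κ≢0 δ≢0 eq₁ eq₃ = ~-diagonal κ δ κ≢0 δ≢0 λ where
        0F → trans (zeroˡ _) (sym (zeroʳ _))
        1F → eq₁
        2F → trans (zeroˡ _) (sym (zeroʳ _))
        3F → eq₃

      -- The invariants have shrunk to pφ(r). The missing information is taken from the value p + r,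
      -- attained by `a` at 1 and therefore by `b` at some y.
      module BothNonzero (p≢0 : p ≢ 0#) (r≢0 : r ≢ 0#) where

        eigen : EigenValue (skewValue b) (p + r)
        eigen = proj₁ (same (p + r)) (1# , 1≢0 , solve 2 (λ p r → skewᴱ O p O r I := (p :+ r) :* I) refl p r)

        y Z : Carrier
        y = proj₁ eigen
        Z = p * y - p′ * φ y
        y≢0 : y ≢ 0#
        y≢0 = proj₁ (proj₂ eigen)
        eq-y : p′ * φ y + r′ * φ³ y ≡ (p + r) * y
        eq-y = trans (sym (value p′ r′ y)) (proj₂ (proj₂ eigen))

        -- Either y rescales f to g, or Z rescales the adjoint of f to g.
        cases : Dec (Z ≡ 0#) → a ~ b
        cases (yes Z≡0) = diagonal y y y≢0 y≢0 first
            (use 1# eq-y (use (- 1#) first (solve 5 (λ p r p′ r′ y → r′ :* Φ³ y := y :* r :+ I :* (p′ :* Φ y :+ r′ :* Φ³ y :- (p :+ r) :* y) :+ :- I :* (p′ :* Φ y :- y :* p)) refl p r p′ r′ y)))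
          where
          first : p′ * φ y ≡ y * p
          first = use (- 1#) Z≡0 (solve 3 (λ p p′ y → p′ :* Φ y := y :* p :+ :- I :* (p :* y :- p′ :* Φ y :- O)) refl p p′ y)
        cases (no Z≢0) = ~-trans (binomial-~adjoint p r p≢0 r≢0) (~-diagonal Z Z Z≢0 Z≢0 λ where
          0F → trans (zeroˡ _) (sym (zeroʳ _))
          1F → use (- p′) (cong φ eq-y) (use (- y) e₁
                 (solve 5 (λ p r p′ r′ y → let Z = p :* y :- p′ :* Φ y in p′ :* Φ Z := Z :* Φ r
                   :+ :- p′ :* (Φ (p′ :* Φ y :+ r′ :* Φ³ y) :- Φ ((p :+ r) :* y)) :+ :- y :* (p :* Φ r :- p′ :* Φ r′)) refl p r p′ r′ y))
          2F → trans (zeroˡ _) (sym (trans (cong (Z *_) (trans (cong φ φ-0) φ-0)) (zeroʳ _)))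
          3F → use (φ³ p) eq-y (use y (cong φ³ e₁)
                 (solve 5 (λ p r p′ r′ y → let Z = p :* y :- p′ :* Φ y in r′ :* Φ³ Z := Z :* Φ³ p
                   :+ Φ³ p :* (p′ :* Φ y :+ r′ :* Φ³ y :- (p :+ r) :* y) :+ y :* (Φ³ (p :* Φ r) :- Φ³ (p′ :* Φ r′))) refl p r p′ r′ y)))

      -- If f vanishes identically then 0 is its only eigenvalue.
      vanishing : ∀ {a b} → SameEigenvalues a b → (∀ x → skewValue a x ≡ 0#) → ∀ x → skewValue b x ≡ 0#
      vanishing {a} {b} same a≡0 x = cases (x ≟ 0#)
        where
        cases : Dec (x ≡ 0#) → skewValue b x ≡ 0#
        cases (yes refl) = skewValue-0 b
        cases (no x≢0) with proj₂ (same (skewValue b x * inv x)) (x , x≢0 , sym (trans (solve 3 (λ f i x → f :* i :* x := f :* (x :* i)) refl (skewValue b x) (inv x) x)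
            (trans (cong (skewValue b x *_) (x*inv≡1 x≢0)) (*-identityʳ _))))
        ... | w , w≢0 , eq = xy≡0⇒y≡0 (inv≢0 x≢0) (trans (*-comm _ _) (xy≡0⇒y≡0 w≢0 (trans (*-comm _ _) (trans (sym eq) (a≡0 w)))))

      vec-zero : ∀ {p r} → p ≡ 0# → r ≡ 0# → ∀ x → skewValue (vec₄ 0# p 0# r) x ≡ 0#
      vec-zero refl refl x = trans (value 0# 0# x) (trans (cong₂ _+_ (zeroˡ _) (zeroˡ _)) (+-identityʳ _))

      ¬both-zero : ¬ (p ≡ 0# × r ≡ 0#) → ¬ (p′ ≡ 0# × r′ ≡ 0#)
      ¬both-zero nz (p′≡0 , r′≡0) = nz (dedekind a a≡0 1F , dedekind a a≡0 3F)
        where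
        a≡0 : ∀ x → skewValue a x ≡ 0#
        a≡0 = vanishing {b} {a} (λ z → proj₂ (same z) , proj₁ (same z)) (vec-zero p′≡0 r′≡0)

      -- x ↦ pφ(x) and x ↦ rφ³(x) are exchanged by the coordinate swap.
      swap : ∀ {a b : Skew} β γ → β ≢ 0# → γ ≢ 0# → (∀ x → skewValue b (β * skewValue a x) ≡ γ * x) → a ~ b
      swap {a} {b} β γ β≢0 γ≢0 eq = record
        { α = 0# ; β = β ; γ = γ ; δ = 0#
        ; det≢0 = λ e → *-nonzero β≢0 γ≢0 (use (- 1#) e (solve 2 (λ β γ → β :* γ := O :+ :- I :* (O :* O :- β :* γ :- O)) refl β γ))
        ; maps = λ x → trans (cong (skewValue b) (solve 3 (λ x β f → O :* x :+ β :* f := β :* f) refl x β (skewValue a x)))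
            (trans (eq x) (solve 3 (λ x γ f → γ :* x := γ :* x :+ O :* f) refl x γ (skewValue a x)))
        }

      -- By `e₁` one of p′ and r′ vanishes too, so `b` is a multiple of φ or of φ³.
      p-only : p ≢ 0# → r ≡ 0# → a ~ b
      p-only p≢0 refl = cases (p′ ≟ 0#)
        where
        i = inv p
        pi≡1 : p * i ≡ 1#
        pi≡1 = x*inv≡1 p≢0
        cases : Dec (p′ ≡ 0#) → a ~ b
        cases (yes refl) = swap i r′ (inv≢0 p≢0) (λ r′≡0 → ¬both-zero (λ (p≡0 , _) → p≢0 p≡0) (refl , r′≡0))
          λ x → use (r′ * x) (trans (cong φ³ pi≡1) (solve 0 (Φ³ I := I) refl))
            (solve 4 (λ p r′ i x → let y = i :* skewᴱ O p O O x in
              skewᴱ O O O r′ y := r′ :* x :+ r′ :* x :* (Φ³ (p :* i) :- I)) refl p r′ i x)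
        cases (no p′≢0) = diagonal 1# (p′ * i) 1≢0 (*-nonzero p′≢0 (inv≢0 p≢0))
          (use (- p′) pi≡1 (solve 3 (λ p p′ i → p′ :* Φ I := p′ :* i :* p :+ :- p′ :* (p :* i :- I)) refl p p′ i))
          (trans (cong (_* φ³ 1#) r′≡0) (trans (zeroˡ _) (sym (zeroʳ _))))
          where
          r′≡0 : r′ ≡ 0#
          r′≡0 = φ-injective (trans (xy≡0⇒y≡0 p′≢0 (trans (sym e₁) (trans (cong (p *_) φ-0) (zeroʳ p)))) (sym φ-0))

      r-only : p ≡ 0# → r ≢ 0# → a ~ b
      r-only refl r≢0 = cases (p′ ≟ 0#)
        where
        i = inv r
        ri≡1 : r * i ≡ 1#
        ri≡1 = x*inv≡1 r≢0
        cases : Dec (p′ ≡ 0#) → a ~ b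
        cases (yes refl) = diagonal 1# (r′ * i) 1≢0 (*-nonzero (λ r′≡0 → ¬both-zero (λ (_ , r≡0) → r≢0 r≡0) (refl , r′≡0)) (inv≢0 r≢0))
          (trans (zeroˡ _) (sym (zeroʳ _)))
          (use (- r′) ri≡1 (solve 3 (λ r r′ i → r′ :* Φ³ I := r′ :* i :* r :+ :- r′ :* (r :* i :- I)) refl r r′ i))
        cases (no p′≢0) = swap i p′ (inv≢0 r≢0) p′≢0 λ x → use (p′ * x) (trans (cong φ ri≡1) φ-1) (use (φ³ (i * (r * φ³ x))) r′≡0
            (solve 5 (λ r p′ r′ i x → let y = i :* skewᴱ O O O r x ; y′ = i :* (r :* Φ³ x) in
              skewᴱ O p′ O r′ y := p′ :* x :+ p′ :* x :* (Φ (r :* i) :- I) :+ Φ³ y′ :* (r′ :- O)) refl r p′ r′ i x))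
          where
          r′≡0 : r′ ≡ 0#
          r′≡0 = φ-injective (trans (xy≡0⇒y≡0 p′≢0 (trans (sym e₁) (zeroˡ _))) (sym φ-0))

    ~-binomial : a ~ b
    ~-binomial = cases (p ≟ 0#) (r ≟ 0#)
      where
      cases : Dec (p ≡ 0#) → Dec (r ≡ 0#) → a ~ b
      cases (no p≢0)  (no r≢0)  = BothNonzero.cases p≢0 r≢0 (BothNonzero.Z p≢0 r≢0 ≟ 0#)
      cases (no p≢0)  (yes r≡0) = p-only p≢0 r≡0
      cases (yes p≡0) (no r≢0)  = r-only p≡0 r≢0
      cases (yes p≡0) (yes r≡0) = record
        { α = 1# ; β = 0# ; γ = 0# ; δ = 1#
        ; det≢0 = λ eq → 1≢0 (use 1# eq (solve 0 (I := O :+ I :* (I :* I :- O :* O :- O)) refl))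
        ; maps = λ x → trans (vanishing {a} {b} same a≡0 _) (sym (trans (cong (λ z → 0# * x + 1# * z) (a≡0 x)) (solve 1 (λ x → O :* x :+ I :* O := O) refl x)))
        }
        where
        a≡0 : ∀ x → skewValue a x ≡ 0#
        a≡0 = vec-zero p≡0 r≡0

  -- Reduction of arbitrary φ-polynomials to the normalised cases.

  ~-reduced : ∀ p s r p′ s′ r′ → SameEigenvalues (vec₄ 0# p s r) (vec₄ 0# p′ s′ r′) → vec₄ 0# p s r ~ vec₄ 0# p′ s′ r′
  ~-reduced p s r p′ s′ r′ same = cases (s ≟ 0#) (s′ ≟ 0#)
    where
    open Invariants (vec₄ 0# p s r) (vec₄ 0# p′ s′ r′) same
    e₁ = invariant₁ refl refl
    e₂ : s * φ² s ≡ s′ * φ² s′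
    e₂ = invariant₂ refl refl
    e₃ = invariant₃ refl refl
    cases : Dec (s ≡ 0#) → Dec (s′ ≡ 0#) → vec₄ 0# p s r ~ vec₄ 0# p′ s′ r′
    cases (yes refl) (yes refl) = ~-binomial p r p′ r′ same e₁
    cases (yes refl) (no s′≢0) = contradiction (trans (sym e₂) (zeroˡ _)) (*-nonzero s′≢0 (φ-nonzero (φ-nonzero s′≢0)))
    -- Dividing both maps by s makes the coefficients of φ² equal to 1 and t = s′/s, and `e₂`
    -- becomes tφ²(t) = 1.
    cases (no s≢0) _ = ~-trans (~-diagonal {b = vec₄ 0# P 1# R} 1# i 1≢0 (inv≢0 s≢0) λ where
        0F → trans (zeroˡ _) (sym (zeroʳ _))
        1F → solve 2 (λ p i → p :* i :* Φ I := i :* p) refl p i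
        2F → trans (trans (*-identityˡ _) (ψ-1 2F)) (trans (sym si≡1) (*-comm s i))
        3F → solve 2 (λ p i → p :* i :* Φ³ I := i :* p) refl r i)
      (~-trans (~-trinomial P R t P′ R′ E₁ E₂ E₃) (~-diagonal 1# s 1≢0 s≢0 λ where
        0F → trans (zeroˡ _) (sym (zeroʳ _))
        1F → use (- p′) si≡1 (solve 3 (λ p s i → p :* Φ I := s :* (p :* i) :+ :- p :* (s :* i :- I)) refl p′ s i)
        2F → use (- s′) si≡1 (solve 3 (λ p s i → p :* Φ² I := s :* (p :* i) :+ :- p :* (s :* i :- I)) refl s′ s i)
        3F → use (- r′) si≡1 (solve 3 (λ p s i → p :* Φ³ I := s :* (p :* i) :+ :- p :* (s :* i :- I)) refl r′ s i)))
      where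
      i = inv s
      si≡1 : s * i ≡ 1#
      si≡1 = x*inv≡1 s≢0
      P = p * i
      R = r * i
      P′ = p′ * i
      R′ = r′ * i
      t = s′ * i
      E₁ : P * φ R ≡ P′ * φ R′
      E₁ = use (i * φ i) e₁ (solve 5 (λ p r p′ r′ i → p :* i :* Φ (r :* i) := p′ :* i :* Φ (r′ :* i) :+ i :* Φ i :* (p :* Φ r :- p′ :* Φ r′)) refl p r p′ r′ i)
      E₂ : t * φ² t ≡ 1#
      E₂ = begin
        t * φ² t                          ≡⟨ solve 2 (λ s i → s :* i :* Φ² (s :* i) := s :* Φ² s :* (i :* Φ² i)) refl s′ i ⟩
        s′ * φ² s′ * (i * φ² i)        ≡⟨ cong (_* (i * φ² i)) e₂ ⟨
        s * φ² s * (i * φ² i)          ≡⟨ solve 2 (λ s i → s :* Φ² s :* (i :* Φ² i) := s :* i :* Φ² (s :* i)) refl s i ⟩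
        s * i * φ² (s * i)                ≡⟨ cong (λ z → z * φ² z) si≡1 ⟩
        1# * φ² 1#                        ≡⟨ solve 0 (I :* Φ² I := I) refl ⟩
        1#                                   ∎
      E₃ : P * φ P + φ R * φ² R ≡ P′ * φ P′ * φ² t + t * φ R′ * φ² R′
      E₃ = use (i * φ i * φ² i) e₃ (use (- (P * φ P)) (cong φ² si≡1) (use (- (φ R * φ² R)) si≡1 (use (P * φ P) (sym (trans (cong φ φ-1) φ-1))
        (solve 7 (λ p s r p′ s′ r′ i →
          p :* i :* Φ (p :* i) :+ Φ (r :* i) :* Φ² (r :* i) := p′ :* i :* Φ (p′ :* i) :* Φ² (s′ :* i) :+ s′ :* i :* Φ (r′ :* i) :* Φ² (r′ :* i)
          :+ i :* Φ i :* Φ² i :* (p :* Φ p :* Φ² s :+ s :* Φ r :* Φ² r :- (p′ :* Φ p′ :* Φ² s′ :+ s′ :* Φ r′ :* Φ² r′))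
          :+ :- (p :* i :* Φ (p :* i)) :* (Φ² (s :* i) :- Φ² I) :+ :- (Φ (r :* i) :* Φ² (r :* i)) :* (s :* i :- I) :+ p :* i :* Φ (p :* i) :* (I :- Φ² I)) refl p s r p′ s′ r′ i))))

  -- Removing the coefficient of x translates the set of values by it, and `invariant₀` says that
  -- the translation is the same for both maps.
  equivalent : ∀ a b → SameEigenvalues a b → a ~ b
  equivalent a b same = ~-trans (~-shift (- a 0F) (sym (-‿inverseʳ _)) refl refl refl)
    (~-trans (~-reduced (a 1F) (a 2F) (a 3F) (b 1F) (b 2F) (b 3F) same′)
      (~-shift (b 0F) (sym (+-identityˡ _)) refl refl refl))
    where
    open Invariants a b same using (invariant₀)
    reduce : Skew → Skew
    reduce c = vec₄ 0# (c 1F) (c 2F) (c 3F)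
    reduce-value : ∀ c x → skewValue c x ≡ skewValue (reduce c) x + c 0F * x
    reduce-value c x = solve 3 (λ c x r → c :* x :+ r := O :* x :+ r :+ c :* x) refl (c 0F) x (c 1F * φ x + (c 2F * φ² x + (c 3F * φ³ x + 0#)))
    up : ∀ c z → EigenValue (skewValue (reduce c)) z → EigenValue (skewValue c) (z + c 0F)
    up c z (x , x≢0 , eq) = x , x≢0 , trans (reduce-value c x) (trans (cong (_+ c 0F * x) eq) (sym (distribʳ x z (c 0F))))
    down : ∀ c z → EigenValue (skewValue c) (z + c 0F) → EigenValue (skewValue (reduce c)) z
    down c z (x , x≢0 , eq) = x , x≢0 , use 1# (sym (reduce-value c x)) (use 1# eq
      (solve 5 (λ T C c z x → T := z :* x :+ I :* (T :+ c :* x :- C) :+ I :* (C :- (z :+ c) :* x)) refl (skewValue (reduce c) x) (skewValue c x) (c 0F) z x))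
    same′ : SameEigenvalues (reduce a) (reduce b)
    same′ z =
      (λ e → down b z (subst (λ w → EigenValue (skewValue b) (z + w)) invariant₀ (proj₁ (same (z + a 0F)) (up a z e)))) ,
      (λ e → down a z (subst (λ w → EigenValue (skewValue a) (z + w)) (sym invariant₀) (proj₂ (same (z + b 0F)) (up b z e))))

-- From linear sets to φ-polynomials.

module Simplicity (q : ℕ) (primePower : IsPrimePower q) (K : Field) (size : HasSize K (q ℕ.^ 4)) where

  open Field K
  open Geometry K q
  open ≡-Reasoning
  open Inverse size using (to; from; strictlyInverseˡ; strictlyInverseʳ)

  private
    module FF = FiniteField K size
    p k : ℕ
    p = proj₁ primePower
    k = proj₁ (proj₂ primePower)
    pr : Prime p
    pr = proj₁ (proj₂ (proj₂ primePower))
    q≡ : q ≡ p ℕ.^ suc k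
    q≡ = proj₂ (proj₂ (proj₂ primePower))

  -- The exponent is kept as q^1 so that `Fixed x` is `InSubfield 1 x` by definition.
  φ : Carrier → Carrier
  φ x = x ^ (q ℕ.^ 1)

  φ-+ : ∀ x y → φ (x + y) ≡ φ x + φ y
  φ-+ x y = subst (λ n → (x + y) ^ n ≡ x ^ n + y ^ n) p^≡ (FF.frobenius-+ pr (suc k ℕ.* 4) N≡ (suc k) x y)
    where
    p^≡ : p ℕ.^ suc k ≡ q ℕ.^ 1
    p^≡ = trans (sym q≡) (sym (ℕ.*-identityʳ q))
    N≡ : q ℕ.^ 4 ≡ p ℕ.^ (suc k ℕ.* 4)
    N≡ = trans (cong (ℕ._^ 4) q≡) (ℕ.^-*-assoc p (suc k) 4)

  φ-* : ∀ x y → φ (x * y) ≡ φ x * φ y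
  φ-* x y = FF.^-* x y (q ℕ.^ 1)

  φ-1 : φ 1# ≡ 1#
  φ-1 = FF.1^n≡1 (q ℕ.^ 1)

  φ⁴ : ∀ x → φ (φ (φ (φ x))) ≡ x
  φ⁴ x = begin
    φ (φ (φ (φ x)))              ≡⟨ cong (φ ∘ φ) (FF.^-^ x Q Q) ⟩
    φ (φ (x ^ (Q ℕ.* Q)))        ≡⟨ cong φ (FF.^-^ x (Q ℕ.* Q) Q) ⟩
    φ (x ^ (Q ℕ.* Q ℕ.* Q))      ≡⟨ FF.^-^ x (Q ℕ.* Q ℕ.* Q) Q ⟩
    x ^ (Q ℕ.* Q ℕ.* Q ℕ.* Q)    ≡⟨ cong (x ^_) (solve 1 (λ q → q :* con 1 :* (q :* con 1) :* (q :* con 1) :* (q :* con 1) := q :* (q :* (q :* (q :* con 1)))) refl q) ⟩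
    x ^ (q ℕ.^ 4)                ≡⟨ FF.x^N≡x x ⟩
    x                            ∎
    where
    open ℕSolver.+-*-Solver
    Q = q ℕ.^ 1

  frobenius : Frobenius K
  frobenius = record { φ = φ ; φ-+ = φ-+ ; φ-* = φ-* ; φ-1 = φ-1 ; φ⁴ = φ⁴ }

  open FrobeniusField K size frobenius
  open FP using () renaming (count to s)

  1<q : 1 ℕ.< q
  1<q = subst (1 ℕ.<_) (sym q≡) (ℕ.≤-<-trans (ℕ.m^n>0 p {{prime⇒nonZero pr}} k) (p^k<p^[1+k] k))
    where
    1<p : 1 ℕ.< p
    1<p = ℕ.nonTrivial⇒n>1 p {{prime⇒nonTrivial pr}}
    p^k<p^[1+k] : ∀ k → p ℕ.^ k ℕ.< p ℕ.^ suc k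
    p^k<p^[1+k] k = ℕ.^-monoʳ-< p 1<p (ℕ.n<1+n k)

  -- The fixed elements are roots of X^q - X.
  s≤q : s ℕ.≤ q
  s≤q = bound q 1<q (λ i → trans (cong (from (FP.element i) ^_) (sym (ℕ.*-identityʳ q))) (FP.sound i))
    where
    replicate-value : ∀ n x → monicValue (Vec.replicate n 0#) x ≡ x ^ n
    replicate-value zero    x = refl
    replicate-value (suc n) x = trans (+-identityˡ _) (cong (x *_) (replicate-value n x))
    bound : ∀ q → 1 ℕ.< q → (∀ i → from (FP.element i) ^ q ≡ from (FP.element i)) → s ℕ.≤ q
    bound 1 (s≤s ())
    bound (suc (suc q)) _ fixed = roots≤degree (0# ∷ - 1# ∷ Vec.replicate q 0#) (from ∘ FP.element)
      (λ {i} {j} eq → FP.injective (trans (sym (strictlyInverseˡ _)) (trans (cong to eq) (strictlyInverseˡ _))))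
      (λ i → let x = from (FP.element i) in begin
        0# + x * (- 1# + x * monicValue (Vec.replicate q 0#) x)   ≡⟨ cong (λ z → 0# + x * (- 1# + x * z)) (replicate-value q x) ⟩
        0# + x * (- 1# + x * x ^ q)                               ≡⟨ solve 2 (λ x y → O :+ x :* (:- I :+ x :* y) := x :* (x :* y) :- x) refl x (x ^ q) ⟩
        x ^ suc (suc q) - x                                       ≡⟨ cong (_- x) (fixed i) ⟩
        x - x                                                     ≡⟨ -‿inverseʳ x ⟩
        0#                                                        ∎)

  -- 0 and 1 are two fixed points. Consequently s^n increases strictly with n, as `dimension-≤`
  -- requires.
  1<s : 1 ℕ.< s
  1<s = F.injective⇒≤ {f = index} λ {i} {j} → index-injective i j
    where
    element : Fin 2 → Carrier
    element 0F = 0#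
    element 1F = 1#
    fixed : ∀ i → Fixed (element i)
    fixed 0F = φ-0
    fixed 1F = φ-1
    witness : ∀ i → ∃[ j ] FP.element j ≡ to (element i)
    witness i = FP.complete (to (element i)) (trans (cong φ (strictlyInverseʳ _)) (trans (fixed i) (sym (strictlyInverseʳ _))))
    index : Fin 2 → Fin s
    index i = proj₁ (witness i)
    index-value : ∀ i → from (FP.element (index i)) ≡ element i
    index-value i = trans (cong from (proj₂ (witness i))) (strictlyInverseʳ _)
    index-injective : ∀ i j → index i ≡ index j → i ≡ j
    index-injective i j eq = separate i j (trans (sym (index-value i)) (trans (cong (from ∘ FP.element) eq) (index-value j)))
      where
      separate : ∀ i j → element i ≡ element j → i ≡ j
      separate 0F 0F _  = refl
      separate 1F 1F _  = refl
      separate 0F 1F eq = contradiction eq 0≢1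
      separate 1F 0F eq = contradiction (sym eq) 0≢1

  decode : ∀ {n} → Fin (s ℕ.^ n) → Fin n → Carrier
  decode {n} k i = from (FP.element (F.finToFun {s} {n} k i))

  decode-fixed : ∀ {n} k i → Fixed (decode {n} k i)
  decode-fixed k i = FP.sound _

  decode-injective : ∀ {n} k l → (∀ i → decode {n} k i ≡ decode l i) → k ≡ l
  decode-injective {n} k l eq = begin
    k                                  ≡⟨ F.funToFin-finToFin {n} {s} k ⟨
    F.funToFin (F.finToFun {s} {n} k)  ≡⟨ funToFin-cong (λ i → FP.injective (trans (sym (strictlyInverseˡ _)) (trans (cong to (eq i)) (strictlyInverseˡ _)))) ⟩
    F.funToFin (F.finToFun {s} {n} l)  ≡⟨ F.funToFin-finToFin {n} {s} l ⟩
    l                                  ∎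

  encode : ∀ {n} → (c : Coeffs 1 n) → ∃[ k ] (∀ i → decode {n} k i ≡ proj₁ c i)
  encode {n} (c , fixed) = F.funToFin (proj₁ ∘ witness) ,
    λ i → trans (cong (from ∘ FP.element) (F.finToFun-funToFin (proj₁ ∘ witness) i)) (trans (cong from (proj₂ (witness i))) (strictlyInverseʳ _))
    where
    witness : ∀ i → ∃[ j ] FP.element j ≡ to (c i)
    witness i = FP.complete (to (c i)) (trans (cong φ (strictlyInverseʳ _)) (trans (fixed i) (sym (strictlyInverseʳ _))))

  lincomb-cong : ∀ {n} {c c′ : Fin n → Carrier} b → (∀ i → c i ≡ c′ i) → lincomb c b ≡ lincomb c′ b
  lincomb-cong {zero}  b eq = refl
  lincomb-cong {suc n} b eq = cong₂ _⊕_ (cong (_· b zero) (eq zero)) (lincomb-cong (b ∘ suc) (eq ∘ suc))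

  lincomb-∈ : ∀ {U n} → IsSubspace 1 U → (b : Fin n → W) → (∀ i → U (b i)) → ∀ c → (∀ i → Fixed (c i)) → U (lincomb c b)
  lincomb-∈ {n = zero}  sub b b∈U c fixed = IsSubspace.zero-mem sub
  lincomb-∈ {n = suc n} sub b b∈U c fixed = IsSubspace.add-mem sub
    (IsSubspace.smul-mem sub (fixed zero) (b∈U zero)) (lincomb-∈ sub (b ∘ suc) (b∈U ∘ suc) (c ∘ suc) (fixed ∘ suc))

  lincomb-difference : ∀ {n} (c c′ : Fin n → Carrier) b → lincomb c b ≡ lincomb c′ b → lincomb (λ i → c i - c′ i) b ≡ 𝟎
  lincomb-difference c c′ b eq = cong₂ _,_
    (trans (proj₁ (difference c c′ b)) (trans (cong (_- proj₁ (lincomb c′ b)) (cong proj₁ eq)) (-‿inverseʳ _)))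
    (trans (proj₂ (difference c c′ b)) (trans (cong (_- proj₂ (lincomb c′ b)) (cong proj₂ eq)) (-‿inverseʳ _)))
    where
    step : ∀ c c′ x r r′ → (c - c′) * x + (r - r′) ≡ (c * x + r) - (c′ * x + r′)
    step = solve 5 (λ c c′ x r r′ → (c :- c′) :* x :+ (r :- r′) := (c :* x :+ r) :- (c′ :* x :+ r′)) refl
    difference : ∀ {n} (c c′ : Fin n → Carrier) b →
      proj₁ (lincomb (λ i → c i - c′ i) b) ≡ proj₁ (lincomb c b) - proj₁ (lincomb c′ b) ×
      proj₂ (lincomb (λ i → c i - c′ i) b) ≡ proj₂ (lincomb c b) - proj₂ (lincomb c′ b)
    difference {zero}  c c′ b = sym (-‿inverseʳ 0#) , sym (-‿inverseʳ 0#)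
    difference {suc n} c c′ b = let (d₁ , d₂) = difference (c ∘ suc) (c′ ∘ suc) (b ∘ suc) in
      trans (cong ((c zero - c′ zero) * proj₁ (b zero) +_) d₁) (step (c zero) (c′ zero) (proj₁ (b zero)) _ _) ,
      trans (cong ((c zero - c′ zero) * proj₂ (b zero) +_) d₂) (step (c zero) (c′ zero) (proj₂ (b zero)) _ _)

  lincomb-injective : ∀ {U n} {b : Fin n → W} → IsBasis 1 U b → ∀ (c c′ : Fin n → Carrier) → (∀ i → Fixed (c i)) → (∀ i → Fixed (c′ i)) →
                      lincomb c b ≡ lincomb c′ b → ∀ i → c i ≡ c′ i
  lincomb-injective {b = b} basis c c′ fixed fixed′ eq i = x-y≡0⇒x≡y
    (IsBasis.indep basis ((λ i → c i - c′ i) , λ i → trans (trans (φ-+ _ _) (cong (φ (c i) +_) (φ-neg _))) (cong₂ _-_ (fixed i) (fixed′ i)))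
      (lincomb-difference c c′ b eq) i)

  -- The s^m combinations of the first basis are distinct, and each is one of the s^n combinations
  -- of the second.
  dimension-≤ : ∀ {U m n} → IsSubspace 1 U → HasDim 1 U m → HasDim 1 U n → m ℕ.≤ n
  dimension-≤ {U} {m} {n} sub (b , B) (b′ , B′) =
    ℕ.≮⇒≥ λ n<m → ℕ.<⇒≱ (ℕ.^-monoʳ-< s 1<s n<m) (F.injective⇒≤ {f = recode} λ {k} {l} → recode-injective k l)
    where
    vector : Fin (s ℕ.^ m) → W
    vector k = lincomb (decode k) b
    vector∈U : ∀ k → U (vector k)
    vector∈U k = lincomb-∈ sub b (IsBasis.in-U B) (decode k) (decode-fixed k)
    spans′ : ∀ k → Σ (Coeffs 1 n) λ c → vector k ≡ lincomb (proj₁ c) b′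
    spans′ k = IsBasis.spans B′ (vector k) (vector∈U k)
    recode : Fin (s ℕ.^ m) → Fin (s ℕ.^ n)
    recode k = proj₁ (encode (proj₁ (spans′ k)))
    vector-recode : ∀ k → vector k ≡ lincomb (decode (recode k)) b′
    vector-recode k = trans (proj₂ (spans′ k)) (lincomb-cong b′ (λ i → sym (proj₂ (encode (proj₁ (spans′ k))) i)))
    recode-injective : ∀ k l → recode k ≡ recode l → k ≡ l
    recode-injective k l eq = decode-injective k l (lincomb-injective B (decode k) (decode l) (decode-fixed k) (decode-fixed l)
      (trans (vector-recode k) (trans (cong (λ j → lincomb (decode j) b′) eq) (sym (vector-recode l)))))

  infix 4 _≟ᵂ_
  _≟ᵂ_ : (u v : W) → Dec (u ≡ v)
  _≟ᵂ_ = Product.≡-dec _≟_ _≟_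

  -- One representative for each of the q⁴ + 1 points of the line.
  point : Fin (suc (q ℕ.^ 4)) → W
  point zero    = 0# , 1#
  point (suc i) = 1# , from i

  point-injective : ∀ i j {x y} → x ≢ 0# → x · point i ≡ y · point j → i ≡ j
  point-injective zero    zero    x≢0 eq = refl
  point-injective zero    (suc j) {x} {y} x≢0 eq = contradiction (begin
      x                ≡⟨ *-identityʳ x ⟨
      x * 1#           ≡⟨ cong proj₂ eq ⟩
      y * from j       ≡⟨ cong (_* from j) y≡0 ⟩
      0# * from j      ≡⟨ zeroˡ _ ⟩
      0#               ∎) x≢0
    where
    y≡0 : y ≡ 0#
    y≡0 = trans (sym (*-identityʳ y)) (trans (sym (cong proj₁ eq)) (zeroʳ x))
  point-injective (suc i) zero    {x} {y} x≢0 eq = contradiction (trans (sym (*-identityʳ x)) (trans (cong proj₁ eq) (zeroʳ y))) x≢0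
  point-injective (suc i) (suc j) {x} {y} x≢0 eq = cong suc (trans (sym (strictlyInverseˡ i)) (trans (cong to i≡j) (strictlyInverseˡ j)))
    where
    i≡j : from i ≡ from j
    i≡j = *-cancelˡ x≢0 (trans (cong proj₂ eq) (cong (_* from j) (trans (sym (*-identityʳ y)) (trans (sym (cong proj₁ eq)) (*-identityʳ x)))))

  -- There are more points than vectors in U.
  point-outside : ∀ {U} → HasDim 1 U 4 → ∃[ i ] ¬ InLinSet U (point i)
  point-outside {U} (b , B) = cases (F.all? hits?)
    where
    Hits : Fin (suc (q ℕ.^ 4)) → Set
    Hits i = ∃[ k ] (lincomb (decode {4} k) b ≢ 𝟎 × ∃[ x ] lincomb (decode {4} k) b ≡ x · point i)
    hits? : ∀ i → Dec (Hits i)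
    hits? i = F.any? λ k → ¬? (lincomb (decode {4} k) b ≟ᵂ 𝟎) ×-dec ∃? (λ x → lincomb (decode {4} k) b ≟ᵂ x · point i)
    collide : ∀ i j (hᵢ : Hits i) (hⱼ : Hits j) → proj₁ hᵢ ≡ proj₁ hⱼ → i ≡ j
    collide i j (k , u≢0 , x , u≡x) (.k , _ , y , u≡y) refl = point-injective i j x≢0 (trans (sym u≡x) u≡y)
      where
      x≢0 : x ≢ 0#
      x≢0 x≡0 = u≢0 (trans u≡x (trans (cong (_· point i) x≡0) (cong₂ _,_ (zeroˡ _) (zeroˡ _))))
    cases : Dec (∀ i → Hits i) → ∃[ i ] ¬ InLinSet U (point i)
    cases (yes hits) = let (i , j , i<j , eq) = F.pigeonhole (s≤s (ℕ.^-monoˡ-≤ 4 s≤q)) (proj₁ ∘ hits) in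
      contradiction (collide i j (hits i) (hits j) eq) (F.<⇒≢ i<j)
    cases (no ¬hits) = let (i , ¬hit) = F.¬∀⟶∃¬ _ _ hits? ¬hits in i , λ (u , u∈U , u≢0 , x , u≡x) →
      let (c , u≡) = IsBasis.spans B u u∈U
          (k , decode≡) = encode c
          u≡′ = trans u≡ (lincomb-cong b (sym ∘ decode≡))
      in ¬hit (k , (λ eq → u≢0 (trans u≡′ eq)) , x , trans (sym u≡′) u≡x)

  matrix : Carrier → Carrier → Carrier → Carrier → W → W
  matrix α β γ δ (x , y) = α * x + β * y , γ * x + δ * y

  module _ (α β γ δ : Carrier) (det≢0 : α * δ - β * γ ≢ 0#) where

    private
      d i : Carrier
      d = α * δ - β * γ
      i = inv d
      di≡1 : d * i ≡ 1#
      di≡1 = x*inv≡1 det≢0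

    matrix⁻¹ : W → W
    matrix⁻¹ = matrix (δ * i) (- (β * i)) (- (γ * i)) (α * i)

    matrix-inverseˡ : ∀ w → matrix α β γ δ (matrix⁻¹ w) ≡ w
    matrix-inverseˡ (x , y) = cong₂ _,_
      (trans (solve 7 (λ α β γ δ i x y → α :* (δ :* i :* x :+ :- (β :* i) :* y) :+ β :* (:- (γ :* i) :* x :+ α :* i :* y) := (α :* δ :- β :* γ) :* i :* x) refl α β γ δ i x y)
        (trans (cong (_* x) di≡1) (*-identityˡ x)))
      (trans (solve 7 (λ α β γ δ i x y → γ :* (δ :* i :* x :+ :- (β :* i) :* y) :+ δ :* (:- (γ :* i) :* x :+ α :* i :* y) := (α :* δ :- β :* γ) :* i :* y) refl α β γ δ i x y)
        (trans (cong (_* y) di≡1) (*-identityˡ y)))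

    matrix-inverseʳ : ∀ w → matrix⁻¹ (matrix α β γ δ w) ≡ w
    matrix-inverseʳ (x , y) = cong₂ _,_
      (trans (solve 7 (λ α β γ δ i x y → δ :* i :* (α :* x :+ β :* y) :+ :- (β :* i) :* (γ :* x :+ δ :* y) := (α :* δ :- β :* γ) :* i :* x) refl α β γ δ i x y)
        (trans (cong (_* x) di≡1) (*-identityˡ x)))
      (trans (solve 7 (λ α β γ δ i x y → :- (γ :* i) :* (α :* x :+ β :* y) :+ α :* i :* (γ :* x :+ δ :* y) := (α :* δ :- β :* γ) :* i :* y) refl α β γ δ i x y)
        (trans (cong (_* y) di≡1) (*-identityˡ y)))

  record Linear : Set where
    field
      α β γ δ : Carrier
      det≢0   : α * δ - β * γ ≢ 0#

    apply apply⁻¹ : W → W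
    apply   = matrix α β γ δ
    apply⁻¹ = matrix⁻¹ α β γ δ det≢0

    inverseˡ : ∀ w → apply (apply⁻¹ w) ≡ w
    inverseˡ = matrix-inverseˡ α β γ δ det≢0

    inverseʳ : ∀ w → apply⁻¹ (apply w) ≡ w
    inverseʳ = matrix-inverseʳ α β γ δ det≢0

  matrix-⊕ : ∀ α β γ δ u v → matrix α β γ δ (u ⊕ v) ≡ matrix α β γ δ u ⊕ matrix α β γ δ v
  matrix-⊕ α β γ δ (x , y) (x′ , y′) = cong₂ _,_ (row α β x y x′ y′) (row γ δ x y x′ y′)
    where
    row : ∀ s t x y x′ y′ → s * (x + x′) + t * (y + y′) ≡ s * x + t * y + (s * x′ + t * y′)
    row = solve 6 (λ s t x y x′ y′ → s :* (x :+ x′) :+ t :* (y :+ y′) := s :* x :+ t :* y :+ (s :* x′ :+ t :* y′)) refl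

  matrix-· : ∀ α β γ δ c u → matrix α β γ δ (c · u) ≡ c · matrix α β γ δ u
  matrix-· α β γ δ c (x , y) = cong₂ _,_ (row α β x y c) (row γ δ x y c)
    where
    row : ∀ s t x y c → s * (c * x) + t * (c * y) ≡ c * (s * x + t * y)
    row = solve 5 (λ s t x y c → s :* (c :* x) :+ t :* (c :* y) := c :* (s :* x :+ t :* y)) refl

  matrix-𝟎 : ∀ α β γ δ → matrix α β γ δ 𝟎 ≡ 𝟎
  matrix-𝟎 α β γ δ = cong₂ _,_ (row α β) (row γ δ)
    where
    row : ∀ s t → s * 0# + t * 0# ≡ 0#
    row = solve 2 (λ s t → s :* O :+ t :* O := O) refl

  matrix-lincomb : ∀ α β γ δ {n} c (b : Fin n → W) →
    matrix α β γ δ (lincomb c b) ≡ (combine c (proj₁ ∘ matrix α β γ δ ∘ b) , combine c (proj₂ ∘ matrix α β γ δ ∘ b))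
  matrix-lincomb α β γ δ {zero}  c b = matrix-𝟎 α β γ δ
  matrix-lincomb α β γ δ {suc n} c b = trans (matrix-⊕ α β γ δ (c zero · b zero) _)
    (cong₂ _⊕_ (matrix-· α β γ δ (c zero) (b zero)) (matrix-lincomb α β γ δ (c ∘ suc) (b ∘ suc)))

  conjugate-ΓL : (M X : Linear) → IsΓL (Linear.apply⁻¹ M ∘ Linear.apply X ∘ Linear.apply M)
  conjugate-ΓL M X = record
    { σ        = id
    ; σ-aut    = record { pres-+ = λ _ _ → refl ; pres-* = λ _ _ → refl ; pres-1 = refl ; inj = id ; surj = λ y → y , id }
    ; additive = λ u v → trans (cong (M.apply⁻¹ ∘ X.apply) (matrix-⊕ _ _ _ _ u v))
        (trans (cong M.apply⁻¹ (matrix-⊕ _ _ _ _ (M.apply u) (M.apply v))) (matrix-⊕ _ _ _ _ (X.apply (M.apply u)) (X.apply (M.apply v))))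
    ; semilin  = λ c u → trans (cong (M.apply⁻¹ ∘ X.apply) (matrix-· _ _ _ _ c u))
        (trans (cong M.apply⁻¹ (matrix-· _ _ _ _ c (M.apply u))) (matrix-· _ _ _ _ c (X.apply (M.apply u))))
    ; inj      = λ {u} {v} eq → trans (sym (back u)) (trans (cong g⁻¹ eq) (back v))
    ; surj     = λ w → g⁻¹ w , λ { refl → forth w }
    }
    where
    module M = Linear M
    module X = Linear X
    g g⁻¹ : W → W
    g   = M.apply⁻¹ ∘ X.apply ∘ M.apply
    g⁻¹ = M.apply⁻¹ ∘ X.apply⁻¹ ∘ M.apply
    back : ∀ u → g⁻¹ (g u) ≡ u
    back u = trans (cong (M.apply⁻¹ ∘ X.apply⁻¹) (M.inverseˡ _)) (trans (cong M.apply⁻¹ (X.inverseʳ _)) (M.inverseʳ u))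
    forth : ∀ w → g (g⁻¹ w) ≡ w
    forth w = trans (cong (M.apply⁻¹ ∘ X.apply) (M.inverseˡ _)) (trans (cong M.apply⁻¹ (X.inverseˡ _)) (M.inverseʳ w))

  -- The chosen maps send w to (0, 1), so that the abscissa of a vector vanishes only on the point
  -- of w.
  record Coordinates (w : W) : Set where
    field
      linear : Linear
    open Linear linear public
    field
      kernel : ∀ u → proj₁ (apply u) ≡ 0# → ∃[ x ] u ≡ x · w

  coordinates : ∀ i → Coordinates (point i)
  coordinates zero = record
    { linear = record { α = 1# ; β = 0# ; γ = 0# ; δ = 1#
      ; det≢0 = λ eq → 0≢1 (sym (trans (solve 0 (I := I :* I :- O :* O) refl) eq)) }
    ; kernel = λ (x , y) eq → y , cong₂ _,_
        (trans (solve 2 (λ x y → x := I :* x :+ O :* y) refl x y) (trans eq (sym (zeroʳ y)))) (sym (*-identityʳ y)) }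
  coordinates (suc i) = record
    { linear = record { α = - z ; β = 1# ; γ = 1# ; δ = 0#
      ; det≢0 = λ eq → 0≢1 (sym (trans (solve 1 (λ z → I := :- (:- z :* O :- I :* I)) refl z) (trans (cong -_ eq) -0#≈0#))) }
    ; kernel = λ (x , y) eq → x , cong₂ _,_ (sym (*-identityʳ x))
        (x-y≡0⇒x≡y (trans (solve 3 (λ x y z → y :- x :* z := :- z :* x :+ I :* y) refl x y z) eq)) }
    where z = from i

  skewValue-combine : ∀ {m n} (a : Fin m → Carrier) (c x : Fin n → Carrier) → (∀ i → Fixed (c i)) →
                      skewValue a (combine c x) ≡ combine c (skewValue a ∘ x)
  skewValue-combine {n = zero}  a c x fixed = skewValue-0 a
  skewValue-combine {n = suc n} a c x fixed = trans (linear a (c zero) (x zero) _ (fixed zero))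
    (cong (c zero * skewValue a (x zero) +_) (skewValue-combine a (c ∘ suc) (x ∘ suc) (fixed ∘ suc)))
    where
    linear : ∀ {m} (a : Fin m → Carrier) c x y → Fixed c → skewValue a (c * x + y) ≡ c * skewValue a x + skewValue a y
    linear {zero}  a c x y fixed = solve 1 (λ c → O := c :* O :+ O) refl c
    linear {suc m} a c x y fixed = begin
      a zero * (c * x + y) + skewValue (a ∘ suc) (φ (c * x + y))
        ≡⟨ cong (λ z → a zero * (c * x + y) + skewValue (a ∘ suc) z) (trans (φ-+ _ _) (cong (_+ φ y) (trans (φ-* c x) (cong (_* φ x) fixed)))) ⟩
      a zero * (c * x + y) + skewValue (a ∘ suc) (c * φ x + φ y)
        ≡⟨ cong (a zero * (c * x + y) +_) (linear (a ∘ suc) c (φ x) (φ y) fixed) ⟩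
      a zero * (c * x + y) + (c * skewValue (a ∘ suc) (φ x) + skewValue (a ∘ suc) (φ y))
        ≡⟨ solve 6 (λ a c x y s t → a :* (c :* x :+ y) :+ (c :* s :+ t) := c :* (a :* x :+ s) :+ (a :* y :+ t)) refl
             (a zero) c x y (skewValue (a ∘ suc) (φ x)) (skewValue (a ∘ suc) (φ y)) ⟩
      c * (a zero * x + skewValue (a ∘ suc) (φ x)) + (a zero * y + skewValue (a ∘ suc) (φ y)) ∎

  module _ {w : W} (M : Coordinates w) where

    open Coordinates M

    record IsGraph (U : SubsetW) (a : Fin 4 → Carrier) : Set where
      field
        toGraph   : ∀ u → U u → proj₂ (apply u) ≡ skewValue a (proj₁ (apply u))
        fromGraph : ∀ u → proj₂ (apply u) ≡ skewValue a (proj₁ (apply u)) → U u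

    module _ {U : SubsetW} (sub : IsSubspace 1 U) (dim : HasDim 1 U 4) (w∉ : ¬ InLinSet U w) where

      private
        b = proj₁ dim
        B = proj₂ dim

      abscissa ordinate : Fin 4 → Carrier
      abscissa i = proj₁ (apply (b i))
      ordinate i = proj₂ (apply (b i))

      -- A relation among the abscissas produces a vector of U on the point of w. As that point is
      -- not in the linear set, the vector is 0, and `b` is a basis.
      abscissa-independent : Independent abscissa
      abscissa-independent c fixed cx≡0 = IsBasis.indep B (c , fixed) (cases (lincomb c b ≟ᵂ 𝟎))
        where
        cases : Dec (lincomb c b ≡ 𝟎) → lincomb c b ≡ 𝟎
        cases (yes eq)  = eq
        cases (no u≢0) = contradiction
          (lincomb c b , lincomb-∈ sub b (IsBasis.in-U B) c fixed , u≢0 ,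
           kernel (lincomb c b) (trans (cong proj₁ (matrix-lincomb α β γ δ c b)) cx≡0)) w∉

      slope : Fin 4 → Carrier
      slope = proj₁ (interpolation abscissa abscissa-independent ordinate)

      private
        apply-lincomb : ∀ c → (∀ i → Fixed (c i)) → apply (lincomb c b) ≡ (combine c abscissa , skewValue slope (combine c abscissa))
        apply-lincomb c fixed = trans (matrix-lincomb α β γ δ c b) (cong (combine c abscissa ,_) (begin
          combine c ordinate                          ≡⟨ combine-cong c (λ i → sym (proj₂ (interpolation abscissa abscissa-independent ordinate) i)) ⟩
          combine c (skewValue slope ∘ abscissa)      ≡⟨ skewValue-combine slope c abscissa fixed ⟨
          skewValue slope (combine c abscissa)        ∎))
          where
          combine-cong : ∀ {n} (c : Fin n → Carrier) {x y : Fin n → Carrier} → (∀ i → x i ≡ y i) → combine c x ≡ combine c y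
          combine-cong {zero}  c eq = refl
          combine-cong {suc n} c eq = cong₂ _+_ (cong (c zero *_) (eq zero)) (combine-cong (c ∘ suc) (eq ∘ suc))

      U⇒graph : ∀ u → U u → proj₂ (apply u) ≡ skewValue slope (proj₁ (apply u))
      U⇒graph u u∈U = let ((c , fixed) , u≡) = IsBasis.spans B u u∈U in
        subst (λ u → proj₂ (apply u) ≡ skewValue slope (proj₁ (apply u))) (sym u≡)
          (trans (cong proj₂ (apply-lincomb c fixed)) (sym (cong (skewValue slope ∘ proj₁) (apply-lincomb c fixed))))

      graph⇒U : ∀ u → proj₂ (apply u) ≡ skewValue slope (proj₁ (apply u)) → U u
      graph⇒U u eq = subst U v≡u (lincomb-∈ sub b (IsBasis.in-U B) coeff fixed)
        where
        open Spanned (independent₄⇒spans abscissa abscissa-independent (proj₁ (apply u)))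
        v≡u : lincomb coeff b ≡ u
        v≡u = trans (sym (inverseʳ _)) (trans (cong apply⁻¹ (trans (apply-lincomb coeff fixed)
          (cong₂ _,_ (sym value) (trans (cong (skewValue slope) (sym value)) (sym eq))))) (inverseʳ u))

      isGraph : ∃[ a ] IsGraph U a
      isGraph = slope , record { toGraph = U⇒graph ; fromGraph = graph⇒U }

  module Comparison {w : W} (M : Coordinates w) (basis : Fin 4 → Carrier) (independent : Independent basis) where

    private module M = Coordinates M
    open QuarticField K size frobenius basis independent
      using (_~_; SameEigenvalues; EigenValue; skewValue-+)

    module _ {U : SubsetW} {a : Fin 4 → Carrier} (graph : IsGraph M U a) where

      open IsGraph graph

      -- In the new coordinates (x, f(x)) represents the point (1, f(x)/x); together with the
      -- converse below, the affine coordinates of the linear set are the values f(x)/x.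
      eigen⇒point : ∀ z → EigenValue (skewValue a) z → InLinSet U (M.apply⁻¹ (1# , z))
      eigen⇒point z (x , x≢0 , eq) = M.apply⁻¹ (x , z * x) ,
        fromGraph _ (trans (cong proj₂ (M.inverseˡ _)) (trans (sym eq) (cong (skewValue a ∘ proj₁) (sym (M.inverseˡ _))))) ,
        (λ u≡0 → x≢0 (cong proj₁ (trans (sym (M.inverseˡ (x , z * x))) (trans (cong M.apply u≡0) (matrix-𝟎 M.α M.β M.γ M.δ))))) ,
        x , trans (cong M.apply⁻¹ (cong₂ _,_ (sym (*-identityʳ x)) (*-comm z x))) (matrix-· _ _ _ _ x (1# , z))

      point⇒eigen : ∀ z → InLinSet U (M.apply⁻¹ (1# , z)) → EigenValue (skewValue a) z
      point⇒eigen z (u , u∈U , u≢0 , x , u≡) = x , x≢0 , (begin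
        skewValue a x                     ≡⟨ cong (skewValue a ∘ proj₁) Mu ⟨
        skewValue a (proj₁ (M.apply u))   ≡⟨ toGraph u u∈U ⟨
        proj₂ (M.apply u)                 ≡⟨ cong proj₂ Mu ⟩
        z * x                             ∎)
        where
        Mu : M.apply u ≡ (x , z * x)
        Mu = trans (cong M.apply u≡) (trans (matrix-· M.α M.β M.γ M.δ x (M.apply⁻¹ (1# , z)))
          (trans (cong (x ·_) (M.inverseˡ (1# , z))) (cong₂ _,_ (*-identityʳ x) (*-comm x z))))
        x≢0 : x ≢ 0#
        x≢0 x≡0 = u≢0 (trans u≡ (trans (cong (_· M.apply⁻¹ (1# , z)) x≡0) (cong₂ _,_ (zeroˡ _) (zeroˡ _))))

    module _ {U V : SubsetW} {a b : Fin 4 → Carrier} (graphU : IsGraph M U a) (graphV : IsGraph M V b) where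

      private
        module U = IsGraph graphU
        module V = IsGraph graphV

      sameEigenvalues : SameLinSet U V → SameEigenvalues a b
      sameEigenvalues same z =
        (λ e → point⇒eigen graphV z (proj₁ (same _ nonzero) (eigen⇒point graphU z e))) ,
        (λ e → point⇒eigen graphU z (proj₂ (same _ nonzero) (eigen⇒point graphV z e)))
        where
        nonzero : M.apply⁻¹ (1# , z) ≢ 𝟎
        nonzero eq = 0≢1 (sym (cong proj₁ (trans (sym (M.inverseˡ (1# , z))) (trans (cong M.apply eq) (matrix-𝟎 M.α M.β M.γ M.δ)))))

      module _ (a~b : a ~ b) where

        private module E = _~_ a~b

        X : Linear
        X = record { α = E.α ; β = E.β ; γ = E.γ ; δ = E.δ ; det≢0 = E.det≢0 }

        g : W → W
        g u = M.apply⁻¹ (Linear.apply X (M.apply u))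

        image : ∀ v → (Σ W λ u → U u × g u ≡ v) → V v
        image v (u , u∈U , refl) = V.fromGraph _ (begin
          proj₂ (M.apply (g u))             ≡⟨ cong proj₂ (M.inverseˡ (Linear.apply X (M.apply u))) ⟩
          E.γ * x + E.δ * y                                             ≡⟨ cong (λ y → E.γ * x + E.δ * y) y≡ax ⟩
          E.γ * x + E.δ * skewValue a x                                 ≡⟨ E.maps x ⟨
          skewValue b (E.α * x + E.β * skewValue a x)                   ≡⟨ cong (λ y → skewValue b (E.α * x + E.β * y)) y≡ax ⟨
          skewValue b (E.α * x + E.β * y)                               ≡⟨ cong (skewValue b ∘ proj₁) (M.inverseˡ (Linear.apply X (M.apply u))) ⟨
          skewValue b (proj₁ (M.apply (g u))) ∎)
          where
          x = proj₁ (M.apply u)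
          y = proj₂ (M.apply u)
          y≡ax : y ≡ skewValue a x
          y≡ax = U.toGraph u u∈U

        -- The effect of `X` on the abscissas of the graph. Being injective on the finite K it is
        -- onto, so the image of the first graph is all of the second.
        h : Carrier → Carrier
        h x = E.α * x + E.β * skewValue a x

        h-kernel : ∀ x → h x ≡ 0# → x ≡ 0#
        h-kernel x hx≡0 = xy≡0⇒y≡0 E.det≢0 (begin
          (E.α * E.δ - E.β * E.γ) * x
            ≡⟨ solve 6 (λ α β γ δ x f → (α :* δ :- β :* γ) :* x := δ :* (α :* x :+ β :* f) :- β :* (γ :* x :+ δ :* f)) refl E.α E.β E.γ E.δ x (skewValue a x) ⟩
          E.δ * h x - E.β * (E.γ * x + E.δ * skewValue a x)
            ≡⟨ cong₂ (λ s t → E.δ * s - E.β * t) hx≡0 (trans (sym (E.maps x)) (trans (cong (skewValue b) hx≡0) (skewValue-0 b))) ⟩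
          E.δ * 0# - E.β * 0#
            ≡⟨ solve 2 (λ s t → s :* O :- t :* O := O) refl E.δ E.β ⟩
          0# ∎)

        h-injective : ∀ {x x′} → h x ≡ h x′ → x ≡ x′
        h-injective {x} {x′} eq = x-y≡0⇒x≡y (h-kernel (x - x′) (begin
          E.α * (x - x′) + E.β * skewValue a (x - x′)
            ≡⟨ solve 6 (λ α β x x′ f f′ → α :* (x :- x′) :+ β :* f := (α :* x :+ β :* (f :+ f′)) :- (α :* x′ :+ β :* f′)) refl E.α E.β x x′ (skewValue a (x - x′)) (skewValue a x′) ⟩
          (E.α * x + E.β * (skewValue a (x - x′) + skewValue a x′)) - h x′
            ≡⟨ cong (λ z → (E.α * x + E.β * z) - h x′) (trans (sym (skewValue-+ a (x - x′) x′)) (cong (skewValue a) (solve 2 (λ x y → x :- y :+ y := x) refl x x′))) ⟩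
          h x - h x′                      ≡⟨ cong (_- h x′) eq ⟩
          h x′ - h x′                     ≡⟨ -‿inverseʳ _ ⟩
          0#                              ∎))

        h-surjective : ∀ y → ∃[ x ] h x ≡ y
        h-surjective y = let (i , eq) = Fin-injective⇒surjective (to ∘ h ∘ from)
                               (λ {i} {j} eq → trans (sym (strictlyInverseˡ i)) (trans (cong to (h-injective (trans (sym (strictlyInverseʳ _)) (trans (cong from eq) (strictlyInverseʳ _))))) (strictlyInverseˡ j)))
                               (to y)
          in from i , trans (sym (strictlyInverseʳ _)) (trans (cong from eq) (strictlyInverseʳ y))

        preimage : ∀ v → V v → Σ W λ u → U u × g u ≡ v
        preimage v v∈V = u , U.fromGraph u (trans (cong proj₂ Mu) (sym (cong (skewValue a ∘ proj₁) Mu))) , (begin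
          g u                                          ≡⟨ cong (M.apply⁻¹ ∘ Linear.apply X) Mu ⟩
          M.apply⁻¹ (h x , E.γ * x + E.δ * skewValue a x)  ≡⟨ cong (λ z → M.apply⁻¹ (h x , z)) (E.maps x) ⟨
          M.apply⁻¹ (h x , skewValue b (h x))          ≡⟨ cong (λ z → M.apply⁻¹ (z , skewValue b z)) hx≡ ⟩
          M.apply⁻¹ (proj₁ (M.apply v) , skewValue b (proj₁ (M.apply v)))
            ≡⟨ cong (λ z → M.apply⁻¹ (proj₁ (M.apply v) , z)) (V.toGraph v v∈V) ⟨
          M.apply⁻¹ (M.apply v)                        ≡⟨ M.inverseʳ v ⟩
          v                                            ∎)
          where
          x = proj₁ (h-surjective (proj₁ (M.apply v)))
          hx≡ : h x ≡ proj₁ (M.apply v)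
          hx≡ = proj₂ (h-surjective (proj₁ (M.apply v)))
          u = M.apply⁻¹ (x , skewValue a x)
          Mu : M.apply u ≡ (x , skewValue a x)
          Mu = M.inverseˡ (x , skewValue a x)

        imageIs : ImageIs g U V
        imageIs v = preimage v , image v

  simple : ∀ U → IsSubspace 1 U → HasDim 1 U 4 → IsSimple U
  simple U subU dimU V n subV dimU′ dimV same =
    conclude (subst (HasDim 1 V) (ℕ.≤-antisym (dimension-≤ subU dimU′ dimU) (dimension-≤ subU dimU dimU′)) dimV)
      (point-outside dimU)
    where
    w≢0 : ∀ i → point i ≢ 𝟎
    w≢0 zero    eq = 0≢1 (sym (cong proj₂ eq))
    w≢0 (suc i) eq = 0≢1 (sym (cong proj₁ eq))
    conclude : HasDim 1 V 4 → (∃[ i ] ¬ InLinSet U (point i)) → Σ (W → W) λ g → IsΓL g × ImageIs g U V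
    -- The same point is missed by L_V, so one change of coordinates turns both U and V into graphs.
    conclude dimV (i , w∉U) = finish (coordinates i) w∉U (w∉U ∘ proj₂ (same (point i) (w≢0 i)))
      where
      finish : ∀ {w} → Coordinates w → ¬ InLinSet U w → ¬ InLinSet V w → Σ (W → W) λ g → IsΓL g × ImageIs g U V
      -- The four independent elements of K that `QuarticField` asks for are the abscissas of the
      -- basis of U.
      finish M w∉U w∉V = compare (abscissa M subU dimU w∉U) (abscissa-independent M subU dimU w∉U) (isGraph M subU dimU w∉U) (isGraph M subV dimV w∉V)
        where
        compare : ∀ basis → Independent basis → (∃[ a ] IsGraph M U a) → (∃[ b ] IsGraph M V b) → Σ (W → W) λ g → IsΓL g × ImageIs g U V
        compare basis independent (a , graphU) (b , graphV) =
          g graphU graphV a~b , conjugate-ΓL (Coordinates.linear M) (X graphU graphV a~b) , imageIs graphU graphV a~b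
          where
          open Comparison M basis independent
          a~b = QuarticField.equivalent K size frobenius basis independent a b (sameEigenvalues graphU graphV same)

open import Data.Nat using (_^_)

theorem4p5 : (q : ℕ) → IsPrimePower q → (K : Field) → HasSize K (q ^ 4) →
    (U : Geometry.SubsetW K q) → Geometry.IsSubspace K q 1 U → Geometry.HasDim K q 1 U 4 →
    Geometry.MaxFieldIsFq K q U → Geometry.IsSimple K q U
theorem4p5 q primePower K size U subU dimU _ = Simplicity.simple q primePower K size U subU dimU
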